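{- The following two statements are equivalent. (A) For every cubic graph $G$ and every perfect matching $\mathcal M$ of $G$ such that $G/\mathcal M$ is $4$-connected, $G$ contains a cycle which dominates $\mathcal M$. (DCC) Every cyclically $4$-edge connected cubic graph has a dominating cycle.
   Context: All graphs are finite and loopless (multiple edges are allowed). Cubic means $3$-regular. A graph $G$ is $k$-connected if $|V(G)|>k$ and $G-X$ is connected for every $X\subseteq V(G)$ with $|X|<k$. A cycle dominates a matching $\mathcal M$ of a graph $G$ if the cycle contains at least one endvertex of each edge of $\mathcal M$. $G/\mathcal M$ denotes the graph which results from $G$ by contracting each edge of $\mathcal M$ to a distinct vertex. A dominating cycle of a graph $G$ is a cycle of $G$ which contains at least one endvertex of every edge of $G$. An edge cut of a connected graph $G$ is a set $E'\subseteq E(G)$ such that $G-E'$ is disconnected; it is a cyclic edge cut if at least two components of $G-E'$ are not trees. If $G$ contains two vertex-disjoint cycles, $\lambda_c(G)$ denotes the minimum size of a cyclic edge cut of $G$. A connected cubic graph $G$ is cyclically $4$-edge connected if $\lambda_c(G)\ge 4$. -}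

module Defs where

open import Data.Bool.Properties using (T-≡)
open import Data.Fin using (Fin)
open import Data.Fin.Properties using (_≟_)
open import Data.Fin.Subset
  using (Subset; _∈_; _∉_; _⊆_; ∣_∣; ⊤; ∁; Nonempty)
open import Data.Fin.Subset.Properties using (_∈?_; ∈⊤)
open import Data.List using (List; allFin; filter; length; lookup)
open import Data.List.Membership.Propositional.Properties
  using (∈-filter⁺; ∈-allFin; ∈-lookup)
open import Data.List.Relation.Unary.All as All using ()
open import Data.List.Relation.Unary.All.Properties using (all-filter)
open import Data.List.Relation.Unary.Any using (index)
open import Data.Nat using (ℕ; _≤_; _<_)
open import Data.Product using (∃-syntax; _×_; _,_; proj₁; proj₂; map)
open import Data.Sum using (_⊎_; inj₁; inj₂)
open import Data.Vec using (tabulate)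
open import Data.Vec.Properties using (lookup∘tabulate; []=⇒lookup)
open import Function using (_∘_)
open import Function.Bundles using (Equivalence)
open import Relation.Binary.Construct.Closure.ReflexiveTransitive using (Star)
open import Relation.Binary.PropositionalEquality
  using (_≡_; _≢_; refl; sym; trans)
open import Relation.Nullary using (¬_; Dec)
open import Relation.Nullary.Decidable
  using (_×-dec_; _⊎-dec_; ¬?; toWitness; isYes)
open import Relation.Unary using (Pred; Decidable)
open import Level using (0ℓ)

⟦_⟧ : ∀ {n} {P : Pred (Fin n) 0ℓ} → Decidable P → Subset n
⟦ P? ⟧ = tabulate (isYes ∘ P?)

∈⟦⟧⁻ : ∀ {n} {P : Pred (Fin n) 0ℓ} (P? : Decidable P) {x} → x ∈ ⟦ P? ⟧ → P x
∈⟦⟧⁻ P? {x} x∈ = toWitness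
  (Equivalence.from T-≡
    (trans (sym (lookup∘tabulate (isYes ∘ P?) x)) ([]=⇒lookup x∈)))

-- Edges are labelled, so parallel edges are allowed.  The order in which
-- `ends` lists the two endvertices of an edge carries no meaning.
record Graph : Set where
  field
    order size : ℕ
    ends       : Fin size → Fin order × Fin order
    loopless   : ∀ e → proj₁ (ends e) ≢ proj₂ (ends e)

  Vertex Edge : Set
  Vertex = Fin order
  Edge   = Fin size

  Incident : Vertex → Edge → Set
  Incident v e = v ≡ proj₁ (ends e) ⊎ v ≡ proj₂ (ends e)

  incident? : ∀ v e → Dec (Incident v e)
  incident? v e = (v ≟ proj₁ (ends e)) ⊎-dec (v ≟ proj₂ (ends e))

  Joins : Edge → Vertex → Vertex → Set
  Joins e u v = ends e ≡ (u , v) ⊎ ends e ≡ (v , u)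

module _ (G : Graph) where
  open Graph G

  record Subgraph : Set where
    field
      vertices : Subset order
      edges    : Subset size
      closed   : ∀ {e v} → e ∈ edges → Incident v e → v ∈ vertices

module _ {G : Graph} where
  open Graph G
  open Subgraph

  infix 4 _⊑_

  _⊑_ : Subgraph G → Subgraph G → Set
  H ⊑ K = vertices H ⊆ vertices K × edges H ⊆ edges K

  degree : Subgraph G → Vertex → ℕ
  degree H v = ∣ ⟦ (λ e → (e ∈? edges H) ×-dec incident? v e) ⟧ ∣

  Adjacent : Subgraph G → Vertex → Vertex → Set
  Adjacent H u v = ∃[ e ] e ∈ edges H × Joins e u v

  Connected : Subgraph G → Set
  Connected H = Nonempty (vertices H)
    × (∀ {u v} → u ∈ vertices H → v ∈ vertices H → Star (Adjacent H) u v)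

  -- Two parallel edges form a cycle of length 2.
  IsCycle : Subgraph G → Set
  IsCycle C = Connected C × (∀ {v} → v ∈ vertices C → degree C v ≡ 2)

  IsTree : Subgraph G → Set
  IsTree T = Connected T × ¬ (∃[ C ] IsCycle C × C ⊑ T)

  IsComponent : Subgraph G → Subgraph G → Set
  IsComponent H K = K ⊑ H × Connected K
    × (∀ K′ → K′ ⊑ H → Connected K′ → K ⊑ K′ → K′ ⊑ K)

  Disjoint : Subgraph G → Subgraph G → Set
  Disjoint H K = ∀ {v} → v ∈ vertices H → v ∉ vertices K

module _ (G : Graph) where
  open Graph G
  open Subgraph

  whole : Subgraph G
  whole = record { vertices = ⊤ ; edges = ⊤ ; closed = λ _ _ → ∈⊤ }

  Cubic : Set
  Cubic = ∀ v → degree whole v ≡ 3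

  deleteVertices : Subset order → Subgraph G
  deleteVertices X = record
    { vertices = ∁ X
    ; edges    = ⟦ both? ⟧
    ; closed   = λ { e∈ (inj₁ refl) → proj₁ (∈⟦⟧⁻ both? e∈)
                   ; e∈ (inj₂ refl) → proj₂ (∈⟦⟧⁻ both? e∈) }
    }
    where
    both? : Decidable λ e → proj₁ (ends e) ∈ ∁ X × proj₂ (ends e) ∈ ∁ X
    both? e = (proj₁ (ends e) ∈? ∁ X) ×-dec (proj₂ (ends e) ∈? ∁ X)

  deleteEdges : Subset size → Subgraph G
  deleteEdges F = record
    { vertices = ⊤ ; edges = ∁ F ; closed = λ _ _ → ∈⊤ }

  VertexConnected : ℕ → Set
  VertexConnected k = k < order
    × (∀ X → ∣ X ∣ < k → Connected (deleteVertices X))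

  IsEdgeCut : Subset size → Set
  IsEdgeCut F = ¬ Connected (deleteEdges F)

  IsCyclicEdgeCut : Subset size → Set
  IsCyclicEdgeCut F = IsEdgeCut F
    × ∃[ K ] ∃[ L ] IsComponent (deleteEdges F) K
                  × IsComponent (deleteEdges F) L
                  × ¬ (K ⊑ L × L ⊑ K)
                  × ¬ IsTree K × ¬ IsTree L

  -- `IsCyclicEdgeConnectivity l` says that λ_c is defined and equal to l.  It
  -- is a relation because λ_c is defined only in the presence of two
  -- vertex-disjoint cycles; K₄ and K₃,₃, for example, have no λ_c.
  IsCyclicEdgeConnectivity : ℕ → Set
  IsCyclicEdgeConnectivity l =
      (∃[ C ] ∃[ D ] IsCycle {G} C × IsCycle {G} D × Disjoint C D)
    × (∃[ F ] IsCyclicEdgeCut F × ∣ F ∣ ≡ l)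
    × (∀ F → IsCyclicEdgeCut F → l ≤ ∣ F ∣)

  CyclicallyEdgeConnected : ℕ → Set
  CyclicallyEdgeConnected k = Connected whole
    × ∃[ l ] IsCyclicEdgeConnectivity l × k ≤ l

  record PerfectMatching : Set where
    field
      matching : Subset size
      disjoint : ∀ {e f v} → e ∈ matching → f ∈ matching →
                 Incident v e → Incident v f → e ≡ f
      covering : ∀ v → ∃[ e ] e ∈ matching × Incident v e

-- The vertices of G/M are the edges of M, numbered by their position in
-- `contracted`; `π` sends each vertex of G to the M-edge covering it.  The
-- edges of G/M are the edges of G whose ends are not identified by `π`: this
-- drops M itself, and also any edge parallel to an edge of M, which would
-- become a loop.
module Contraction (G : Graph) (M : PerfectMatching G) where
  open Graph G
  open PerfectMatching M

  contracted : List Edge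
  contracted = filter (_∈? matching) (allFin size)

  π : Vertex → Fin (length contracted)
  π v with e , e∈M , _ ← covering v =
    index (∈-filter⁺ (_∈? matching) (∈-allFin e) e∈M)

  Survives : Pred Edge 0ℓ
  Survives e = π (proj₁ (ends e)) ≢ π (proj₂ (ends e))

  survives? : Decidable Survives
  survives? e = ¬? (π (proj₁ (ends e)) ≟ π (proj₂ (ends e)))

  surviving : List Edge
  surviving = filter survives? (allFin size)

  quotient : Graph
  quotient = record
    { order    = length contracted
    ; size     = length surviving
    ; ends     = map π π ∘ ends ∘ lookup surviving
    ; loopless = λ i →
        All.lookup (all-filter survives? (allFin size)) (∈-lookup i)
    }

infix 6 _/ᴹ_

_/ᴹ_ : (G : Graph) → PerfectMatching G → Graph
G /ᴹ M = Contraction.quotient G M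

module _ {G : Graph} where
  open Graph G
  open Subgraph

  Dominates : Subgraph G → Subset size → Set
  Dominates C F = ∀ {e} → e ∈ F → ∃[ v ] v ∈ vertices C × Incident v e

  IsDominatingCycle : Subgraph G → Set
  IsDominatingCycle C = IsCycle C × Dominates C ⊤

{-# OPTIONS --safe #-}
module Submission where

-- For (A) ⇒ (DCC), replace every vertex of G by a triangle and let M be the set of original edges: G^Δ/M is
-- the line graph of G, which is 4-connected when λ_c(G) ≥ 4, and a cycle dominating M projects to a
-- dominating cycle of G.
-- For (DCC) ⇒ (A), 4-connectedness of G/M forces every edge cut of size at most 3 to have no M-edge on one of
-- its sides, so its only possible cyclic such sides are triangles of G − M.  Contracting these triangles gives a
-- cubic graph H without cyclic edge cuts of size at most 3, and a dominating cycle of H lifts to a cycle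
-- dominating M.  If H has no two disjoint cycles, λ_c(H) is undefined and (DCC) does not apply, but then
-- a shortest cycle C has length at most 4 or is spanning, and C or a detour of C is dominating.

open import Defs
open import Data.Bool using (Bool; true; false; if_then_else_; not; _∧_; _xor_)
open import Data.Bool.Properties using (T-≡)
import Data.Empty as Empty
open import Data.Fin using (Fin; zero; suc; fromℕ<; combine; remQuot; splitAt; _↑ˡ_; _↑ʳ_)
import Data.Fin.Properties as Fin
open import Data.Fin.Properties
  using (_≟_; any?; all?; splitAt-↑ˡ; splitAt-↑ʳ; splitAt⁻¹-↑ˡ; splitAt⁻¹-↑ʳ; remQuot-combine; combine-remQuot;
         combine-injective; ↑ˡ-injective; ↑ʳ-injective)
open import Data.Fin.Subset
open import Data.Fin.Subset.Properties
open import Data.List using (List; []; _∷_; length; lookup; allFin; filter; map)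
import Data.List.Membership.Propositional as Mem
open import Data.List.Membership.Propositional.Properties using (∈-lookup; ∈-filter⁺; ∈-filter⁻; ∈-allFin)
open import Data.List.Relation.Unary.All as All using (All; []; _∷_)
open import Data.List.Relation.Unary.All.Properties using (all-filter)
open import Data.List.Relation.Unary.AllPairs using ([]; _∷_)
open import Data.List.Relation.Unary.Any using (here; there; index)
open import Data.List.Relation.Unary.Any.Properties using (lookup-index)
open import Data.List.Relation.Unary.Unique.Propositional using (Unique)
open import Data.List.Relation.Unary.Unique.Propositional.Properties using (filter⁺; allFin⁺)
open import Data.Nat using (ℕ; zero; suc; _+_; _*_; _≤_; _<_; z≤n; s≤s; _<?_)
open import Data.Nat.ListAction using (sum)
import Data.Nat.Properties as ℕ
open import Data.Nat.Properties
  using (≤-trans; ≤-refl; ≤-reflexive; ≤-pred; n≤1+n; 1+n≰n; m≤n⇒m≤1+n; ≮⇒≥; suc-injective; +-suc; +-comm;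
         +-identityʳ; +-monoʳ-≤; +-monoˡ-≤; +-mono-≤; +-cancelˡ-≤)
open import Data.Nat.Solver using (module +-*-Solver)
open import Data.Product as Product using (∃; ∃-syntax; _×_; _,_; proj₁; proj₂; uncurry)
open import Data.Product.Properties using (≡-dec)
open import Data.Sum using (_⊎_; inj₁; inj₂; swap) renaming ([_,_]′ to [_,_])
open import Data.Vec using ([]; _∷_; here; there)
open import Data.Vec.Properties using (lookup∘tabulate; lookup⇒[]=)
open import Function using (_∘_; id)
open import Function.Bundles using (Equivalence; _⇔_; mk⇔)
open import Level using (0ℓ)
open import Relation.Binary.Construct.Closure.ReflexiveTransitive as Star using (Star; ε; _◅_; _◅◅_)
open import Relation.Binary.PropositionalEquality
  using (_≡_; _≢_; refl; sym; trans; cong; cong₂; subst; subst₂; ≢-sym; module ≡-Reasoning)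
open import Relation.Nullary using (¬_; Dec; yes; no; contradiction; does)
open import Relation.Nullary.Decidable using (fromWitness; isYes; _×-dec_; _⊎-dec_; _→-dec_; ¬?; map′)
open import Relation.Unary using (Pred; Decidable)

-- Counting in finite sets

-- One count serves both the line graph and the case without disjoint cycles: in a cubic graph, a
-- nonempty vertex set that induces a forest with n vertices and c components has n + 2c, hence at
-- least n + 2, boundary edges. So an edge cut of size at most 3 with two or more vertices on either
-- side has a cycle on either side, and three vertices separating the line graph would be such a cut
-- of G. In the other direction an edge cut of G appears in G/M as a mixture: crossing M-edges
-- become vertices, the other crossing edges stay edges. Each such edge is traded for one of its
-- ends until a vertex cut remains. A side without M-edges sends the M-edge of each of its vertices
-- across the cut, so it has at most three vertices; 4-connectedness also excludes parallel edges
-- outside M, and only a triangle can be left. The value λ_c(H) presupposes a minimum cyclic edge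
-- cut, which is obtained only under double negation. A search through all pairs of vertex set and
-- edge set decides whether H has a dominating cycle, and this removes the double negation.

∈⟦⟧⁺ : ∀ {n} {P : Pred (Fin n) 0ℓ} (P? : Decidable P) {x} → P x → x ∈ ⟦ P? ⟧
∈⟦⟧⁺ P? {x} px = lookup⇒[]= x _
  (trans (lookup∘tabulate (isYes ∘ P?) x) (Equivalence.to T-≡ (fromWitness px)))

bit : ∀ {P : Set} → Dec P → ℕ
bit d = if does d then 1 else 0

bit-yes : ∀ {P : Set} (d : Dec P) → P → bit d ≡ 1
bit-yes (yes _) _ = refl
bit-yes (no ¬p) p = contradiction p ¬p

bit-no : ∀ {P : Set} (d : Dec P) → ¬ P → bit d ≡ 0
bit-no (yes p) ¬p = contradiction p ¬p
bit-no (no _)  _  = refl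

bit-cong : ∀ {P Q : Set} (d : Dec P) (e : Dec Q) → (P → Q) → (Q → P) → bit d ≡ bit e
bit-cong (yes p) e f g = sym (bit-yes e (f p))
bit-cong (no ¬p) e f g = sym (bit-no e (¬p ∘ g))

x∉p-x : ∀ {n} (p : Subset n) {x} → x ∉ p - x
x∉p-x (_ ∷ p) {zero}  ()
x∉p-x (_ ∷ p) {suc x} (there h) = x∉p-x p h

∈-minus⁻ : ∀ {n} (p : Subset n) {x y} → x ∈ p - y → x ∈ p × x ≢ y
∈-minus⁻ p {x} {y} h = p─q⊆p p ⁅ y ⁆ h , λ { refl → x∉p-x p h }

∣minus∣ : ∀ {n} (p : Subset n) {x} → x ∈ p → ∣ p ∣ ≡ suc ∣ p - x ∣
∣minus∣ (inside ∷ p) {zero} here = cong (suc ∘ ∣_∣) (sym (p─⊥≡p p))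
∣minus∣ (inside ∷ p) {suc x} (there h) = cong suc (∣minus∣ p h)
∣minus∣ (outside ∷ p) {suc x} (there h) = ∣minus∣ p h

empty-card : ∀ {n} (p : Subset n) → (∀ {x} → x ∉ p) → ∣ p ∣ ≡ 0
empty-card {n} p none with Empty-unique {p = p} (λ (x , h) → none h)
... | refl = ∣⊥∣≡0 n

card-list : ∀ {n} (p : Subset n) (xs : List (Fin n)) → Unique xs →
            (∀ {x} → x ∈ p → x Mem.∈ xs) → ∣ p ∣ ≡ sum (map (λ x → bit (x ∈? p)) xs)
card-list p [] _ cover = empty-card p (λ h → contradiction (cover h) λ ())
card-list p (x ∷ xs) (x∉xs ∷ u) cover = trans (lem (x ∈? p)) (cong (bit (x ∈? p) +_) rest)
  where
  lem : (d : Dec (x ∈ p)) → ∣ p ∣ ≡ bit d + ∣ p - x ∣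
  lem (yes h) = ∣minus∣ p h
  lem (no ¬h) = cong ∣_∣ (⊆-antisym (λ {y} h → x∈p∧x≢y⇒x∈p-y h (λ { refl → ¬h h })) (p─q⊆p p ⁅ x ⁆))
  cover′ : ∀ {y} → y ∈ p - x → y Mem.∈ xs
  cover′ h with ∈-minus⁻ p h
  ... | y∈p , y≢x with cover y∈p
  ... | here y≡x = contradiction y≡x y≢x
  ... | there k  = k
  bits : ∀ {ys} → All (x ≢_) ys →
         sum (map (λ y → bit (y ∈? (p - x))) ys) ≡ sum (map (λ y → bit (y ∈? p)) ys)
  bits [] = refl
  bits (x≢y ∷ rs) = cong₂ _+_
    (bit-cong (_ ∈? _) (_ ∈? _) (proj₁ ∘ ∈-minus⁻ p) (λ h → x∈p∧x≢y⇒x∈p-y h (≢-sym x≢y))) (bits rs)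
  rest : ∣ p - x ∣ ≡ sum (map (λ y → bit (y ∈? p)) xs)
  rest = trans (card-list (p - x) xs u cover′) (bits x∉xs)

card-≤-length : ∀ {n} (p : Subset n) (xs : List (Fin n)) →
                (∀ {x} → x ∈ p → x Mem.∈ xs) → ∣ p ∣ ≤ length xs
card-≤-length p [] cover = ≤-reflexive (empty-card p (λ h → contradiction (cover h) λ ()))
card-≤-length p (x ∷ xs) cover = ≤-trans (lem (x ∈? p)) (s≤s (card-≤-length (p - x) xs cover′))
  where
  lem : Dec (x ∈ p) → ∣ p ∣ ≤ suc ∣ p - x ∣
  lem (yes h) = ≤-reflexive (∣minus∣ p h)
  lem (no ¬h) = m≤n⇒m≤1+n (p⊆q⇒∣p∣≤∣q∣ {p = p} {q = p - x} (λ {y} h → x∈p∧x≢y⇒x∈p-y h (λ { refl → ¬h h })))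
  cover′ : ∀ {y} → y ∈ p - x → y Mem.∈ xs
  cover′ h with ∈-minus⁻ p h
  ... | y∈p , y≢x with cover y∈p
  ... | here y≡x = contradiction y≡x y≢x
  ... | there k  = k

length-≤-card : ∀ {n} (p : Subset n) (xs : List (Fin n)) → Unique xs → All (_∈ p) xs → length xs ≤ ∣ p ∣
length-≤-card p [] _ _ = z≤n
length-≤-card p (x ∷ xs) (x∉xs ∷ u) (h ∷ hs) = ≤-trans
  (s≤s (length-≤-card (p - x) xs u
    (All.zipWith (λ (x≢y , y∈p) → x∈p∧x≢y⇒x∈p-y y∈p (≢-sym x≢y)) (x∉xs , hs))))
  (≤-reflexive (sym (∣minus∣ p h)))

-- The injection is a relation, so that side conditions on `x` can be stored in `R` and are at hand
-- when injectivity is proved.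
card-≤-inj : ∀ {n m} (p : Subset n) (q : Subset m) (R : Fin n → Fin m → Set) →
             (∀ {x} → x ∈ p → ∃[ y ] y ∈ q × R x y) →
             (∀ {x x′ y} → R x y → R x′ y → x ≡ x′) → ∣ p ∣ ≤ ∣ q ∣
card-≤-inj [] q R tot inj = z≤n
card-≤-inj (outside ∷ p) q R tot inj = card-≤-inj p q (R ∘ suc)
  (λ h → tot (there h)) (λ r r′ → Fin.suc-injective (inj r r′))
card-≤-inj (inside ∷ p) q R tot inj with tot here
... | y , y∈q , r₀ = ≤-trans
  (s≤s (card-≤-inj p (q - y) (R ∘ suc)
    (λ h → let (z , z∈q , r) = tot (there h) in
      z , x∈p∧x≢y⇒x∈p-y z∈q (λ { refl → contradiction (inj r r₀) λ () }) , r)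
    (λ r r′ → Fin.suc-injective (inj r r′))))
  (≤-reflexive (sym (∣minus∣ q y∈q)))

card-split : ∀ {n} (r m : Subset n) → ∣ r ∩ m ∣ + ∣ r ∩ ∁ m ∣ ≡ ∣ r ∣
card-split [] [] = refl
card-split (outside ∷ r) (_ ∷ m) = card-split r m
card-split (inside ∷ r) (inside ∷ m) = cong suc (card-split r m)
card-split (inside ∷ r) (outside ∷ m) = trans (+-suc _ _) (cong suc (card-split r m))

∣∪⁅⁆∣ : ∀ {n} (p : Subset n) {x} → x ∉ p → ∣ p ∪ ⁅ x ⁆ ∣ ≡ suc ∣ p ∣
∣∪⁅⁆∣ p {x} x∉p = trans (∣minus∣ (p ∪ ⁅ x ⁆) (q⊆p∪q p ⁅ x ⁆ (x∈⁅x⁆ x)))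
  (cong (suc ∘ ∣_∣) (⊆-antisym
    (λ h → let (k , ne) = ∈-minus⁻ (p ∪ ⁅ x ⁆) h in back k ne)
    (λ h → x∈p∧x≢y⇒x∈p-y (p⊆p∪q ⁅ x ⁆ h) (λ { refl → x∉p h }))))
  where
  back : ∀ {y} → y ∈ p ∪ ⁅ x ⁆ → y ≢ x → y ∈ p
  back h ne with x∈p∪q⁻ p ⁅ x ⁆ h
  ... | inj₁ k = k
  ... | inj₂ k = contradiction (x∈⁅y⁆⇒x≡y x k) ne

∈-∪⁅⁆⁻ : ∀ {n} (p : Subset n) {x y} → y ∈ p ∪ ⁅ x ⁆ → y ≡ x ⊎ y ∈ p
∈-∪⁅⁆⁻ p {x} h with x∈p∪q⁻ p ⁅ x ⁆ h
... | inj₁ k = inj₂ k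
... | inj₂ k = inj₁ (x∈⁅y⁆⇒x≡y x k)

∈-∪ˡ : ∀ {n} {p : Subset n} {x y} → y ∈ p → y ∈ p ∪ ⁅ x ⁆
∈-∪ˡ {x = x} = p⊆p∪q ⁅ x ⁆

∈-∪ʳ : ∀ {n} (p : Subset n) {x} → x ∈ p ∪ ⁅ x ⁆
∈-∪ʳ p {x} = q⊆p∪q p ⁅ x ⁆ (x∈⁅x⁆ x)

lookup-injective : ∀ {A : Set} {xs : List A} → Unique xs → ∀ {i j} → lookup xs i ≡ lookup xs j → i ≡ j
lookup-injective (_ ∷ _) {zero} {zero} eq = refl
lookup-injective (x∉ ∷ _) {zero} {suc j} eq = contradiction eq (All.lookup x∉ (∈-lookup j))
lookup-injective (x∉ ∷ _) {suc i} {zero} eq = contradiction (sym eq) (All.lookup x∉ (∈-lookup i))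
lookup-injective (_ ∷ u) {suc i} {suc j} eq = cong suc (lookup-injective u eq)

module Enumeration {n : ℕ} {P : Pred (Fin n) 0ℓ} (P? : Decidable P) where
  elements : List (Fin n)
  elements = filter P? (allFin n)

  elements-unique : Unique elements
  elements-unique = filter⁺ P? (allFin⁺ n)

  ∈-elements : ∀ {x} → P x → x Mem.∈ elements
  ∈-elements {x} = ∈-filter⁺ P? (∈-allFin x)

  elements-sound : ∀ {x} → x Mem.∈ elements → P x
  elements-sound h = proj₂ (∈-filter⁻ P? {xs = allFin n} h)

  position : ∀ {x} → P x → Fin (length elements)
  position px = index (∈-elements px)

  lookup-position : ∀ {x} (px : P x) → lookup elements (position px) ≡ x
  lookup-position px = sym (lookup-index (∈-elements px))

  lookup-sound : ∀ i → P (lookup elements i)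
  lookup-sound i = elements-sound (∈-lookup i)

  position-lookup : ∀ {i x} (px : P x) → lookup elements i ≡ x → position px ≡ i
  position-lookup px eq = lookup-injective elements-unique (trans (lookup-position px) (sym eq))

  card≡length : ∣ ⟦ P? ⟧ ∣ ≡ length elements
  card≡length = trans (card-list ⟦ P? ⟧ elements elements-unique (∈-elements ∘ ∈⟦⟧⁻ P?))
    (ones (All.tabulate elements-sound))
    where
    ones : ∀ {xs} → All P xs → sum (map (λ x → bit (x ∈? ⟦ P? ⟧)) xs) ≡ length xs
    ones [] = refl
    ones (px ∷ pxs) = cong₂ _+_ (bit-yes (_ ∈? _) (∈⟦⟧⁺ P? px)) (ones pxs)

-- Reachability, paths and cycles

-- The alternatives are neither decided nor exclusive a priori; whichever side `f` returns is kept
-- as a witness.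
all⊎any : ∀ {n} {P Q : Fin n → Set} → (∀ x → P x ⊎ Q x) → (∀ x → P x) ⊎ ∃ Q
all⊎any {zero} f = inj₁ λ ()
all⊎any {suc n} {P} f with f zero | all⊎any (f ∘ suc)
... | inj₂ q | _            = inj₂ (zero , q)
... | inj₁ _ | inj₂ (x , q) = inj₂ (suc x , q)
... | inj₁ p | inj₁ ps      = inj₁ λ { zero → p ; (suc x) → ps x }

module Reachability {n : ℕ} {R : Fin n → Fin n → Set} (R? : ∀ x y → Dec (R x y)) where

  Closed : Subset n → Set
  Closed S = ∀ {x y} → x ∈ S → R x y → y ∈ S

  closed-star : ∀ {S} → Closed S → ∀ {x y} → x ∈ S → Star R x y → y ∈ S
  closed-star c x∈S ε = x∈S
  closed-star c x∈S (r ◅ rs) = closed-star c (c x∈S r) rs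

  private
    -- The bound `n ≤ k + ∣ S ∣` is fuel: each round adds a vertex to `S`, and at `k = 0` one more
    -- vertex would make `S` larger than the ground set. The path constructions below use the same
    -- device.
    saturate : ∀ {u} k (S : Subset n) → n ≤ k + ∣ S ∣ → u ∈ S → (∀ {x} → x ∈ S → Star R u x) →
               ∃[ T ] u ∈ T × Closed T × (∀ {x} → x ∈ T → Star R u x)
    saturate k S n≤ u∈S reach with any? (λ x → any? (λ y → (x ∈? S) ×-dec (R? x y) ×-dec ¬? (y ∈? S)))
    ... | no none = S , u∈S , closed , reach
      where
      closed : Closed S
      closed {x} {y} x∈S r with y ∈? S
      ... | yes y∈S = y∈S
      ... | no y∉S  = contradiction (x , y , x∈S , r , y∉S) none
    saturate zero S n≤ u∈S reach | yes (x , y , x∈S , r , y∉S) =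
      contradiction (≤-trans (s≤s n≤) (≤-trans (≤-reflexive (sym (∣∪⁅⁆∣ S y∉S))) (∣p∣≤n (S ∪ ⁅ y ⁆)))) 1+n≰n
    saturate {u} (suc k) S n≤ u∈S reach | yes (x , y , x∈S , r , y∉S) =
      saturate k (S ∪ ⁅ y ⁆)
        (≤-trans n≤ (≤-reflexive (trans (sym (+-suc k ∣ S ∣)) (cong (k +_) (sym (∣∪⁅⁆∣ S y∉S))))))
        (∈-∪ˡ u∈S) extend
      where
      extend : ∀ {z} → z ∈ S ∪ ⁅ y ⁆ → Star R u z
      extend h with ∈-∪⁅⁆⁻ S h
      ... | inj₁ refl = reach x∈S ◅◅ (r ◅ ε)
      ... | inj₂ z∈S  = reach z∈S

  reachable : ∀ u → ∃[ T ] u ∈ T × Closed T × (∀ {x} → x ∈ T → Star R u x)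
  reachable u = saturate n ⁅ u ⁆ (ℕ.m≤m+n n _) (x∈⁅x⁆ u) (λ h → subst (Star R u) (sym (x∈⁅y⁆⇒x≡y u h)) ε)

  star? : ∀ u v → Dec (Star R u v)
  star? u v with reachable u
  ... | T , u∈T , c , reach = map′ reach (closed-star c u∈T) (v ∈? T)

module Basics (G : Graph) where
  open Graph G

  Adj : Subset size → Vertex → Vertex → Set
  Adj E u v = ∃[ e ] e ∈ E × Joins e u v

  joins-sym : ∀ {e u v} → Joins e u v → Joins e v u
  joins-sym = swap

  joins-≢ : ∀ {e u v} → Joins e u v → u ≢ v
  joins-≢ {e} (inj₁ eq) refl = loopless e (trans (cong proj₁ eq) (sym (cong proj₂ eq)))
  joins-≢ {e} (inj₂ eq) refl = loopless e (trans (cong proj₁ eq) (sym (cong proj₂ eq)))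

  joins-incˡ : ∀ {e u v} → Joins e u v → Incident u e
  joins-incˡ (inj₁ eq) = inj₁ (sym (cong proj₁ eq))
  joins-incˡ (inj₂ eq) = inj₂ (sym (cong proj₂ eq))

  joins-incʳ : ∀ {e u v} → Joins e u v → Incident v e
  joins-incʳ j = joins-incˡ (joins-sym j)

  joins-inc⁻ : ∀ {e u v x} → Joins e u v → Incident x e → x ≡ u ⊎ x ≡ v
  joins-inc⁻ (inj₁ eq) (inj₁ h) = inj₁ (trans h (cong proj₁ eq))
  joins-inc⁻ (inj₁ eq) (inj₂ h) = inj₂ (trans h (cong proj₂ eq))
  joins-inc⁻ (inj₂ eq) (inj₁ h) = inj₂ (trans h (cong proj₁ eq))
  joins-inc⁻ (inj₂ eq) (inj₂ h) = inj₁ (trans h (cong proj₂ eq))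

  inc-joins : ∀ {e u} → Incident u e → ∃[ v ] Joins e u v
  inc-joins {e} (inj₁ refl) = proj₂ (ends e) , inj₁ refl
  inc-joins {e} (inj₂ refl) = proj₁ (ends e) , inj₂ refl

  joins-ends : ∀ e → Joins e (proj₁ (ends e)) (proj₂ (ends e))
  joins-ends e = inj₁ refl

  joins-unique : ∀ {e u v w} → Joins e u v → Joins e u w → v ≡ w
  joins-unique j k with joins-inc⁻ j (joins-incʳ k)
  ... | inj₁ refl = contradiction refl (joins-≢ k)
  ... | inj₂ w≡v  = sym w≡v

  joins? : ∀ e u v → Dec (Joins e u v)
  joins? e u v = ≡-dec _≟_ _≟_ (ends e) (u , v) ⊎-dec ≡-dec _≟_ _≟_ (ends e) (v , u)

  adj? : ∀ E u v → Dec (Adj E u v)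
  adj? E u v = any? (λ e → (e ∈? E) ×-dec joins? e u v)

  adj-sym : ∀ {E u v} → Adj E u v → Adj E v u
  adj-sym (e , e∈E , j) = e , e∈E , joins-sym j

  star-sym : ∀ {E u v} → Star (Adj E) u v → Star (Adj E) v u
  star-sym = Star.reverse adj-sym

  star-mono : ∀ {E F} → E ⊆ F → ∀ {u v} → Star (Adj E) u v → Star (Adj F) u v
  star-mono sub = Star.map (λ (e , e∈E , j) → e , sub e∈E , j)

  deg : Subset size → Vertex → ℕ
  deg E v = ∣ ⟦ (λ e → (e ∈? E) ×-dec incident? v e) ⟧ ∣

  private
    at? : ∀ E v e → Dec (e ∈ E × Incident v e)
    at? E v e = (e ∈? E) ×-dec incident? v e

  deg-⊥ : ∀ v → deg ⊥ v ≡ 0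
  deg-⊥ v = ℕ.n≤0⇒n≡0 (card-≤-length ⟦ at? ⊥ v ⟧ [] (λ h → contradiction (proj₁ (∈⟦⟧⁻ (at? ⊥ v) h)) ∉⊥))

  deg-mono : ∀ {E F} → E ⊆ F → ∀ v → deg E v ≤ deg F v
  deg-mono {E} {F} sub v = p⊆q⇒∣p∣≤∣q∣ {p = ⟦ at? E v ⟧} {q = ⟦ at? F v ⟧}
    (λ h → let (k , i) = ∈⟦⟧⁻ (at? E v) h in ∈⟦⟧⁺ (at? F v) (sub k , i))

  deg-add : ∀ {E e} → e ∉ E → ∀ v → deg (E ∪ ⁅ e ⁆) v ≡ bit (incident? v e) + deg E v
  deg-add {E} {e} e∉E v = by (incident? v e)
    where
    by : (d : Dec (Incident v e)) → deg (E ∪ ⁅ e ⁆) v ≡ bit d + deg E v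
    by (yes i) = trans (cong ∣_∣ (⊆-antisym to from)) (∣∪⁅⁆∣ ⟦ at? E v ⟧ (e∉E ∘ proj₁ ∘ ∈⟦⟧⁻ (at? E v)))
      where
      to : ⟦ at? (E ∪ ⁅ e ⁆) v ⟧ ⊆ ⟦ at? E v ⟧ ∪ ⁅ e ⁆
      to h with ∈⟦⟧⁻ (at? (E ∪ ⁅ e ⁆) v) h
      ... | k , i′ with ∈-∪⁅⁆⁻ E k
      ... | inj₁ refl = ∈-∪ʳ ⟦ at? E v ⟧
      ... | inj₂ k′   = ∈-∪ˡ (∈⟦⟧⁺ (at? E v) (k′ , i′))
      from : ⟦ at? E v ⟧ ∪ ⁅ e ⁆ ⊆ ⟦ at? (E ∪ ⁅ e ⁆) v ⟧
      from h with ∈-∪⁅⁆⁻ ⟦ at? E v ⟧ h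
      ... | inj₁ refl = ∈⟦⟧⁺ (at? (E ∪ ⁅ e ⁆) v) (∈-∪ʳ E , i)
      ... | inj₂ k    = let (k′ , i′) = ∈⟦⟧⁻ (at? E v) k in ∈⟦⟧⁺ (at? (E ∪ ⁅ e ⁆) v) (∈-∪ˡ k′ , i′)
    by (no ¬i) = cong ∣_∣ (⊆-antisym to from)
      where
      to : ⟦ at? (E ∪ ⁅ e ⁆) v ⟧ ⊆ ⟦ at? E v ⟧
      to h with ∈⟦⟧⁻ (at? (E ∪ ⁅ e ⁆) v) h
      ... | k , i′ with ∈-∪⁅⁆⁻ E k
      ... | inj₁ refl = contradiction i′ ¬i
      ... | inj₂ k′   = ∈⟦⟧⁺ (at? E v) (k′ , i′)
      from : ⟦ at? E v ⟧ ⊆ ⟦ at? (E ∪ ⁅ e ⁆) v ⟧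
      from h = let (k′ , i′) = ∈⟦⟧⁻ (at? E v) h in ∈⟦⟧⁺ (at? (E ∪ ⁅ e ⁆) v) (∈-∪ˡ k′ , i′)

  bit-incident : ∀ {e u v} → Joins e u v → ∀ x → bit (incident? x e) ≡ bit (x ≟ u) + bit (x ≟ v)
  bit-incident {e} {u} {v} j x with x ≟ u | x ≟ v
  ... | yes refl | yes refl = contradiction refl (joins-≢ j)
  ... | yes refl | no _     = bit-yes (incident? x e) (joins-incˡ j)
  ... | no _     | yes refl = bit-yes (incident? x e) (joins-incʳ j)
  ... | no x≢u   | no x≢v   = bit-no (incident? x e) ([ x≢u , x≢v ] ∘ joins-inc⁻ j)

  cycle? : ∀ C → Dec (IsCycle {G} C)
  cycle? C = connected? ×-dec
    map′ (λ f {v} → f v) (λ f v → f) (all? (λ v → (v ∈? vertices) →-dec (degree C v ℕ.≟ 2)))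
    where
    open Subgraph C
    connected? : Dec (Connected C)
    connected? = nonempty? vertices ×-dec
      map′ (λ f {u} {v} → f u v) (λ f u v → f)
        (all? (λ u → all? (λ v → (u ∈? vertices) →-dec ((v ∈? vertices) →-dec
          Reachability.star? (adj? edges) u v))))

  -- A search over pairs of subsets, for which closure is a decidable condition. `Q` sees only the
  -- two subsets, so the result cannot depend on which proof of `closed` a subgraph carries.
  anyCycle? : {Q : Subset order → Subset size → Set} → (∀ V E → Dec (Q V E)) →
              Dec (∃[ C ] IsCycle {G} C × Q (Subgraph.vertices C) (Subgraph.edges C))
  anyCycle? {Q} Q? = map′
    (λ (V , E , cl , c) → record { vertices = V ; edges = E ; closed = λ {e} {v} → cl e v } , c)
    (λ (C , c) → Subgraph.vertices C , Subgraph.edges C , (λ e v → Subgraph.closed C) , c)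
    (anySubset? (λ V → anySubset? (λ E → body? V E)))
    where
    Body : Subset order → Subset size → Set
    Body V E = ∃ λ (cl : ∀ e v → e ∈ E → Incident v e → v ∈ V) →
      IsCycle {G} (record { vertices = V ; edges = E ; closed = λ {e} {v} → cl e v }) × Q V E
    body? : ∀ V E → Dec (Body V E)
    body? V E with all? (λ e → all? (λ v → (e ∈? E) →-dec (incident? v e →-dec (v ∈? V))))
    ... | no ¬cl = no (λ (cl , _) → ¬cl cl)
    ... | yes cl = map′ (λ c → cl , c) (λ (_ , c) → c)
      (cycle? (record { vertices = V ; edges = E ; closed = λ {e} {v} → cl e v }) ×-dec Q? V E)

  -- The last two indices are the vertex set and the edge set, ready to become a `Subgraph`. A path
  -- grows at its head by a vertex outside `P`; this keeps it simple and makes the added edge new as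
  -- well.
  data Path : Vertex → Vertex → Subset order → Subset size → Set where
    here : ∀ {v} → Path v v ⁅ v ⁆ ⊥
    step : ∀ {e w u v P E} → Joins e w u → w ∉ P → Path u v P E → Path w v (P ∪ ⁅ w ⁆) (E ∪ ⁅ e ⁆)

  path-head : ∀ {u v P E} → Path u v P E → u ∈ P
  path-head here = x∈⁅x⁆ _
  path-head (step {P = P} j w∉P p) = ∈-∪ʳ P

  path-last : ∀ {u v P E} → Path u v P E → v ∈ P
  path-last here = x∈⁅x⁆ _
  path-last (step j w∉P p) = ∈-∪ˡ (path-last p)

  path-closed : ∀ {u v P E} → Path u v P E → ∀ {e x} → e ∈ E → Incident x e → x ∈ P
  path-closed here h i = contradiction h ∉⊥
  path-closed (step {P = P} {E = E} j w∉P p) h i with ∈-∪⁅⁆⁻ E h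
  ... | inj₂ k = ∈-∪ˡ (path-closed p k i)
  ... | inj₁ refl with joins-inc⁻ j i
  ... | inj₁ refl = ∈-∪ʳ P
  ... | inj₂ refl = ∈-∪ˡ (path-head p)

  path-fresh : ∀ {u v P E} → Path u v P E → ∀ {e x y} → Joins e x y → x ∉ P → e ∉ E
  path-fresh p j x∉P e∈E = x∉P (path-closed p e∈E (joins-incˡ j))

  path-head-unique : ∀ {u v P E} → Path u v P E → ∀ {e f} → e ∈ E → f ∈ E →
                     Incident u e → Incident u f → e ≡ f
  path-head-unique here h _ _ _ = contradiction h ∉⊥
  path-head-unique (step {E = E} j w∉P p) h k i l with ∈-∪⁅⁆⁻ E h | ∈-∪⁅⁆⁻ E k
  ... | inj₁ refl | inj₁ refl = refl
  ... | inj₂ h′   | _         = contradiction (path-closed p h′ i) w∉P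
  ... | inj₁ _    | inj₂ k′   = contradiction (path-closed p k′ l) w∉P

  path-connected : ∀ {u v P E} → Path u v P E → ∀ {x} → x ∈ P → Star (Adj E) x v
  path-connected {v = v} here h with x∈⁅y⁆⇒x≡y v h
  ... | refl = ε
  path-connected (step {P = P} {E = E} j w∉P p) h with ∈-∪⁅⁆⁻ P h
  ... | inj₁ refl = (_ , ∈-∪ʳ E , j) ◅ star-mono ∈-∪ˡ (path-connected p (path-head p))
  ... | inj₂ k    = star-mono ∈-∪ˡ (path-connected p k)

  bit-∪ : ∀ {P : Subset order} {w} → w ∉ P → ∀ x → bit (x ∈? (P ∪ ⁅ w ⁆)) ≡ bit (x ≟ w) + bit (x ∈? P)
  bit-∪ {P} {w} w∉P x with x ≟ w
  ... | yes refl = trans (bit-yes (x ∈? (P ∪ ⁅ x ⁆)) (∈-∪ʳ P)) (cong suc (sym (bit-no (x ∈? P) w∉P)))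
  ... | no x≢w   = bit-cong (x ∈? (P ∪ ⁅ w ⁆)) (x ∈? P) back ∈-∪ˡ
    where
    back : x ∈ P ∪ ⁅ w ⁆ → x ∈ P
    back h = [ (λ eq → contradiction eq x≢w) , (λ k → k) ] (∈-∪⁅⁆⁻ P h)

  -- Each end falls short of degree 2 by one. Writing the deficits on the left avoids subtraction
  -- and covers the path of a single vertex, where both deficits occur at the same place.
  path-degree : ∀ {u v P E} → Path u v P E → ∀ x →
                deg E x + (bit (x ≟ u) + bit (x ≟ v)) ≡ bit (x ∈? P) + bit (x ∈? P)
  path-degree {v = v} here x = trans (cong (_+ (bit (x ≟ v) + bit (x ≟ v))) (deg-⊥ x)) (cong₂ _+_ eq eq)
    where
    eq : bit (x ≟ v) ≡ bit (x ∈? ⁅ v ⁆)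
    eq = bit-cong (x ≟ v) (x ∈? ⁅ v ⁆) (λ { refl → x∈⁅x⁆ x }) (x∈⁅y⁆⇒x≡y v)
  path-degree {v = v} (step {e} {w} {u} {_} {P} {E} j w∉P p) x = begin
    deg (E ∪ ⁅ e ⁆) x + (bw + bv)
      ≡⟨ cong (_+ (bw + bv)) (trans (deg-add (path-fresh p j w∉P) x) (cong (_+ deg E x) (bit-incident j x))) ⟩
    bw + bu + deg E x + (bw + bv)
      ≡⟨ solve 4 (λ a b c d → a :+ b :+ d :+ (a :+ c) := (a :+ a) :+ (d :+ (b :+ c))) refl bw bu bv (deg E x) ⟩
    (bw + bw) + (deg E x + (bu + bv))
      ≡⟨ cong ((bw + bw) +_) (path-degree p x) ⟩
    (bw + bw) + (bP + bP)
      ≡⟨ solve 2 (λ a b → (a :+ a) :+ (b :+ b) := (a :+ b) :+ (a :+ b)) refl bw bP ⟩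
    (bw + bP) + (bw + bP)
      ≡⟨ sym (cong₂ _+_ (bit-∪ w∉P x) (bit-∪ w∉P x)) ⟩
    bit (x ∈? (P ∪ ⁅ w ⁆)) + bit (x ∈? (P ∪ ⁅ w ⁆)) ∎
    where
    open ≡-Reasoning
    open +-*-Solver
    bw = bit (x ≟ w)
    bu = bit (x ≟ u)
    bv = bit (x ≟ v)
    bP = bit (x ∈? P)

  closePath : ∀ {u v P E e} → Path u v P E → Joins e v u → Subgraph G
  closePath {P = P} {E} {e} p j = record
    { vertices = P
    ; edges = E ∪ ⁅ e ⁆
    ; closed = λ h i → [ (λ { refl → [ (λ { refl → path-last p }) , (λ { refl → path-head p }) ] (joins-inc⁻ j i) })
                       , (λ k → path-closed p k i) ] (∈-∪⁅⁆⁻ E h)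
    }

  closed-degree : ∀ {u v P E e} → Path u v P E → Joins e v u → e ∉ E → ∀ {x} → x ∈ P → deg (E ∪ ⁅ e ⁆) x ≡ 2
  closed-degree {u} {v} {P} {E} {e} p j e∉E {x} x∈P = begin
    deg (E ∪ ⁅ e ⁆) x                       ≡⟨ deg-add e∉E x ⟩
    bit (incident? x e) + deg E x           ≡⟨ cong (_+ deg E x) (trans (bit-incident j x) (+-comm (bit (x ≟ v)) _)) ⟩
    bit (x ≟ u) + bit (x ≟ v) + deg E x     ≡⟨ +-comm _ (deg E x) ⟩
    deg E x + (bit (x ≟ u) + bit (x ≟ v))   ≡⟨ path-degree p x ⟩
    bit (x ∈? P) + bit (x ∈? P)             ≡⟨ cong₂ _+_ (bit-yes (x ∈? P) x∈P) (bit-yes (x ∈? P) x∈P) ⟩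
    2                                       ∎
    where open ≡-Reasoning

  -- The condition `e ∉ E` prevents a path of one edge from being closed by that same edge; closing
  -- it by a parallel edge gives a cycle of length 2.
  closePath-cycle : ∀ {u v P E e} (p : Path u v P E) (j : Joins e v u) → e ∉ E → IsCycle (closePath p j)
  closePath-cycle {u} {v} {P} {E} p j e∉E =
    ((u , path-head p) , λ x∈P y∈P →
      star-mono ∈-∪ˡ (path-connected p x∈P ◅◅ star-sym (path-connected p y∈P)))
    , closed-degree p j e∉E

  -- Both halves contain `x`, hence the `suc` in `sizes`. The inclusion `E₁⊆E` keeps an edge outside
  -- the path fresh when the first half is closed up with it.
  record Split (u v x : Vertex) (P : Subset order) (E : Subset size) : Set where
    field
      {P₁ P₂} : Subset order
      {E₁ E₂} : Subset size
      path₁   : Path u x P₁ E₁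
      path₂   : Path x v P₂ E₂
      P₁⊆P    : P₁ ⊆ P
      P₂⊆P    : P₂ ⊆ P
      E₁⊆E    : E₁ ⊆ E
      meet    : ∀ {y} → y ∈ P₁ → y ∈ P₂ → y ≡ x
      sizes   : ∣ P₁ ∣ + ∣ P₂ ∣ ≤ suc ∣ P ∣

  split : ∀ {u v P E} → Path u v P E → ∀ {x} → x ∈ P → Split u v x P E
  split {v = v} here h with x∈⁅y⁆⇒x≡y v h
  ... | refl = record
    { path₁ = here ; path₂ = here ; P₁⊆P = λ k → k ; P₂⊆P = λ k → k ; E₁⊆E = λ k → k
    ; meet = λ k _ → x∈⁅y⁆⇒x≡y v k
    ; sizes = ≤-reflexive (cong (_+ ∣ ⁅ v ⁆ ∣) (∣⁅x⁆∣≡1 v)) }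
  split (step {w = w} {P = P} {E} j w∉P p) h with ∈-∪⁅⁆⁻ P h
  ... | inj₁ refl = record
    { path₁ = here ; path₂ = step j w∉P p
    ; P₁⊆P = λ k → subst (_∈ P ∪ ⁅ _ ⁆) (sym (x∈⁅y⁆⇒x≡y _ k)) (∈-∪ʳ P)
    ; P₂⊆P = λ k → k ; E₁⊆E = λ k → contradiction k ∉⊥
    ; meet = λ k _ → x∈⁅y⁆⇒x≡y _ k
    ; sizes = ≤-reflexive (cong (_+ ∣ P ∪ ⁅ w ⁆ ∣) (∣⁅x⁆∣≡1 w)) }
  ... | inj₂ k = record
    { path₁ = step j (λ l → w∉P (S.P₁⊆P l)) S.path₁ ; path₂ = S.path₂
    ; P₁⊆P = λ l → [ (λ { refl → ∈-∪ʳ P }) , (λ m → ∈-∪ˡ (S.P₁⊆P m)) ] (∈-∪⁅⁆⁻ S.P₁ l)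
    ; P₂⊆P = λ l → ∈-∪ˡ (S.P₂⊆P l)
    ; E₁⊆E = λ l → [ (λ { refl → ∈-∪ʳ E }) , (λ m → ∈-∪ˡ (S.E₁⊆E m)) ] (∈-∪⁅⁆⁻ S.E₁ l)
    ; meet = λ l m → [ (λ { refl → contradiction (S.P₂⊆P m) w∉P }) , (λ l′ → S.meet l′ m) ] (∈-∪⁅⁆⁻ S.P₁ l)
    ; sizes = ≤-trans (≤-reflexive (cong (_+ ∣ S.P₂ ∣) (∣∪⁅⁆∣ S.P₁ (λ l → w∉P (S.P₁⊆P l)))))
        (≤-trans (s≤s S.sizes) (≤-reflexive (cong suc (sym (∣∪⁅⁆∣ P w∉P))))) }
    where module S = Split (split p k)

  -- The edges differ, but `w` and `z` may coincide: two parallel edges already form a cycle.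
  TwoInside : Subset order → Vertex → Set
  TwoInside A v = ∃[ e ] ∃[ f ] ∃[ w ] ∃[ z ] e ≢ f × (Joins e v w × w ∈ A) × (Joins f v z × z ∈ A)

  CycleIn : Subset order → Set
  CycleIn A = ∃[ C ] IsCycle {G} C × Subgraph.vertices C ⊆ A

  module _ (A : Subset order) (two : ∀ {v} → v ∈ A → TwoInside A v) where
    private
      grow : ∀ k {u v P E} → Path u v P E → P ⊆ A → order ≤ k + ∣ P ∣ → CycleIn A
      extend : ∀ k {u v w P E e} → Path u v P E → P ⊆ A → order ≤ k + ∣ P ∣ →
               Joins e u w → w ∈ A → e ∉ E → CycleIn A

      grow k {E = E} p P⊆A fuel with two (P⊆A (path-head p))
      ... | e , f , w , z , e≢f , (j , w∈A) , (l , z∈A) with e ∈? E | f ∈? E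
      ... | no e∉E | _      = extend k p P⊆A fuel j w∈A e∉E
      ... | yes _  | no f∉E = extend k p P⊆A fuel l z∈A f∉E
      ... | yes h  | yes h′ = contradiction (path-head-unique p h h′ (joins-incˡ j) (joins-incˡ l)) e≢f

      extend k {w = w} {P} p P⊆A fuel j w∈A e∉E with w ∈? P
      extend k p P⊆A fuel j w∈A e∉E | yes w∈P =
        closePath S.path₁ (joins-sym j) , closePath-cycle S.path₁ (joins-sym j) (e∉E ∘ S.E₁⊆E) , P⊆A ∘ S.P₁⊆P
        where module S = Split (split p w∈P)
      extend zero {w = w} {P} p P⊆A fuel j w∈A e∉E | no w∉P =
        contradiction (≤-trans (s≤s fuel) (≤-trans (≤-reflexive (sym (∣∪⁅⁆∣ P w∉P))) (∣p∣≤n (P ∪ ⁅ w ⁆)))) 1+n≰n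
      extend (suc k) {w = w} {P} p P⊆A fuel j w∈A e∉E | no w∉P =
        grow k (step (joins-sym j) w∉P p)
          (λ h → [ (λ { refl → w∈A }) , P⊆A ] (∈-∪⁅⁆⁻ P h))
          (≤-trans fuel (≤-reflexive (trans (sym (+-suc k ∣ P ∣)) (cong (k +_) (sym (∣∪⁅⁆∣ P w∉P))))))

    twoInside⇒cycle : Nonempty A → CycleIn A
    twoInside⇒cycle (v , v∈A) = grow order (here {v}) (λ h → subst (_∈ A) (sym (x∈⁅y⁆⇒x≡y v h)) v∈A) (ℕ.m≤m+n order _)

-- Cubic graphs

-- A walk from `X` to `Y` stays in `X` until `next` puts a vertex in `Y`; the step taken there is
-- the crossing.
star-crossing : ∀ {A : Set} {R : A → A → Set} {X Y : A → Set} → (∀ {x y} → X x → R x y → X y ⊎ Y y) →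
                (∀ {x} → X x → ¬ Y x) → ∀ {u v} → Star R u v → X u → Y v → ∃[ p ] ∃[ q ] R p q × X p × Y q
star-crossing next apart ε xu yv = contradiction yv (apart xu)
star-crossing next apart (r ◅ rs) xu yv with next xu r
... | inj₂ yw = _ , _ , r , xu , yw
... | inj₁ xw = star-crossing next apart rs xw yv

module Cubics (G : Graph) where
  open Graph G
  open Basics G

  -- Edges are numbered, not neighbours, since parallel edges make neighbours coincide.
  record Slots (v : Vertex) : Set where
    field
      slot       : Fin 3 → Edge
      slot-inc   : ∀ i → Incident v (slot i)
      slot-inj   : ∀ {i j} → slot i ≡ slot j → i ≡ j
      slot-cover : ∀ {e} → Incident v e → ∃[ i ] slot i ≡ e

  open Slots

  deg-slots : ∀ {v} (S : Slots v) E →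
    deg E v ≡ bit (slot S zero ∈? E) + (bit (slot S (suc zero) ∈? E) + bit (slot S (suc (suc zero)) ∈? E))
  deg-slots {v} S E = trans (card-list ⟦ at? ⟧ xs unique cover)
    (cong₂ _+_ (bits zero) (cong₂ _+_ (bits (suc zero)) (trans (+-identityʳ _) (bits (suc (suc zero))))))
    where
    at? : ∀ e → Dec (e ∈ E × Incident v e)
    at? e = (e ∈? E) ×-dec incident? v e
    xs : List Edge
    xs = slot S zero ∷ slot S (suc zero) ∷ slot S (suc (suc zero)) ∷ []
    distinct : ∀ {i j} → i ≢ j → slot S i ≢ slot S j
    distinct i≢j eq = i≢j (slot-inj S eq)
    unique : Unique xs
    unique = (distinct (λ ()) ∷ distinct (λ ()) ∷ []) ∷ (distinct (λ ()) ∷ []) ∷ [] ∷ []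
    cover : ∀ {e} → e ∈ ⟦ at? ⟧ → e Mem.∈ xs
    cover h with slot-cover S (proj₂ (∈⟦⟧⁻ at? h))
    ... | zero , refl = here refl
    ... | suc zero , refl = there (here refl)
    ... | suc (suc zero) , refl = there (there (here refl))
    bits : ∀ i → bit (slot S i ∈? ⟦ at? ⟧) ≡ bit (slot S i ∈? E)
    bits i = bit-cong (slot S i ∈? ⟦ at? ⟧) (slot S i ∈? E) (proj₁ ∘ ∈⟦⟧⁻ at?) (λ h → ∈⟦⟧⁺ at? (h , slot-inc S i))

  slots⇒deg≡3 : ∀ {v} → Slots v → deg ⊤ v ≡ 3
  slots⇒deg≡3 S = trans (deg-slots S ⊤)
    (cong₂ _+_ (one zero) (cong₂ _+_ (one (suc zero)) (one (suc (suc zero)))))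
    where
    one : ∀ i → bit (slot S i ∈? ⊤) ≡ 1
    one i = bit-yes (slot S i ∈? ⊤) ∈⊤

  deg≡3⇒slots : ∀ {v} → deg ⊤ v ≡ 3 → Slots v
  deg≡3⇒slots {v} eq = build elements elements-unique elements-sound (λ i → ∈-elements (∈⊤ , i))
      (trans (sym card≡length) eq)
    where
    open Enumeration (λ e → (e ∈? ⊤) ×-dec incident? v e)
    build : (xs : List Edge) → Unique xs → (∀ {e} → e Mem.∈ xs → e ∈ ⊤ × Incident v e) →
            (∀ {e} → Incident v e → e Mem.∈ xs) → length xs ≡ 3 → Slots v
    build xs@(_ ∷ _ ∷ _ ∷ []) u sound cover refl = record
      { slot = lookup xs
      ; slot-inc = λ i → proj₂ (sound (∈-lookup {xs = xs} i))
      ; slot-inj = lookup-injective u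
      ; slot-cover = λ i → index (cover i) , sym (lookup-index (cover i)) }

  record TwoEdges (E : Subset size) (v : Vertex) : Set where
    field
      {e f} : Edge
      e≢f   : e ≢ f
      e∈E   : e ∈ E
      f∈E   : f ∈ E
      inc-e : Incident v e
      inc-f : Incident v f

  deg≡2⇒twoEdges : ∀ {E v} → deg E v ≡ 2 → TwoEdges E v
  deg≡2⇒twoEdges {E} {v} eq = build elements elements-unique elements-sound (trans (sym card≡length) eq)
    where
    open Enumeration (λ e → (e ∈? E) ×-dec incident? v e)
    build : (xs : List Edge) → Unique xs → (∀ {e} → e Mem.∈ xs → e ∈ E × Incident v e) →
            length xs ≡ 2 → TwoEdges E v
    build (e ∷ f ∷ []) ((e≢f ∷ []) ∷ _) sound refl = record
      { e≢f = e≢f ; e∈E = proj₁ (sound (here refl)) ; f∈E = proj₁ (sound (there (here refl)))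
      ; inc-e = proj₂ (sound (here refl)) ; inc-f = proj₂ (sound (there (here refl))) }

  deg-extra : ∀ {E F v} → deg F v < deg E v → ∃[ e ] e ∈ E × e ∉ F × Incident v e
  deg-extra {E} {F} {v} lt with any? (λ e → (e ∈? E) ×-dec ¬? (e ∈? F) ×-dec incident? v e)
  ... | yes found = found
  ... | no none = contradiction (≤-trans lt (p⊆q⇒∣p∣≤∣q∣ {p = ⟦ at? E ⟧} {q = ⟦ at? F ⟧} sub)) 1+n≰n
    where
    at? : ∀ E e → Dec (e ∈ E × Incident v e)
    at? E e = (e ∈? E) ×-dec incident? v e
    sub : ⟦ at? E ⟧ ⊆ ⟦ at? F ⟧
    sub {e} h with ∈⟦⟧⁻ (at? E) h | e ∈? F
    ... | e∈E , i | yes e∈F = ∈⟦⟧⁺ (at? F) (e∈F , i)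
    ... | e∈E , i | no e∉F = contradiction (e , e∈E , e∉F , i) none

  deg-add-incident : ∀ {E e v} → e ∉ E → Incident v e → deg (E ∪ ⁅ e ⁆) v ≡ suc (deg E v)
  deg-add-incident {E} {e} {v} e∉E i = trans (deg-add e∉E v) (cong (_+ deg E v) (bit-yes (incident? v e) i))

  saturated : ∀ {E F v e} → F ⊆ E → deg E v ≤ deg F v → e ∈ E → Incident v e → e ∈ F
  saturated {E} {F} {v} {e} F⊆E le e∈E i with e ∈? F
  ... | yes e∈F = e∈F
  ... | no e∉F = contradiction
    (≤-trans (≤-reflexive (sym (deg-add-incident e∉F i)))
      (≤-trans (deg-mono (λ h → [ (λ { refl → e∈E }) , F⊆E ] (∈-∪⁅⁆⁻ F h)) v) le)) 1+n≰n

  -- Two different edges outside `E` would give `v` degree 4. This makes the edge by which a vertex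
  -- of a cycle leaves that cycle unique.
  third-unique : ∀ {E v e f} → Slots v → deg E v ≡ 2 → e ∉ E → f ∉ E → Incident v e → Incident v f → e ≡ f
  third-unique {E} {v} {e} {f} S two e∉E f∉E i j with e ≟ f
  ... | yes eq = eq
  ... | no e≢f = contradiction
    (≤-trans (≤-reflexive (sym (trans (deg-add-incident f∉ j) (cong suc (trans (deg-add-incident e∉E i) (cong suc two))))))
      (≤-trans (deg-mono (λ _ → ∈⊤) v) (≤-reflexive (slots⇒deg≡3 S)))) 1+n≰n
    where
    f∉ : f ∉ E ∪ ⁅ e ⁆
    f∉ h = [ (λ eq → e≢f (sym eq)) , f∉E ] (∈-∪⁅⁆⁻ E h)

  crosses? : ∀ A e → Dec ((proj₁ (ends e) ∈ A × proj₂ (ends e) ∉ A) ⊎ (proj₂ (ends e) ∈ A × proj₁ (ends e) ∉ A))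
  crosses? A e = ((proj₁ (ends e) ∈? A) ×-dec ¬? (proj₂ (ends e) ∈? A))
           ⊎-dec ((proj₂ (ends e) ∈? A) ×-dec ¬? (proj₁ (ends e) ∈? A))

  δ : Subset order → Subset size
  δ A = ⟦ crosses? A ⟧

  δ⁺ : ∀ {A e u v} → Joins e u v → u ∈ A → v ∉ A → e ∈ δ A
  δ⁺ {A} (inj₁ eq) u∈A v∉A = ∈⟦⟧⁺ (crosses? A)
    (inj₁ (subst (_∈ A) (sym (cong proj₁ eq)) u∈A , λ h → v∉A (subst (_∈ A) (cong proj₂ eq) h)))
  δ⁺ {A} (inj₂ eq) u∈A v∉A = ∈⟦⟧⁺ (crosses? A)
    (inj₂ (subst (_∈ A) (sym (cong proj₂ eq)) u∈A , λ h → v∉A (subst (_∈ A) (cong proj₁ eq) h)))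

  δ⁻ : ∀ {A e} → e ∈ δ A → ∃[ u ] ∃[ v ] Joins e u v × u ∈ A × v ∉ A
  δ⁻ {A} {e} h with ∈⟦⟧⁻ (crosses? A) h
  ... | inj₁ (u∈ , v∉) = _ , _ , inj₁ refl , u∈ , v∉
  ... | inj₂ (u∈ , v∉) = _ , _ , inj₂ refl , u∈ , v∉

  δ-∁ : ∀ {A} → δ (∁ A) ⊆ δ A
  δ-∁ {A} h with δ⁻ {A = ∁ A} h
  ... | u , v , j , u∈ , v∉ = δ⁺ (joins-sym j) (x∉∁p⇒x∈p v∉) (x∈∁p⇒x∉p u∈)

  δ-inside : ∀ {A e} → (∀ {v} → Incident v e → v ∈ A) → e ∉ δ A
  δ-inside all∈ h with δ⁻ h
  ... | u , v , j , u∈ , v∉ = v∉ (all∈ (joins-incʳ j))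

  δ-outside : ∀ {A e} → (∀ {v} → Incident v e → v ∉ A) → e ∉ δ A
  δ-outside all∉ h with δ⁻ h
  ... | u , v , j , u∈ , v∉ = all∉ (joins-incˡ j) u∈

  record TwoOut (A : Subset order) (v : Vertex) : Set where
    field
      {a b c} : Edge
      a≢b     : a ≢ b
      a∈δ     : a ∈ δ A
      b∈δ     : b ∈ δ A
      inc-a   : Incident v a
      inc-b   : Incident v b
      cover   : ∀ {e} → Incident v e → e ≡ a ⊎ e ≡ b ⊎ e ≡ c

  twoInside⊎twoOut : ∀ {A v} → Slots v → v ∈ A → TwoInside A v ⊎ TwoOut A v
  twoInside⊎twoOut {A} {v} S v∈A = cases (far zero ∈? A) (far (suc zero) ∈? A) (far (suc (suc zero)) ∈? A)
    where
    far : Fin 3 → Vertex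
    far i = proj₁ (inc-joins (slot-inc S i))
    joins : ∀ i → Joins (slot S i) v (far i)
    joins i = proj₂ (inc-joins (slot-inc S i))
    two : ∀ i j → i ≢ j → far i ∈ A → far j ∈ A → TwoInside A v
    two i j i≢j hi hj = _ , _ , _ , _ , (λ eq → i≢j (slot-inj S eq)) , (joins i , hi) , (joins j , hj)
    out : ∀ i j k → i ≢ j → (∀ x → x ≡ i ⊎ x ≡ j ⊎ x ≡ k) → far i ∉ A → far j ∉ A → TwoOut A v
    out i j k i≢j all hi hj = record
      { a≢b = λ eq → i≢j (slot-inj S eq) ; a∈δ = δ⁺ (joins i) v∈A hi ; b∈δ = δ⁺ (joins j) v∈A hj
      ; inc-a = slot-inc S i ; inc-b = slot-inc S j ; cover = cover }
      where
      cover : ∀ {e} → Incident v e → e ≡ slot S i ⊎ e ≡ slot S j ⊎ e ≡ slot S k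
      cover inc with slot-cover S inc
      ... | x , refl with all x
      ... | inj₁ refl = inj₁ refl
      ... | inj₂ (inj₁ refl) = inj₂ (inj₁ refl)
      ... | inj₂ (inj₂ refl) = inj₂ (inj₂ refl)
    cases : Dec (far zero ∈ A) → Dec (far (suc zero) ∈ A) → Dec (far (suc (suc zero)) ∈ A) → TwoInside A v ⊎ TwoOut A v
    cases (yes p) (yes q) _       = inj₁ (two _ _ (λ ()) p q)
    cases (yes p) (no _)  (yes r) = inj₁ (two _ _ (λ ()) p r)
    cases (no _)  (yes q) (yes r) = inj₁ (two _ _ (λ ()) q r)
    cases (no p)  (no q)  _       = inj₂ (out zero (suc zero) (suc (suc zero)) (λ ())
      (λ { zero → inj₁ refl ; (suc zero) → inj₂ (inj₁ refl) ; (suc (suc zero)) → inj₂ (inj₂ refl) }) p q)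
    cases (no p)  (yes _) (no r)  = inj₂ (out zero (suc (suc zero)) (suc zero) (λ ())
      (λ { zero → inj₁ refl ; (suc (suc zero)) → inj₂ (inj₁ refl) ; (suc zero) → inj₂ (inj₂ refl) }) p r)
    cases (yes _) (no q)  (no r)  = inj₂ (out (suc zero) (suc (suc zero)) zero (λ ())
      (λ { (suc zero) → inj₁ refl ; (suc (suc zero)) → inj₂ (inj₁ refl) ; zero → inj₂ (inj₂ refl) }) q r)

  -- Removing `v` takes `a` and `b` out of the boundary and can bring in nothing but `c`.
  δ-decrease : ∀ {A v} → v ∈ A → TwoOut A v → suc ∣ δ (A - v) ∣ ≤ ∣ δ A ∣
  δ-decrease {A} {v} v∈A T = ≤-trans (s≤s bound)
      (≤-reflexive (sym (trans (∣minus∣ (δ A) T.a∈δ) (cong suc (∣minus∣ (δ A - T.a) b∈)))))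
    where
    module T = TwoOut T
    D = δ A - T.a - T.b
    b∈ : T.b ∈ δ A - T.a
    b∈ = x∈p∧x≢y⇒x∈p-y T.b∈δ (≢-sym T.a≢b)
    not-c : ∀ {e x} → e ∈ δ A → Joins e v x → x ∉ A
    not-c e∈δ j x∈A with δ⁻ e∈δ
    ... | u , w , k , u∈A , w∉A with joins-inc⁻ j (joins-incʳ k)
    ... | inj₁ refl = w∉A v∈A
    ... | inj₂ refl = w∉A x∈A
    sub : δ (A - v) ⊆ D ∪ ⁅ T.c ⁆
    sub {e} h with δ⁻ {A = A - v} h
    ... | x , y , j , x∈ , y∉ with ∈-minus⁻ A x∈ | y ≟ v
    ... | x∈A , x≢v | yes refl = at-v (T.cover (joins-incʳ j))
      where
      at-v : e ≡ T.a ⊎ e ≡ T.b ⊎ e ≡ T.c → e ∈ D ∪ ⁅ T.c ⁆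
      at-v (inj₁ refl) = contradiction x∈A (not-c T.a∈δ (joins-sym j))
      at-v (inj₂ (inj₁ refl)) = contradiction x∈A (not-c T.b∈δ (joins-sym j))
      at-v (inj₂ (inj₂ refl)) = ∈-∪ʳ D
    ... | x∈A , x≢v | no y≢v = ∈-∪ˡ
      (x∈p∧x≢y⇒x∈p-y (x∈p∧x≢y⇒x∈p-y (δ⁺ j x∈A y∉A) (away T.inc-a)) (away T.inc-b))
      where
      y∉A : y ∉ A
      y∉A y∈A = y∉ (x∈p∧x≢y⇒x∈p-y y∈A y≢v)
      away : ∀ {f} → Incident v f → e ≢ f
      away i refl with joins-inc⁻ j i
      ... | inj₁ eq = x≢v (sym eq)
      ... | inj₂ eq = y≢v (sym eq)
    bound : ∣ δ (A - v) ∣ ≤ suc ∣ D ∣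
    bound = ≤-trans (p⊆q⇒∣p∣≤∣q∣ {p = δ (A - v)} {q = D ∪ ⁅ T.c ⁆} sub) ∪≤
      where
      ∪≤ : ∣ D ∪ ⁅ T.c ⁆ ∣ ≤ suc ∣ D ∣
      ∪≤ with T.c ∈? D
      ... | no c∉ = ≤-reflexive (∣∪⁅⁆∣ D c∉)
      ... | yes c∈ = m≤n⇒m≤1+n (p⊆q⇒∣p∣≤∣q∣ {p = D ∪ ⁅ T.c ⁆} {q = D} (λ h → [ (λ { refl → c∈ }) , id ] (∈-∪⁅⁆⁻ D h)))

  -- Peeling off a vertex with at most one edge inside A lowers |δ A|.
  cycle⊎boundary : (∀ v → Slots v) → ∀ {A} → Nonempty A → CycleIn A ⊎ ∣ A ∣ + 2 ≤ ∣ δ A ∣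
  cycle⊎boundary S {A} ne = go ∣ A ∣ ≤-refl ne
    where
    go : ∀ k {A} → ∣ A ∣ ≤ k → Nonempty A → CycleIn A ⊎ ∣ A ∣ + 2 ≤ ∣ δ A ∣
    go zero le (v , v∈A) = contradiction (≤-trans (≤-reflexive (sym (∣minus∣ _ v∈A))) le) λ ()
    go (suc k) {A} le ne with all⊎any dichotomy
      where
      dichotomy : ∀ v → (v ∈ A → TwoInside A v) ⊎ (v ∈ A × TwoOut A v)
      dichotomy v with v ∈? A
      ... | no v∉A = inj₁ (λ v∈A → contradiction v∈A v∉A)
      ... | yes v∈A with twoInside⊎twoOut (S v) v∈A
      ... | inj₁ t = inj₁ (λ _ → t)
      ... | inj₂ t = inj₂ (v∈A , t)
    ... | inj₁ two = inj₁ (twoInside⇒cycle A (two _) ne)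
    ... | inj₂ (v , v∈A , t) with nonempty? (A - v)
    ... | yes ne′ with go k {A - v} (≤-pred (≤-trans (≤-reflexive (sym (∣minus∣ A v∈A))) le)) ne′
    ... | inj₁ (C , cyc , sub) = inj₁ (C , cyc , proj₁ ∘ ∈-minus⁻ A ∘ sub)
    ... | inj₂ bound = inj₂ (≤-trans (≤-reflexive (cong (_+ 2) (∣minus∣ A v∈A))) (≤-trans (s≤s bound) (δ-decrease v∈A t)))
    -- `A` is the single vertex `v`; there are no loops, so its three edges all cross, and 3 = 1 +
    -- 2.
    go (suc k) {A} le ne | inj₂ (v , v∈A , t) | no empty = inj₂ (≤-trans (≤-reflexive (cong (_+ 2) one))
        (length-≤-card (δ A) (slot (S v) zero ∷ slot (S v) (suc zero) ∷ slot (S v) (suc (suc zero)) ∷ [])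
          ((distinct (λ ()) ∷ distinct (λ ()) ∷ []) ∷ (distinct (λ ()) ∷ []) ∷ [] ∷ [])
          (out zero ∷ out (suc zero) ∷ out (suc (suc zero)) ∷ [])))
      where
      distinct : ∀ {i j} → i ≢ j → slot (S v) i ≢ slot (S v) j
      distinct i≢j eq = i≢j (slot-inj (S v) eq)
      one : ∣ A ∣ ≡ 1
      one = trans (∣minus∣ A v∈A) (cong suc (trans (cong ∣_∣ (Empty-unique empty)) (∣⊥∣≡0 order)))
      out : ∀ i → slot (S v) i ∈ δ A
      out i with inc-joins (slot-inc (S v) i)
      ... | w , j = δ⁺ j v∈A (λ w∈A → empty (w , x∈p∧x≢y⇒x∈p-y w∈A (≢-sym (joins-≢ j))))

  OpenedAt : Subgraph G → Edge → Vertex → Vertex → Set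
  OpenedAt C f a b = ∃[ E ] Path b a (Subgraph.vertices C) E × E ⊆ Subgraph.edges C × f ∉ E

  -- A path inside `C` starts at `a`, avoids `f` and is grown at its head. While the head is not
  -- `b`, it has degree 1 in the path together with `f`, so `C` offers another edge there; this edge
  -- cannot return to the path, whose other vertices have degree 2 already. Once the head is `b`,
  -- path and `f` use up all edges of `C` at the path's vertices, and connectedness makes the path
  -- span `C`.
  open-cycle : ∀ C {f a b} → IsCycle C → f ∈ Subgraph.edges C → Joins f a b → OpenedAt C f a b
  open-cycle C {f} {a} {b} ((_ , conn) , two) f∈C j = grow order here
      (λ h → subst (_∈ V) (sym (x∈⁅y⁆⇒x≡y a h)) a∈V) (λ h → contradiction h ∉⊥) ∉⊥ (ℕ.m≤m+n order _)
    where
    open Subgraph C renaming (vertices to V; edges to EC)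
    a∈V : a ∈ V
    a∈V = closed f∈C (joins-incˡ j)
    grow : ∀ k {u P E} → Path u a P E → P ⊆ V → E ⊆ EC → f ∉ E → order ≤ k + ∣ P ∣ → OpenedAt C f a b
    grow k {u} {P} {E} p P⊆V E⊆ f∉E fuel with u ≟ b
    ... | yes refl = E , subst (λ X → Path b a X E) (⊆-antisym P⊆V all) p , E⊆ , f∉E
      where
      F⊆ : E ∪ ⁅ f ⁆ ⊆ EC
      F⊆ h = [ (λ { refl → f∈C }) , E⊆ ] (∈-∪⁅⁆⁻ E h)
      next : ∀ {x y} → x ∈ P → Adj EC x y → y ∈ P
      next {x} x∈P (e , e∈C , k) with ∈-∪⁅⁆⁻ E (saturated F⊆ (≤-reflexive
        (trans (two (P⊆V x∈P)) (sym (closed-degree p j f∉E x∈P)))) e∈C (joins-incˡ k))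
      ... | inj₂ e∈E = path-closed p e∈E (joins-incʳ k)
      ... | inj₁ refl with joins-inc⁻ j (joins-incʳ k)
      ... | inj₁ refl = path-last p
      ... | inj₂ refl = path-head p
      all : V ⊆ P
      all v∈V = Reachability.closed-star (adj? EC) next (path-head p) (conn (P⊆V (path-head p)) v∈V)
    ... | no u≢b = continue k fuel (deg-extra {EC} {F} {u} (≤-trans (≤-reflexive (cong suc deg-u)) (≤-reflexive (sym (two (P⊆V (path-head p)))))))
      where
      F = E ∪ ⁅ f ⁆
      F⊆ : F ⊆ EC
      F⊆ h = [ (λ { refl → f∈C }) , E⊆ ] (∈-∪⁅⁆⁻ E h)
      -- The deficit of the path at its end `a` is cancelled by `f`, so only its head `u` and the
      -- far end `b` of `f` need a correction.
      balance : ∀ x → bit (x ≟ u) + deg F x ≡ bit (x ≟ b) + (bit (x ∈? P) + bit (x ∈? P))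
      balance x = begin
        bit (x ≟ u) + deg F x
          ≡⟨ cong (bit (x ≟ u) +_) (trans (deg-add f∉E x) (cong (_+ deg E x) (bit-incident j x))) ⟩
        bit (x ≟ u) + (bit (x ≟ a) + bit (x ≟ b) + deg E x)
          ≡⟨ solve 4 (λ p q r s → p :+ (q :+ r :+ s) := r :+ (s :+ (p :+ q))) refl (bit (x ≟ u)) (bit (x ≟ a)) (bit (x ≟ b)) (deg E x) ⟩
        bit (x ≟ b) + (deg E x + (bit (x ≟ u) + bit (x ≟ a)))
          ≡⟨ cong (bit (x ≟ b) +_) (path-degree p x) ⟩
        bit (x ≟ b) + (bit (x ∈? P) + bit (x ∈? P)) ∎
        where
        open ≡-Reasoning
        open +-*-Solver
      deg-u : deg F u ≡ 1
      deg-u = suc-injective (trans (cong (_+ deg F u) (sym (bit-yes (u ≟ u) refl))) (trans (balance u)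
        (cong₂ _+_ (bit-no (u ≟ b) u≢b) (cong₂ _+_ (bit-yes (u ∈? P) (path-head p)) (bit-yes (u ∈? P) (path-head p))))))
      deg-w : ∀ {w} → w ∈ P → w ≢ u → 2 ≤ deg F w
      deg-w {w} w∈P w≢u = ≤-trans (ℕ.m≤n+m 2 (bit (w ≟ b))) (≤-reflexive (sym (trans
        (cong (_+ deg F w) (sym (bit-no (w ≟ u) w≢u))) (trans (balance w)
          (cong (bit (w ≟ b) +_) (cong₂ _+_ (bit-yes (w ∈? P) w∈P) (bit-yes (w ∈? P) w∈P)))))))
      continue : ∀ m → order ≤ m + ∣ P ∣ → ∃[ e ] e ∈ EC × e ∉ F × Incident u e → OpenedAt C f a b
      continue m le (e , e∈C , e∉F , i) with inc-joins i
      ... | w , l with w ∈? P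
      ... | yes w∈P = contradiction (saturated F⊆ (≤-trans (≤-reflexive (two (P⊆V w∈P)))
                        (deg-w w∈P (≢-sym (joins-≢ l)))) e∈C (joins-incʳ l)) e∉F
      ... | no w∉P with m | le
      ... | zero | le = contradiction (≤-trans (s≤s le) (≤-trans (≤-reflexive (sym (∣∪⁅⁆∣ P w∉P))) (∣p∣≤n (P ∪ ⁅ w ⁆)))) 1+n≰n
      ... | suc m | le = grow m (step (joins-sym l) w∉P p)
          (λ h → [ (λ { refl → closed e∈C (joins-incʳ l) }) , P⊆V ] (∈-∪⁅⁆⁻ P h))
          (λ h → [ (λ { refl → e∈C }) , E⊆ ] (∈-∪⁅⁆⁻ E h))
          (λ h → [ (λ { refl → e∉F (∈-∪ʳ E) }) , f∉E ] (∈-∪⁅⁆⁻ E h))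
          (≤-trans le (≤-reflexive (trans (sym (+-suc m ∣ P ∣)) (cong (m +_) (sym (∣∪⁅⁆∣ P w∉P))))))

  digon : ∀ {e f x y} → e ≢ f → Joins e x y → Joins f x y →
          ∃[ C ] IsCycle {G} C × (∀ {z} → z ∈ Subgraph.vertices C → z ≡ x ⊎ z ≡ y) × ∣ Subgraph.vertices C ∣ ≡ 2
  digon {e} {f} {x} {y} e≢f j k =
    closePath p (joins-sym k) ,
    closePath-cycle p (joins-sym k) (λ h → [ (λ eq → e≢f (sym eq)) , ∉⊥ ] (∈-∪⁅⁆⁻ ⊥ h)) ,
    (λ h → [ inj₁ , (λ h′ → inj₂ (x∈⁅y⁆⇒x≡y y h′)) ] (∈-∪⁅⁆⁻ ⁅ y ⁆ h)) ,
    trans (∣∪⁅⁆∣ ⁅ y ⁆ x∉) (cong suc (∣⁅x⁆∣≡1 y))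
    where
    x∉ : x ∉ ⁅ y ⁆
    x∉ h = joins-≢ j (x∈⁅y⁆⇒x≡y y h)
    p : Path x y (⁅ y ⁆ ∪ ⁅ x ⁆) (⊥ ∪ ⁅ e ⁆)
    p = step j x∉ here

  Shortest : Subgraph G → Set
  Shortest C = IsCycle C × (∀ (D : Subgraph G) → IsCycle D → ∣ Subgraph.vertices C ∣ ≤ ∣ Subgraph.vertices D ∣)

  shortest : ∃[ C ] IsCycle {G} C → ∃[ C ] Shortest C
  shortest (C , cyc) = go ∣ Subgraph.vertices C ∣ C cyc ≤-refl
    where
    go : ∀ k C → IsCycle C → ∣ Subgraph.vertices C ∣ ≤ k → ∃[ C ] Shortest C
    go k C cyc le with anyCycle? (λ V _ → ∣ V ∣ <? ∣ Subgraph.vertices C ∣)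
    ... | no none = C , cyc , λ D cycD → ≮⇒≥ (λ lt → none (D , cycD , lt))
    go zero C cyc le | yes (D , cycD , lt) = contradiction (≤-trans lt le) λ ()
    go (suc k) C cyc le | yes (D , cycD , lt) = go k D cycD (≤-pred (≤-trans lt le))

  -- The vertex x splits C into two arcs, and x closes each of them to a cycle no shorter than C.
  chord-bound : ∀ {C x a b e f} → Shortest C → x ∉ Subgraph.vertices C → e ≢ f →
                Joins e x a → a ∈ Subgraph.vertices C → Joins f x b → b ∈ Subgraph.vertices C →
                ∣ Subgraph.vertices C ∣ ≤ 4
  chord-bound {C} {x} {a} {b} {e} {f} (cyc , min) x∉V e≢f j a∈V k b∈V with a ≟ b
  ... | yes refl = let (D , cycD , _ , eq) = digon e≢f j k in
      ≤-trans (min D cycD) (≤-trans (≤-reflexive eq) (s≤s (s≤s z≤n)))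
  ... | no a≢b with deg≡2⇒twoEdges (proj₂ cyc a∈V)
  ... | record { e = g ; e∈E = g∈C ; inc-e = g-inc } with inc-joins g-inc
  ... | c , l with open-cycle C cyc g∈C l
  -- The two cycles have `∣P₁∣ + 2` and `∣P₂∣ + 1` vertices, and the two halves of `C` share `b`;
  -- hence `∣V∣ + ∣V∣ ≤ ∣V∣ + 4`.
  ... | E , p , E⊆ , g∉E = +-cancelˡ-≤ ∣ V ∣ _ _ (≤-trans (+-mono-≤ (min (closePath q₁ (joins-sym k)) cycle₁) (min (closePath q₂ (joins-sym j)) cycle₂))
      (≤-trans (≤-reflexive (cong₂ _+_ size₁ size₂)) (≤-trans (≤-reflexive rearrange)
        (≤-trans (+-monoˡ-≤ 3 S.sizes) (≤-reflexive (sym (+-suc _ 3)))))))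
    where
    V = Subgraph.vertices C
    module S = Split (split p b∈V)
    rearrange : suc (suc ∣ S.P₁ ∣) + suc ∣ S.P₂ ∣ ≡ (∣ S.P₁ ∣ + ∣ S.P₂ ∣) + 3
    rearrange = solve 2 (λ m n → (con 2 :+ m) :+ (con 1 :+ n) := (m :+ n) :+ con 3) refl ∣ S.P₁ ∣ ∣ S.P₂ ∣
      where open +-*-Solver
    x∉P₁ : x ∉ S.P₁
    x∉P₁ = x∉V ∘ S.P₁⊆P
    x∉P₂ : x ∉ S.P₂
    x∉P₂ = x∉V ∘ S.P₂⊆P
    a∉P₁ : a ∉ S.P₁
    a∉P₁ h = a≢b (S.meet h (path-last S.path₂))
    x≢a : x ≢ a
    x≢a = joins-≢ j
    x∉P₁a : x ∉ S.P₁ ∪ ⁅ a ⁆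
    x∉P₁a h = [ x≢a , x∉P₁ ] (∈-∪⁅⁆⁻ S.P₁ h)
    q₁ : Path x b _ _
    q₁ = step j x∉P₁a (step l a∉P₁ S.path₁)
    cycle₁ : IsCycle (closePath q₁ (joins-sym k))
    cycle₁ = closePath-cycle q₁ (joins-sym k) (λ h → e≢f (path-head-unique q₁ (∈-∪ʳ _) h (joins-incˡ j) (joins-incˡ k)))
    size₁ : ∣ (S.P₁ ∪ ⁅ a ⁆) ∪ ⁅ x ⁆ ∣ ≡ suc (suc ∣ S.P₁ ∣)
    size₁ = trans (∣∪⁅⁆∣ (S.P₁ ∪ ⁅ a ⁆) x∉P₁a) (cong suc (∣∪⁅⁆∣ S.P₁ a∉P₁))
    q₂ : Path x a _ _
    q₂ = step k x∉P₂ S.path₂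
    cycle₂ : IsCycle (closePath q₂ (joins-sym j))
    cycle₂ = closePath-cycle q₂ (joins-sym j) (λ h → e≢f (path-head-unique q₂ h (∈-∪ʳ _) (joins-incˡ j) (joins-incˡ k)))
    size₂ : ∣ S.P₂ ∪ ⁅ x ⁆ ∣ ≡ suc ∣ S.P₂ ∣
    size₂ = ∣∪⁅⁆∣ S.P₂ x∉P₂

-- Dominating cycles in the absence of two disjoint cycles

module Domination (G : Graph) (S : ∀ v → Cubics.Slots G v) where
  open Graph G
  open Basics G
  open Cubics G

  TwoDisjointCycles : Set
  TwoDisjointCycles = ∃[ C ] ∃[ D ] IsCycle {G} C × IsCycle {G} D × Disjoint C D

  DominatingCycle : Set
  DominatingCycle = ∃[ C ] IsDominatingCycle {G} C

  cycleIn-∁ : ∀ C → IsCycle {G} C → CycleIn (∁ (Subgraph.vertices C)) → TwoDisjointCycles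
  cycleIn-∁ C cyc (D , cycD , sub) = C , D , cyc , cycD , λ v∈C v∈D → x∈∁p⇒x∉p (sub v∈D) v∈C

  -- With C a shortest cycle, its complement contains either a cycle or at most one edge xy;
  -- in the latter case an edge ab of C with a ~ x and b ~ y can be replaced by the path a x y b.
  module _ (C : Subgraph G) (short : Shortest C) where
    private
      open Subgraph C renaming (vertices to V; edges to EC)
      A = ∁ V
      cyc = proj₁ short

      module _ (no-cycle : ¬ CycleIn A) where

        A⇒∉V : ∀ {v} → v ∈ A → v ∉ V
        A⇒∉V = x∈∁p⇒x∉p

        ∉A⇒V : ∀ {v} → v ∉ A → v ∈ V
        ∉A⇒V = x∉∁p⇒x∈p

        δ∉C : ∀ {e} → e ∈ δ A → e ∉ EC
        δ∉C h e∈C with δ⁻ h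
        ... | u , v , j , u∈A , _ = A⇒∉V u∈A (closed e∈C (joins-incˡ j))

        leaving-unique : ∀ {v e f} → v ∈ V → e ∉ EC → f ∉ EC → Incident v e → Incident v f → e ≡ f
        leaving-unique {v} v∈V = third-unique (S v) (proj₂ cyc v∈V)

        -- A vertex of `C` has only one edge outside `C`, so a crossing edge is determined by its
        -- end on `C`.
        δ≤V : ∣ δ A ∣ ≤ ∣ V ∣
        δ≤V = card-≤-inj (δ A) V (λ e v → v ∈ V × e ∉ EC × Incident v e)
          (λ h → let (u , v , j , _ , v∉A) = δ⁻ h in
            v , ∉A⇒V v∉A , ∉A⇒V v∉A , δ∉C h , joins-incʳ j)
          (λ (v∈V , e∉ , i) (_ , f∉ , k) → leaving-unique v∈V e∉ f∉ i k)

        data Out (x : Vertex) : Set where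
          out : ∀ {e f a b} → e ≢ f → Joins e x a → Joins f x b → a ∈ V → b ∈ V → Out x

        toOut : ∀ {x} → x ∈ A → TwoOut A x → Out x
        toOut {x} x∈A T with inc-joins T.inc-a | inc-joins T.inc-b
          where module T = TwoOut T
        ... | a , j | b , k = out T.a≢b j k (far T.a∈δ j) (far T.b∈δ k)
          where
          module T = TwoOut T
          far : ∀ {e y} → e ∈ δ A → Joins e x y → y ∈ V
          far h l with δ⁻ h
          ... | u , v , m , u∈A , v∉A with joins-inc⁻ l (joins-incʳ m)
          ... | inj₁ refl = contradiction x∈A v∉A
          ... | inj₂ refl = ∉A⇒V v∉A

        inside⊎out : ∀ {x} → x ∈ A → TwoInside A x ⊎ Out x
        inside⊎out {x} x∈A with twoInside⊎twoOut (S x) x∈A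
        ... | inj₁ t = inj₁ t
        ... | inj₂ t = inj₂ (toOut x∈A t)

        dominates-if : (∀ {e u v} → Joins e u v → u ∈ A → v ∉ A) → Dominates C ⊤
        dominates-if indep {e} _ with proj₁ (ends e) ∈? A
        ... | no u∉A = _ , ∉A⇒V u∉A , inj₁ refl
        ... | yes u∈A = _ , ∉A⇒V (indep (joins-ends e) u∈A) , inj₂ refl

        module _ (nonempty : Nonempty A) where

          A≤ : ∣ A ∣ + 2 ≤ ∣ V ∣
          A≤ with cycle⊎boundary S nonempty
          ... | inj₁ c = contradiction c no-cycle
          ... | inj₂ le = ≤-trans le δ≤V

          -- If every vertex of `A` had two edges inside `A`, there would be a cycle in `A`. So some
          -- vertex sends two edges to `C`, and a shortest cycle with such a vertex beside it is
          -- short.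
          V≤4 : ∣ V ∣ ≤ 4
          V≤4 with all⊎any dichotomy
            where
            dichotomy : ∀ x → (x ∈ A → TwoInside A x) ⊎ (x ∈ A × Out x)
            dichotomy x with x ∈? A
            ... | no x∉A = inj₁ (λ h → contradiction h x∉A)
            ... | yes x∈A with inside⊎out x∈A
            ... | inj₁ t = inj₁ (λ _ → t)
            ... | inj₂ o = inj₂ (x∈A , o)
          ... | inj₁ two = contradiction (twoInside⇒cycle A (two _) nonempty) no-cycle
          ... | inj₂ (x , x∈A , out e≢f j k a∈V b∈V) = chord-bound {C = C} short (A⇒∉V x∈A) e≢f j a∈V k b∈V

          A≤2 : ∣ A ∣ ≤ 2
          A≤2 = ℕ.+-cancelʳ-≤ 2 ∣ A ∣ 2 (≤-trans A≤ V≤4)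

          module _ {x y g} (xy : Joins g x y) (x∈A : x ∈ A) (y∈A : y ∈ A) where

            A-pair : ∀ {z} → z ∈ A → z ≡ x ⊎ z ≡ y
            A-pair {z} z∈A with z ≟ x | z ≟ y
            ... | yes eq | _      = inj₁ eq
            ... | no _   | yes eq = inj₂ eq
            ... | no z≢x | no z≢y = contradiction
              (≤-trans (length-≤-card A (z ∷ x ∷ y ∷ [])
                ((z≢x ∷ z≢y ∷ []) ∷ (joins-≢ xy ∷ []) ∷ [] ∷ []) (z∈A ∷ x∈A ∷ y∈A ∷ [])) A≤2) 1+n≰n

            not-inside : ∀ {z} → z ∈ A → ¬ TwoInside A z
            not-inside {z} z∈A (e , f , w , w′ , e≢f , (j , w∈A) , (k , w′∈A)) with w ≟ w′
            ... | yes refl = no-cycle (let (D , cycD , sub , _) = digon e≢f j k in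
                    D , cycD , λ h → [ (λ { refl → z∈A }) , (λ { refl → w∈A }) ] (sub h))
            ... | no w≢w′ = contradiction (≤-trans (length-≤-card A (z ∷ w ∷ w′ ∷ [])
                ((joins-≢ j ∷ joins-≢ k ∷ []) ∷ (w≢w′ ∷ []) ∷ [] ∷ []) (z∈A ∷ w∈A ∷ w′∈A ∷ [])) A≤2) 1+n≰n

            only-out : ∀ {z} → z ∈ A → Out z
            only-out z∈A = [ (λ t → contradiction t (not-inside z∈A)) , id ] (inside⊎out z∈A)

            Near : Vertex → Vertex → Set
            Near z v = ∃[ e ] Joins e z v × v ∈ V

            leaves : ∀ {z v e} → z ∈ A → Joins e z v → e ∉ EC
            leaves z∈A j e∈C = A⇒∉V z∈A (closed e∈C (joins-incˡ j))

            distinct : ∀ {z e f a b} → z ∈ A → e ≢ f → Joins e z a → Joins f z b → a ∈ V → a ≢ b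
            distinct z∈A e≢f j k a∈V refl =
              e≢f (leaving-unique a∈V (leaves z∈A j) (leaves z∈A k) (joins-incʳ j) (joins-incʳ k))

            -- The only edge of `v` outside `C` would join it to `x` and to `y` at once.
            apart : ∀ {v} → Near x v → ¬ Near y v
            apart (e , j , v∈V) (f , k , _) with leaving-unique v∈V (leaves x∈A j) (leaves y∈A k) (joins-incʳ j) (joins-incʳ k)
            ... | refl with joins-inc⁻ j (joins-incˡ k)
            ... | inj₁ y≡x = joins-≢ xy (sym y≡x)
            ... | inj₂ refl = A⇒∉V y∈A v∈V

            -- Each of `x` and `y` has two neighbours on `C`. These four vertices are distinct, and
            -- `C` has no more than four.
            all-near : ∀ {v} → v ∈ V → Near x v ⊎ Near y v
            all-near {v} v∈V with only-out x∈A | only-out y∈A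
            ... | out {a = a} {b} e≢f j k a∈V b∈V | out {a = c} {d} e′≢f′ j′ k′ c∈V d∈V
              with v ≟ a | v ≟ b | v ≟ c | v ≟ d
            ... | yes refl | _ | _ | _ = inj₁ (_ , j , v∈V)
            ... | no _ | yes refl | _ | _ = inj₁ (_ , k , v∈V)
            ... | no _ | no _ | yes refl | _ = inj₂ (_ , j′ , v∈V)
            ... | no _ | no _ | no _ | yes refl = inj₂ (_ , k′ , v∈V)
            ... | no v≢a | no v≢b | no v≢c | no v≢d = contradiction
                (≤-trans (length-≤-card V (v ∷ a ∷ b ∷ c ∷ d ∷ [])
                  ((v≢a ∷ v≢b ∷ v≢c ∷ v≢d ∷ [])
                    ∷ (distinct x∈A e≢f j k a∈V ∷ cross j a∈V j′ c∈V ∷ cross j a∈V k′ d∈V ∷ [])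
                    ∷ (cross k b∈V j′ c∈V ∷ cross k b∈V k′ d∈V ∷ [])
                    ∷ (distinct y∈A e′≢f′ j′ k′ c∈V ∷ []) ∷ [] ∷ [])
                  (v∈V ∷ a∈V ∷ b∈V ∷ c∈V ∷ d∈V ∷ [])) V≤4) 1+n≰n
              where
              cross : ∀ {e f p q} → Joins e x p → p ∈ V → Joins f y q → q ∈ V → p ≢ q
              cross l p∈V m q∈V refl = apart (_ , l , p∈V) (_ , m , q∈V)

            rerouted : DominatingCycle
            rerouted with only-out x∈A | only-out y∈A
            ... | out {a = a} _ j _ a∈V _ | out {a = c} _ k _ c∈V _ with star-crossing {X = Near x} {Y = Near y}
                  (λ { _ (e , e∈C , l) → all-near (closed e∈C (joins-incʳ l)) }) apart
                  (proj₂ (proj₁ cyc) a∈V c∈V) (_ , j , a∈V) (_ , k , c∈V)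
            ... | p , q , (f , f∈C , l) , (e , xp , p∈V) , (e′ , yq , q∈V) with open-cycle C cyc f∈C l
            ... | E , path , _ , _ = closePath path′ (joins-sym xp) , closePath-cycle path′ (joins-sym xp) fresh , dominates
              where
              y∉V : y ∉ V
              y∉V = A⇒∉V y∈A
              x∉Vy : x ∉ V ∪ ⁅ y ⁆
              x∉Vy h = [ joins-≢ xy , A⇒∉V x∈A ] (∈-∪⁅⁆⁻ V h)
              path′ : Path x p ((V ∪ ⁅ y ⁆) ∪ ⁅ x ⁆) ((E ∪ ⁅ e′ ⁆) ∪ ⁅ g ⁆)
              path′ = step xy x∉Vy (step yq y∉V path)
              fresh : e ∉ (E ∪ ⁅ e′ ⁆) ∪ ⁅ g ⁆
              fresh h with path-head-unique path′ h (∈-∪ʳ _) (joins-incˡ xp) (joins-incˡ xy)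
              ... | refl with joins-unique xp xy
              ... | refl = y∉V p∈V
              -- The complement of `C` consists of `x` and `y` alone, so the rerouted cycle is
              -- spanning.
              dominates : Dominates (closePath path′ (joins-sym xp)) ⊤
              dominates {e} _ with proj₁ (ends e) ∈? A
              ... | no u∉A = _ , ∈-∪ˡ (∈-∪ˡ (∉A⇒V u∉A)) , inj₁ refl
              ... | yes u∈A with A-pair u∈A
              ... | inj₁ eq = _ , subst (_∈ (V ∪ ⁅ y ⁆) ∪ ⁅ x ⁆) (sym eq) (∈-∪ʳ (V ∪ ⁅ y ⁆)) , inj₁ refl
              ... | inj₂ eq = _ , subst (_∈ (V ∪ ⁅ y ⁆) ∪ ⁅ x ⁆) (sym eq) (∈-∪ˡ (∈-∪ʳ V)) , inj₁ refl

        dominating : DominatingCycle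
        dominating with any? (λ e → (proj₁ (ends e) ∈? A) ×-dec (proj₂ (ends e) ∈? A))
        ... | yes (e , u∈A , v∈A) = rerouted (_ , u∈A) (joins-ends e) u∈A v∈A
        ... | no none = C , cyc , dominates-if indep
          where
          indep : ∀ {e u v} → Joins e u v → u ∈ A → v ∉ A
          indep {e} (inj₁ refl) u∈A v∈A = none (e , u∈A , v∈A)
          indep {e} (inj₂ refl) u∈A v∈A = none (e , v∈A , u∈A)

    twoDisjoint⊎dominating-shortest : TwoDisjointCycles ⊎ DominatingCycle
    twoDisjoint⊎dominating-shortest with anyCycle? (λ V′ _ → V′ ⊆? A)
    ... | yes cycleIn = inj₁ (cycleIn-∁ C cyc cycleIn)
    ... | no none = inj₂ (dominating none)

  -- A cycle to start from exists because the whole vertex set has empty boundary, whereas a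
  -- nonempty set without a cycle has boundary edges.
  twoDisjoint⊎dominating : Vertex → TwoDisjointCycles ⊎ DominatingCycle
  twoDisjoint⊎dominating v with cycle⊎boundary S {⊤} (v , ∈⊤)
  ... | inj₁ (C , cyc , _) = let (C′ , short) = shortest (C , cyc) in twoDisjoint⊎dominating-shortest C′ short
  ... | inj₂ le = contradiction
    (≤-trans (≤-trans (ℕ.m≤n+m 2 ∣ ⊤ {order} ∣) le) (card-≤-length (δ ⊤) [] (λ h → contradiction h (δ-inside (λ _ → ∈⊤))))) λ ()

  -- Three edges at a vertex of `C` and two edges of `D` are five different edges, since no edge of
  -- `D` touches `C`. Five is what 4-connectedness of the line graph demands of its order.
  twoDisjoint⇒size≥5 : TwoDisjointCycles → 5 ≤ size
  twoDisjoint⇒size≥5 (C , D , (((c , c∈C) , _) , _) , (((d , d∈D) , _) , two) , disj) =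
    ≤-trans (count (deg≡2⇒twoEdges (two d∈D))) (≤-reflexive (∣⊤∣≡n size))
    where
    open Slots (S c)
    distinct : ∀ {i j} → i ≢ j → slot i ≢ slot j
    distinct i≢j eq = i≢j (slot-inj eq)
    apart : ∀ i {g} → g ∈ Subgraph.edges D → slot i ≢ g
    apart i g∈D eq = disj c∈C (Subgraph.closed D g∈D (subst (Incident c) eq (slot-inc i)))
    count : TwoEdges (Subgraph.edges D) d → 5 ≤ ∣ ⊤ {size} ∣
    count T = length-≤-card ⊤ (slot zero ∷ slot (suc zero) ∷ slot (suc (suc zero)) ∷ T.e ∷ T.f ∷ [])
      ((distinct (λ ()) ∷ distinct (λ ()) ∷ apart zero T.e∈E ∷ apart zero T.f∈E ∷ [])
        ∷ (distinct (λ ()) ∷ apart (suc zero) T.e∈E ∷ apart (suc zero) T.f∈E ∷ [])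
        ∷ (apart (suc (suc zero)) T.e∈E ∷ apart (suc (suc zero)) T.f∈E ∷ []) ∷ (T.e≢f ∷ []) ∷ [] ∷ [])
      (∈⊤ ∷ ∈⊤ ∷ ∈⊤ ∷ ∈⊤ ∷ ∈⊤ ∷ [])
      where module T = TwoEdges T

-- Cyclic edge cuts

-- `P` is not assumed decidable, so the descent can only refute the absence of a minimum.
minimum-card : ∀ {n} {P : Subset n → Set} {F} → P F → ¬ ¬ (∃[ F ] P F × (∀ F′ → P F′ → ∣ F ∣ ≤ ∣ F′ ∣))
minimum-card {n} {P} {F₀} p none = go ∣ F₀ ∣ F₀ p ≤-refl
  where
  go : ∀ k F → P F → ¬ (∣ F ∣ ≤ k)
  go zero F p le = none (F , p , λ F′ p′ → ≤-trans le z≤n)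
  go (suc k) F p le = none (F , p , λ F′ p′ → ≮⇒≥ (λ lt → go k F′ p′ (≤-pred (≤-trans lt le))))

module EdgeCuts (G : Graph) where
  open Graph G
  open Basics G
  open Cubics G
  open Subgraph

  module _ (F : Subset size) (u : Vertex) where
    private
      reach = Reachability.reachable (adj? (∁ F)) u
      T = proj₁ reach
      -- Testing one end suffices: `T` is closed under the edges outside `F`.
      edge? : ∀ e → Dec (e ∈ ∁ F × proj₁ (ends e) ∈ T)
      edge? e = (e ∈? ∁ F) ×-dec (proj₁ (ends e) ∈? T)

      T-closed : ∀ {e x y} → e ∈ ∁ F → Joins e x y → x ∈ T → y ∈ T
      T-closed e∉F j x∈T = proj₁ (proj₂ (proj₂ reach)) x∈T (_ , e∉F , j)

    component : Subgraph G
    component = record { vertices = T ; edges = ⟦ edge? ⟧ ; closed = closed′ }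
      where
      closed′ : ∀ {e v} → e ∈ ⟦ edge? ⟧ → Incident v e → v ∈ T
      closed′ {e} h i with ∈⟦⟧⁻ edge? h | i
      ... | _   , u∈T | inj₁ refl = u∈T
      ... | e∉F , u∈T | inj₂ refl = T-closed e∉F (joins-ends e) u∈T

    component-root : u ∈ vertices component
    component-root = proj₁ (proj₂ reach)

    component-edge : ∀ {e v} → e ∈ ∁ F → Incident v e → v ∈ T → e ∈ edges component
    component-edge e∉F (inj₁ refl) v∈T = ∈⟦⟧⁺ edge? (e∉F , v∈T)
    component-edge {e} e∉F (inj₂ refl) v∈T = ∈⟦⟧⁺ edge? (e∉F , T-closed e∉F (joins-sym (joins-ends e)) v∈T)

    component-step : ∀ {e x y} → e ∈ ∁ F → Joins e x y → x ∈ vertices component → y ∈ vertices component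
    component-step = T-closed

    component-reach : ∀ {x y} → x ∈ T → Star (Adj (∁ F)) x y → y ∈ T
    component-reach = Reachability.closed-star (adj? (∁ F)) (proj₁ (proj₂ (proj₂ reach)))

    component-least : ∀ {S} → u ∈ S → (∀ {x y} → x ∈ S → Adj (∁ F) x y → y ∈ S) → vertices component ⊆ S
    component-least u∈S next h = Reachability.closed-star (adj? (∁ F)) next u∈S (proj₂ (proj₂ (proj₂ reach)) h)

    private
      restrict : ∀ {x y} → x ∈ T → Star (Adj (∁ F)) x y → Star (Adj (edges component)) x y
      restrict x∈T ε = ε
      restrict x∈T ((e , e∉F , j) ◅ rs) =
        (e , component-edge e∉F (joins-incˡ j) x∈T , j) ◅ restrict (T-closed e∉F j x∈T) rs

    component-connected : Connected component
    component-connected = (u , component-root) , λ x∈T y∈T → star-sym (from-root x∈T) ◅◅ from-root y∈T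
      where
      from-root : ∀ {x} → x ∈ T → Star (Adj (edges component)) u x
      from-root h = restrict component-root (proj₂ (proj₂ (proj₂ reach)) h)

    component-⊑ : component ⊑ deleteEdges G F
    component-⊑ = (λ _ → ∈⊤) , (λ h → proj₁ (∈⟦⟧⁻ edge? h))

    component-maximal : ∀ K → K ⊑ deleteEdges G F → Connected K → u ∈ vertices K → K ⊑ component
    component-maximal K (_ , E⊆) (_ , conn) u∈K = in-T , λ e∈K →
      component-edge (E⊆ e∈K) (inj₁ refl) (in-T (closed K e∈K (inj₁ refl)))
      where
      in-T : vertices K ⊆ T
      in-T v∈K = component-reach component-root (star-mono E⊆ (conn u∈K v∈K))

    component-isComponent : IsComponent (deleteEdges G F) component
    component-isComponent = component-⊑ , component-connected ,
      λ K K⊑ conn ⊑K → component-maximal K K⊑ conn (proj₁ ⊑K component-root)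

  isComponent⇒⊒ : ∀ {F} K {v} → IsComponent (deleteEdges G F) K → v ∈ vertices K →
                  component F v ⊑ K × K ⊑ component F v
  isComponent⇒⊒ {F} K {v} (K⊑ , conn , maximal) v∈K =
    maximal (component F v) (component-⊑ F v) (component-connected F v) K⊑comp , K⊑comp
    where
    K⊑comp : K ⊑ component F v
    K⊑comp = component-maximal F v K K⊑ conn v∈K

  -- A cyclic cut asks for components, not merely for sides. The component of a vertex of `C` and
  -- that of a vertex of `D` contain these whole cycles, so neither is a tree; they differ because
  -- the first one stays within `A`.
  δ-cyclicEdgeCut : ∀ A → CycleIn A → CycleIn (∁ A) → IsCyclicEdgeCut G (δ A)
  δ-cyclicEdgeCut A (C , cycC , C⊆A) (D , cycD , D⊆∁A) =
    (λ (_ , conn) → separated (component-reach (δ A) c (component-root (δ A) c) (conn ∈⊤ ∈⊤))) ,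
    K , L , component-isComponent (δ A) c , component-isComponent (δ A) d ,
    (λ (_ , L⊑K) → separated (proj₁ L⊑K (component-root (δ A) d))) ,
    (λ (_ , acyclic) → acyclic (C , cycC , within C cycC avoidC)) ,
    (λ (_ , acyclic) → acyclic (D , cycD , within D cycD avoidD))
    where
    c = proj₁ (proj₁ (proj₁ cycC))
    d = proj₁ (proj₁ (proj₁ cycD))
    K = component (δ A) c
    L = component (δ A) d
    K⊆A : vertices K ⊆ A
    K⊆A = component-least (δ A) c (C⊆A (proj₂ (proj₁ (proj₁ cycC)))) next
      where
      next : ∀ {x y} → x ∈ A → Adj (∁ (δ A)) x y → y ∈ A
      next {x} {y} x∈A (e , e∉ , j) with y ∈? A
      ... | yes y∈A = y∈A
      ... | no y∉A = contradiction (δ⁺ j x∈A y∉A) (x∈∁p⇒x∉p e∉)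
    separated : d ∉ vertices K
    separated h = x∈∁p⇒x∉p (D⊆∁A (proj₂ (proj₁ (proj₁ cycD)))) (K⊆A h)
    avoidC : edges C ⊆ ∁ (δ A)
    avoidC h = x∉p⇒x∈∁p (δ-inside (λ i → C⊆A (closed C h i)))
    avoidD : edges D ⊆ ∁ (δ A)
    avoidD h = x∉p⇒x∈∁p (δ-outside (λ i → x∈∁p⇒x∉p (D⊆∁A (closed D h i))))
    within : ∀ B (cyc : IsCycle {G} B) → edges B ⊆ ∁ (δ A) → B ⊑ component (δ A) (proj₁ (proj₁ (proj₁ cyc)))
    within B (((b , b∈B) , conn) , _) avoid =
      component-maximal (δ A) b B ((λ _ → ∈⊤) , avoid) ((b , b∈B) , conn) b∈B

  dominatingCycle? : ∀ F → Dec (∃[ C ] IsCycle {G} C × Dominates C F)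
  dominatingCycle? F = anyCycle? (λ V E → map′ (λ f {e} → f e) (λ f e → f)
    (all? (λ e → (e ∈? F) →-dec any? (λ v → (v ∈? V) ×-dec incident? v e))))

  -- The boundary of `C` is a cyclic cut, which gives the search for a minimum one its start; the
  -- double negation comes from that search.
  cyclicallyEdgeConnected : Connected (whole G) → (∃[ C ] ∃[ D ] IsCycle {G} C × IsCycle {G} D × Disjoint C D) →
    ∀ {k} → (∀ F → IsCyclicEdgeCut G F → k ≤ ∣ F ∣) → ¬ ¬ CyclicallyEdgeConnected G k
  cyclicallyEdgeConnected conn two@(C , D , cycC , cycD , disj) bound none =
    minimum-card {P = IsCyclicEdgeCut G} cut λ (F , isCut , min) →
      none (conn , ∣ F ∣ , (two , (F , isCut , refl) , min) , bound F isCut)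
    where
    cut : IsCyclicEdgeCut G (δ (vertices C))
    cut = δ-cyclicEdgeCut (vertices C) (C , cycC , id) (D , cycD , λ v∈D → x∉p⇒x∈∁p (λ v∈C → disj v∈C v∈D))

-- Contractions

module Quotient (G : Graph) {k : ℕ} (π : Fin (Graph.order G) → Fin k) where
  open Graph G

  survives? : ∀ e → Dec (π (proj₁ (ends e)) ≢ π (proj₂ (ends e)))
  survives? e = ¬? (π (proj₁ (ends e)) ≟ π (proj₂ (ends e)))

  open Enumeration survives? public

  -- One construction serves both contractions. For the `π` of a perfect matching it is `G /ᴹ M` by
  -- computation; later `π` collapses triangles.
  graph : Graph
  graph = record
    { order    = k
    ; size     = length elements
    ; ends     = Product.map π π ∘ ends ∘ lookup elements
    ; loopless = λ i → All.lookup (all-filter survives? (allFin size)) (∈-lookup i)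
    }

  original : Graph.Edge graph → Edge
  original = lookup elements

  original-injective : ∀ {i j} → original i ≡ original j → i ≡ j
  original-injective = lookup-injective elements-unique

  joins⁻ : ∀ {j x y} → Graph.Joins graph j x y → ∃[ u ] ∃[ v ] Joins (original j) u v × π u ≡ x × π v ≡ y
  joins⁻ (inj₁ refl) = _ , _ , inj₁ refl , refl , refl
  joins⁻ (inj₂ refl) = _ , _ , inj₂ refl , refl , refl

  joins⁺ : ∀ {j u v} → Joins (original j) u v → Graph.Joins graph j (π u) (π v)
  joins⁺ (inj₁ eq) = inj₁ (cong (Product.map π π) eq)
  joins⁺ (inj₂ eq) = inj₂ (cong (Product.map π π) eq)

  incident⁻ : ∀ {j x} → Graph.Incident graph x j → ∃[ u ] Incident u (original j) × π u ≡ x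
  incident⁻ (inj₁ refl) = _ , inj₁ refl , refl
  incident⁻ (inj₂ refl) = _ , inj₂ refl , refl

  incident⁺ : ∀ {j u} → Incident u (original j) → Graph.Incident graph (π u) j
  incident⁺ (inj₁ refl) = inj₁ refl
  incident⁺ (inj₂ refl) = inj₂ refl

  joins-survive : ∀ {e u v} → Joins e u v → π u ≢ π v → π (proj₁ (ends e)) ≢ π (proj₂ (ends e))
  joins-survive (inj₁ refl) ne = ne
  joins-survive (inj₂ refl) ne = ≢-sym ne

  survive-joins : ∀ {e u v} → Joins e u v → π (proj₁ (ends e)) ≢ π (proj₂ (ends e)) → π u ≢ π v
  survive-joins (inj₁ refl) ne = ne
  survive-joins (inj₂ refl) ne = ≢-sym ne

  lift-edge : ∀ {e u v} → Joins e u v → π u ≢ π v → ∃[ j ] original j ≡ e × Graph.Joins graph j (π u) (π v)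
  lift-edge {e} j ne = position s , lookup-position s ,
    joins⁺ (subst (λ f → Joins f _ _) (sym (lookup-position s)) j)
    where s = joins-survive {e = e} j ne

module MatchingContraction (G : Graph) (M : PerfectMatching G) where
  open Graph G
  open PerfectMatching M
  open Contraction G M using (contracted; π) public

  partnerEdge : Vertex → Edge
  partnerEdge v = proj₁ (covering v)

  partnerEdge-∈ : ∀ v → partnerEdge v ∈ matching
  partnerEdge-∈ v = proj₁ (proj₂ (covering v))

  partnerEdge-incident : ∀ v → Incident v (partnerEdge v)
  partnerEdge-incident v = proj₂ (proj₂ (covering v))

  partnerEdge-unique : ∀ {e v} → e ∈ matching → Incident v e → partnerEdge v ≡ e
  partnerEdge-unique {v = v} e∈M i = disjoint (partnerEdge-∈ v) e∈M (partnerEdge-incident v) i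

  label : Fin (length contracted) → Edge
  label = lookup contracted

  open Enumeration (_∈? matching) using (elements-unique; lookup-sound)

  label-∈ : ∀ x → label x ∈ matching
  label-∈ = lookup-sound

  label-injective : ∀ {x y} → label x ≡ label y → x ≡ y
  label-injective = lookup-injective elements-unique

  label-π : ∀ v → label (π v) ≡ partnerEdge v
  label-π v with covering v
  ... | e , e∈M , _ = sym (lookup-index (∈-filter⁺ (_∈? matching) (∈-allFin e) e∈M))

  label-incident : ∀ {v x} → Incident v (label x) → π v ≡ x
  label-incident {v} {x} i = label-injective (trans (label-π v) (partnerEdge-unique (label-∈ x) i))

  π-surjective : ∀ x → ∃[ v ] π v ≡ x
  π-surjective x = proj₁ (ends (label x)) , label-incident (inj₁ refl)

-- Inflating vertices to triangles

rot : Fin 3 → Fin 3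
rot zero             = suc zero
rot (suc zero)       = suc (suc zero)
rot (suc (suc zero)) = zero

rot≢ : ∀ i → rot i ≢ rot (rot i)
rot≢ zero ()
rot≢ (suc zero) ()
rot≢ (suc (suc zero)) ()

rot³ : ∀ i → rot (rot (rot i)) ≡ i
rot³ zero             = refl
rot³ (suc zero)       = refl
rot³ (suc (suc zero)) = refl

opposite : ∀ {i j} → i ≢ j → ∃[ k ] ((i ≡ rot k × j ≡ rot (rot k)) ⊎ (j ≡ rot k × i ≡ rot (rot k)))
opposite {zero} {zero} ne = contradiction refl ne
opposite {zero} {suc zero} _ = suc (suc zero) , inj₁ (refl , refl)
opposite {zero} {suc (suc zero)} _ = suc zero , inj₂ (refl , refl)
opposite {suc zero} {zero} _ = suc (suc zero) , inj₂ (refl , refl)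
opposite {suc zero} {suc zero} ne = contradiction refl ne
opposite {suc zero} {suc (suc zero)} _ = zero , inj₁ (refl , refl)
opposite {suc (suc zero)} {zero} _ = suc zero , inj₁ (refl , refl)
opposite {suc (suc zero)} {suc zero} _ = zero , inj₂ (refl , refl)
opposite {suc (suc zero)} {suc (suc zero)} ne = contradiction refl ne

module Inflation (G : Graph) (S : ∀ v → Cubics.Slots G v) where
  open Graph G
  open Basics G
  module Slot v = Cubics.Slots (S v)
  open Slot

  port : ∀ {v e} → Incident v e → Fin 3
  port {v} i = proj₁ (slot-cover v i)

  slot-port : ∀ {v e} (i : Incident v e) → slot v (port i) ≡ e
  slot-port {v} i = proj₂ (slot-cover v i)

  corner : Vertex → Fin 3 → Fin (order * 3)
  corner = combine

  base : Fin (order * 3) → Vertex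
  base x = proj₁ (remQuot 3 x)

  base-corner : ∀ v i → base (corner v i) ≡ v
  base-corner v i = cong proj₁ (remQuot-combine v i)

  corner-injective : ∀ {u i v j} → corner u i ≡ corner v j → u ≡ v × i ≡ j
  corner-injective eq = combine-injective _ _ _ _ eq

  data CornerView : Fin (order * 3) → Set where
    isCorner : ∀ v i → CornerView (corner v i)

  cornerView : ∀ x → CornerView x
  cornerView x = subst CornerView (combine-remQuot {order} 3 x) (isCorner _ _)

  mate : Edge → Fin (size + order * 3)
  mate e = e ↑ˡ (order * 3)

  -- This is the side of the triangle at `v` opposite to `corner v i`, so the sides at that corner
  -- are numbered `rot i` and `rot (rot i)`.
  side : Vertex → Fin 3 → Fin (size + order * 3)
  side v i = size ↑ʳ combine v i

  data EdgeView : Fin (size + order * 3) → Set where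
    isMate : ∀ e → EdgeView (mate e)
    isSide : ∀ v i → EdgeView (side v i)

  edgeView : ∀ x → EdgeView x
  edgeView x with splitAt size x in eq
  ... | inj₁ e = subst EdgeView (splitAt⁻¹-↑ˡ eq) (isMate e)
  ... | inj₂ t = subst EdgeView (trans (cong (size ↑ʳ_) (combine-remQuot {order} 3 t)) (splitAt⁻¹-↑ʳ {size} eq)) (isSide _ _)

  mate-injective : ∀ {e f} → mate e ≡ mate f → e ≡ f
  mate-injective = ↑ˡ-injective _ _ _

  side-injective : ∀ {u i v j} → side u i ≡ side v j → u ≡ v × i ≡ j
  side-injective eq = combine-injective _ _ _ _ (↑ʳ-injective size _ _ eq)

  mate≢side : ∀ {e v i} → mate e ≢ side v i
  mate≢side {e} {v} {i} eq with trans (sym (splitAt-↑ˡ size e _)) (trans (cong (splitAt size) eq) (splitAt-↑ʳ size _ (combine v i)))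
  ... | ()

  private
    matesEnds : Edge → Fin (order * 3) × Fin (order * 3)
    matesEnds e = corner (proj₁ (ends e)) (port {e = e} (inj₁ refl)) , corner (proj₂ (ends e)) (port {e = e} (inj₂ refl))

    sideEnds : Fin order × Fin 3 → Fin (order * 3) × Fin (order * 3)
    sideEnds (v , i) = corner v (rot i) , corner v (rot (rot i))

    edgeEnds : Edge ⊎ Fin (order * 3) → Fin (order * 3) × Fin (order * 3)
    edgeEnds = [ matesEnds , (λ t → sideEnds (remQuot 3 t)) ]

    edgeEnds-≢ : ∀ x → proj₁ (edgeEnds x) ≢ proj₂ (edgeEnds x)
    edgeEnds-≢ (inj₁ e) eq = loopless e (proj₁ (corner-injective eq))
    edgeEnds-≢ (inj₂ t) eq = rot≢ _ (proj₂ (corner-injective eq))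

  inflated : Graph
  inflated = record
    { order    = order * 3
    ; size     = size + order * 3
    ; ends     = λ x → edgeEnds (splitAt size x)
    ; loopless = λ x → edgeEnds-≢ (splitAt size x)
    }

  module I = Graph inflated
  module BI = Basics inflated
  module CI = Cubics inflated

  private
    mate-ends : ∀ e → I.ends (mate e) ≡ matesEnds e
    mate-ends e = cong edgeEnds (splitAt-↑ˡ size e (order * 3))

    side-ends : ∀ v i → I.ends (side v i) ≡ sideEnds (v , i)
    side-ends v i = trans (cong edgeEnds (splitAt-↑ʳ size _ (combine v i))) (cong sideEnds (remQuot-combine v i))

  side-joins : ∀ v i → I.Joins (side v i) (corner v (rot i)) (corner v (rot (rot i)))
  side-joins v i = inj₁ (side-ends v i)

  mate-joins : ∀ e → I.Joins (mate e) (corner (proj₁ (ends e)) (port {e = e} (inj₁ refl))) (corner (proj₂ (ends e)) (port {e = e} (inj₂ refl)))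
  mate-joins e = inj₁ (mate-ends e)

  mate-incident⁻ : ∀ {v i e} → I.Incident (corner v i) (mate e) → slot v i ≡ e
  mate-incident⁻ {e = e} inc with BI.joins-inc⁻ (mate-joins e) inc
  ... | inj₁ eq = at (corner-injective eq)
    where
    at : ∀ {v i} → v ≡ proj₁ (ends e) × i ≡ port {e = e} (inj₁ refl) → slot v i ≡ e
    at (refl , refl) = slot-port _
  ... | inj₂ eq = at (corner-injective eq)
    where
    at : ∀ {v i} → v ≡ proj₂ (ends e) × i ≡ port {e = e} (inj₂ refl) → slot v i ≡ e
    at (refl , refl) = slot-port _

  mate-incident⁺ : ∀ v i → I.Incident (corner v i) (mate (slot v i))
  mate-incident⁺ v i = at refl (slot-inc v i)
    where
    at : ∀ {v i e} → slot v i ≡ e → Incident v e → I.Incident (corner v i) (mate e)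
    at {v} {i} {e} eq (inj₁ refl) = subst (λ k → I.Incident (corner v k) (mate e))
      (slot-inj v (trans (slot-port (inj₁ refl)) (sym eq))) (BI.joins-incˡ (mate-joins e))
    at {v} {i} {e} eq (inj₂ refl) = subst (λ k → I.Incident (corner v k) (mate e))
      (slot-inj v (trans (slot-port (inj₂ refl)) (sym eq))) (BI.joins-incʳ (mate-joins e))

  side-incident⁻ : ∀ {v i w k} → I.Incident (corner v i) (side w k) → v ≡ w × (i ≡ rot k ⊎ i ≡ rot (rot k))
  side-incident⁻ {w = w} {k} inc with BI.joins-inc⁻ (side-joins w k) inc
  ... | inj₁ eq = let (p , q) = corner-injective eq in p , inj₁ q
  ... | inj₂ eq = let (p , q) = corner-injective eq in p , inj₂ q

  side-between : ∀ v {i j} → i ≢ j → ∃[ k ] I.Joins (side v k) (corner v i) (corner v j)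
  side-between v ne with opposite ne
  ... | k , inj₁ (refl , refl) = k , side-joins v k
  ... | k , inj₂ (refl , refl) = k , BI.joins-sym (side-joins v k)

  slotsI : ∀ v i → CI.Slots (corner v i)
  slotsI v i = record { slot = sl ; slot-inc = inc ; slot-inj = inj ; slot-cover = cover }
    where
    sl : Fin 3 → I.Edge
    sl zero             = mate (slot v i)
    sl (suc zero)       = side v (rot i)
    sl (suc (suc zero)) = side v (rot (rot i))
    inc : ∀ k → I.Incident (corner v i) (sl k)
    inc zero = mate-incident⁺ v i
    inc (suc zero) = subst (λ k → I.Incident (corner v k) (side v (rot i))) (rot³ i) (BI.joins-incʳ (side-joins v (rot i)))
    inc (suc (suc zero)) = subst (λ k → I.Incident (corner v k) (side v (rot (rot i)))) (rot³ i) (BI.joins-incˡ (side-joins v (rot (rot i))))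
    inj : ∀ {j k} → sl j ≡ sl k → j ≡ k
    inj {zero} {zero} _ = refl
    inj {zero} {suc zero} eq = contradiction eq mate≢side
    inj {zero} {suc (suc zero)} eq = contradiction eq mate≢side
    inj {suc zero} {zero} eq = contradiction (sym eq) mate≢side
    inj {suc zero} {suc zero} _ = refl
    inj {suc zero} {suc (suc zero)} eq = contradiction (proj₂ (side-injective eq)) (rot≢ i)
    inj {suc (suc zero)} {zero} eq = contradiction (sym eq) mate≢side
    inj {suc (suc zero)} {suc zero} eq = contradiction (sym (proj₂ (side-injective eq))) (rot≢ i)
    inj {suc (suc zero)} {suc (suc zero)} _ = refl
    cover : ∀ {e} → I.Incident (corner v i) e → ∃[ k ] sl k ≡ e
    cover {e} h with edgeView e
    ... | isMate f = zero , cong mate (mate-incident⁻ h)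
    ... | isSide w k with side-incident⁻ h
    ... | refl , inj₁ refl = suc (suc zero) , cong (side v) (rot³ k)
    ... | refl , inj₂ refl = suc zero , cong (side v) (rot³ k)

  inflated-cubic : Cubic inflated
  inflated-cubic x with cornerView x
  ... | isCorner v i = CI.slots⇒deg≡3 (slotsI v i)

  private
    IsMate : I.Edge → Set
    IsMate x = ∃[ e ] x ≡ mate e

    mate? : ∀ x → Dec (IsMate x)
    mate? x = any? (λ e → x ≟ mate e)

  mates : PerfectMatching inflated
  mates = record
    { matching = ⟦ mate? ⟧
    ; disjoint = disj
    ; covering = λ x → mate (uncurry slot (remQuot 3 x)) , ∈⟦⟧⁺ mate? (_ , refl) ,
        subst (λ y → I.Incident y (mate (uncurry slot (remQuot 3 x)))) (combine-remQuot {order} 3 x) (mate-incident⁺ _ _)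
    }
    where
    disj : ∀ {e f x} → e ∈ ⟦ mate? ⟧ → f ∈ ⟦ mate? ⟧ → I.Incident x e → I.Incident x f → e ≡ f
    disj {x = x} h k i j with ∈⟦⟧⁻ mate? h | ∈⟦⟧⁻ mate? k | cornerView x
    ... | _ , refl | _ , refl | isCorner v p = cong mate (trans (sym (mate-incident⁻ i)) (mate-incident⁻ j))

  mate-∈ : ∀ e → mate e ∈ PerfectMatching.matching mates
  mate-∈ e = ∈⟦⟧⁺ mate? (e , refl)

  module LineGraph (M : PerfectMatching inflated) (mate∈M : ∀ e → mate e ∈ PerfectMatching.matching M) where
    module MC = MatchingContraction inflated M
    module Q = Quotient inflated MC.π
    module BQ = Basics Q.graph

    class : Edge → Graph.Vertex Q.graph
    class e = MC.π (corner (proj₁ (ends e)) (port {e = e} (inj₁ refl)))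

    label-class : ∀ e → MC.label (class e) ≡ mate e
    label-class e = trans (MC.label-π (corner (proj₁ (ends e)) (port {e = e} (inj₁ refl)))) (MC.partnerEdge-unique (mate∈M e) (BI.joins-incˡ (mate-joins e)))

    class-injective : ∀ {e f} → class e ≡ class f → e ≡ f
    class-injective {e} {f} eq = mate-injective (trans (sym (label-class e)) (trans (cong MC.label eq) (label-class f)))

    class-corner : ∀ v i → MC.π (corner v i) ≡ class (slot v i)
    class-corner v i = MC.label-injective {MC.π (corner v i)} {class (slot v i)} (trans (trans (MC.label-π (corner v i))
      (MC.partnerEdge-unique (mate∈M (slot v i)) (mate-incident⁺ v i))) (sym (label-class (slot v i))))

    class-surjective : ∀ x → ∃[ e ] class e ≡ x
    class-surjective x with MC.π-surjective x
    ... | y , refl with cornerView y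
    ... | isCorner v i = slot v i , sym (class-corner v i)

    -- Contracting the original edges turns the inflation into the line graph of G.
    class-adjacent : ∀ {v e f} → e ≢ f → Incident v e → Incident v f →
                     ∃[ j ] Graph.Joins Q.graph j (class e) (class f)
    class-adjacent {v} {e} {f} e≢f i j = t , subst₂ (Graph.Joins Q.graph t) eqᵉ eqᶠ m
      where
      p = port {v} {e} i
      q = port {v} {f} j
      eqᵉ : MC.π (corner v p) ≡ class e
      eqᵉ = trans (class-corner v p) (cong class (slot-port i))
      eqᶠ : MC.π (corner v q) ≡ class f
      eqᶠ = trans (class-corner v q) (cong class (slot-port j))
      between : ∃[ k ] I.Joins (side v k) (corner v p) (corner v q)
      between = side-between v (λ p≡q → e≢f (trans (sym (slot-port i)) (trans (cong (slot v) p≡q) (slot-port j))))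
      lifted : ∃[ t ] Q.original t ≡ side v (proj₁ between) × Graph.Joins Q.graph t (MC.π (corner v p)) (MC.π (corner v q))
      lifted = Q.lift-edge {side v (proj₁ between)} {corner v p} {corner v q} (proj₂ between)
        (λ eq → e≢f (class-injective (trans (sym eqᵉ) (trans eq eqᶠ))))
      t = proj₁ lifted
      m = proj₂ (proj₂ lifted)

-- The graph K is the line graph of G up to multiplicities of edges, with `class` numbering the edges of G.
module LineConnectivity (G : Graph) (S : ∀ v → Cubics.Slots G v) (K : Graph)
  (class : Graph.Edge G → Graph.Vertex K)
  (class-injective : ∀ {e f} → class e ≡ class f → e ≡ f)
  (class-surjective : ∀ x → ∃[ e ] class e ≡ x)
  (class-adjacent : ∀ {v e f} → e ≢ f → Graph.Incident G v e → Graph.Incident G v f →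
                    ∃[ j ] Graph.Joins K j (class e) (class f))
  (size≥5 : 5 ≤ Graph.size G)
  (no-cut : ∀ A → Basics.CycleIn G A → Basics.CycleIn G (∁ A) → 4 ≤ ∣ Cubics.δ G A ∣) where

  open Graph G
  open Basics G
  open Cubics G
  module BQ = Basics K

  module _ (X : Subset (Graph.order K)) (X≤3 : ∣ X ∣ ≤ 3) where
    private
      H = deleteVertices K X
      module H = Subgraph H

      module R = Reachability (BQ.adj? H.edges)

      outside-closed : R.Closed (∁ X)
      outside-closed _ (j , j∈H , l) = H.closed j∈H (BQ.joins-incʳ l)

      adjacent : ∀ {v e f} → e ≢ f → Incident v e → Incident v f → class e ∈ ∁ X → class f ∈ ∁ X →
                 BQ.Adj H.edges (class e) (class f)
      adjacent {v} {e} {f} e≢f i k p q = j , ∈⟦⟧⁺ _ (inside-X (inj₁ refl) , inside-X (inj₂ refl)) , l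
        where
        found = class-adjacent {v} {e} {f} e≢f i k
        j = proj₁ found
        l = proj₂ found
        inside-X : ∀ {x} → Graph.Incident K x j → x ∈ ∁ X
        inside-X {x} i = [ (λ { eq → subst (_∈ ∁ X) (sym eq) p }) , (λ eq → subst (_∈ ∁ X) (sym eq) q) ]
          (BQ.joins-inc⁻ {j} {class e} {class f} l i)

    -- Let `T` be the part reached from `e₀`, and `A` the set of ends of edges of `G` in `T`. An
    -- edge of `G` that leaves `A` must be deleted, so `∣ δ A ∣ ≤ 3`. `A` contains both ends of
    -- `e₀`, and its complement both ends of `f₀`; a side without a cycle would need at least 2 + 2
    -- boundary edges. Both sides therefore contain cycles, against `no-cut`.
    connected : ∀ e₀ f₀ → class e₀ ∈ ∁ X → class f₀ ∈ ∁ X → Star (BQ.Adj H.edges) (class e₀) (class f₀)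
    connected e₀ f₀ e₀∉X f₀∉X with R.reachable (class e₀)
    ... | T , e₀∈T , T-closed , reach with class f₀ ∈? T
    ... | yes f₀∈T = reach f₀∈T
    ... | no f₀∉T = contradiction (≤-trans (no-cut A (cycleIn A≥2 ≤-refl) (cycleIn ∁A≥2 (p⊆q⇒∣p∣≤∣q∣ {p = δ (∁ A)} {q = δ A} δ-∁))) δA≤3) 1+n≰n
      where
      touched? : ∀ v → Dec (∃[ e ] Incident v e × class e ∈ T)
      touched? v = any? (λ e → incident? v e ×-dec (class e ∈? T))
      A = ⟦ touched? ⟧
      T⊆ : ∀ {e} → class e ∈ T → class e ∈ ∁ X
      T⊆ h = R.closed-star outside-closed e₀∉X (reach h)
      hop : ∀ {v e f} → Incident v e → class e ∈ T → Incident v f → class f ∈ ∁ X → class f ∈ T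
      hop {v} {e} {f} i e∈T k f∉X with e ≟ f
      ... | yes refl = e∈T
      ... | no e≢f = T-closed e∈T (adjacent e≢f i k (T⊆ e∈T) f∉X)
      δA⊆X : ∀ {f} → f ∈ δ A → class f ∈ X
      δA⊆X {f} h with δ⁻ h
      ... | u , v , j , u∈A , v∉A with class f ∈? X
      ... | yes f∈X = f∈X
      ... | no f∉X = let (e , i , e∈T) = ∈⟦⟧⁻ touched? u∈A in contradiction
        (∈⟦⟧⁺ touched? (f , joins-incʳ j , hop i e∈T (joins-incˡ j) (x∉p⇒x∈∁p f∉X))) v∉A
      δA≤3 : ∣ δ A ∣ ≤ 3
      δA≤3 = ≤-trans (card-≤-inj (δ A) X (λ e x → class e ≡ x) (λ {e} h → class e , δA⊆X h , refl)
        (λ p q → class-injective (trans p (sym q)))) X≤3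
      pair : ∀ (B : Subset order) e → (∀ {v} → Incident v e → v ∈ B) → 2 ≤ ∣ B ∣
      pair B e all = length-≤-card B (_ ∷ _ ∷ []) ((joins-≢ (joins-ends e) ∷ []) ∷ [] ∷ [])
        (all (inj₁ refl) ∷ all (inj₂ refl) ∷ [])
      A≥2 : 2 ≤ ∣ A ∣
      A≥2 = pair A e₀ (λ i → ∈⟦⟧⁺ touched? (e₀ , i , e₀∈T))
      ∁A≥2 : 2 ≤ ∣ ∁ A ∣
      ∁A≥2 = pair (∁ A) f₀ (λ k → x∉p⇒x∈∁p (λ v∈A → let (e , i , e∈T) = ∈⟦⟧⁻ touched? v∈A in
        f₀∉T (hop i e∈T k f₀∉X)))
      cycleIn : ∀ {B} → 2 ≤ ∣ B ∣ → ∣ δ B ∣ ≤ ∣ δ A ∣ → CycleIn B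
      cycleIn {B} two le with nonempty? B
      ... | no empty = contradiction (≤-trans two (≤-reflexive (trans (cong ∣_∣ (Empty-unique empty)) (∣⊥∣≡0 order)))) λ ()
      ... | yes ne with cycle⊎boundary S ne
      ... | inj₁ c = c
      ... | inj₂ bound = contradiction (≤-trans (+-monoˡ-≤ 2 two) (≤-trans bound (≤-trans le δA≤3))) 1+n≰n

  order≥5 : 5 ≤ Graph.order K
  order≥5 = ≤-trans size≥5 (subst₂ _≤_ (∣⊤∣≡n size) (∣⊤∣≡n _)
    (card-≤-inj ⊤ ⊤ (λ e x → class e ≡ x) (λ {e} _ → class e , ∈⊤ , refl) (λ p q → class-injective (trans p (sym q)))))

  lineGraph-4-connected : VertexConnected K 4
  lineGraph-4-connected = order≥5 , λ X X<4 → nonempty X (≤-pred X<4) , λ {x} {y} x∉X y∉X → star X (≤-pred X<4) x y x∉X y∉X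
    where
    nonempty : ∀ X → ∣ X ∣ ≤ 3 → Nonempty (∁ X)
    nonempty X X≤3 with nonempty? (∁ X)
    ... | yes ne = ne
    ... | no empty = contradiction (≤-trans (≤-trans order≥5 (≤-trans (≤-reflexive (sym (∣⊤∣≡n _)))
      (p⊆q⇒∣p∣≤∣q∣ {p = ⊤} {q = X} (λ {x} _ → x∉∁p⇒x∈p (λ h → empty (x , h)))))) (≤-trans X≤3 (n≤1+n 3))) 1+n≰n
    star : ∀ X → ∣ X ∣ ≤ 3 → ∀ x y → x ∈ ∁ X → y ∈ ∁ X → Star (BQ.Adj (Subgraph.edges (deleteVertices K X))) x y
    star X X≤3 x y x∉X y∉X with class-surjective x | class-surjective y
    ... | e , refl | f , refl = connected X X≤3 e f x∉X y∉X

-- Projecting a cycle of the inflation to the original graph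

-- At a corner a cycle uses two of the three edges or none. Either way the original edge `x` is used
-- exactly when one of the two sides `y` and `z` is.
xor-lemma : ∀ x y z → (if x then 1 else 0) + ((if y then 1 else 0) + (if z then 1 else 0)) ≡ 2 ⊎ (x ≡ false × y ≡ false × z ≡ false) →
            x ≡ y xor z
xor-lemma true true false _ = refl
xor-lemma true false true _ = refl
xor-lemma false true true _ = refl
xor-lemma false false false _ = refl
xor-lemma true true true (inj₁ ())
xor-lemma true true true (inj₂ (() , _))
xor-lemma true false false (inj₁ ())
xor-lemma true false false (inj₂ (() , _))
xor-lemma false true false (inj₁ ())
xor-lemma false true false (inj₂ (_ , () , _))
xor-lemma false false true (inj₁ ())
xor-lemma false false true (inj₂ (_ , _ , ()))

-- For the usage bits `a`, `b`, `c` of the sides of a triangle, the three summands tell where a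
-- cycle leaves it; by parity it does so twice or never.
xor-total : ∀ a b c → (if b xor c then 1 else 0) + ((if c xor a then 1 else 0) + (if a xor b then 1 else 0)) ≡ 2 ⊎
            (b xor c ≡ false × c xor a ≡ false × a xor b ≡ false)
xor-total true  true  true  = inj₂ (refl , refl , refl)
xor-total true  true  false = inj₁ refl
xor-total true  false true  = inj₁ refl
xor-total true  false false = inj₁ refl
xor-total false true  true  = inj₁ refl
xor-total false true  false = inj₁ refl
xor-total false false true  = inj₁ refl
xor-total false false false = inj₂ (refl , refl , refl)

module Projection (G : Graph) (S : ∀ v → Cubics.Slots G v) (size≥5 : 5 ≤ Graph.size G)
  (C : Subgraph (Inflation.inflated G S)) (cyc : IsCycle C)
  (dom : ∀ e → ∃[ x ] x ∈ Subgraph.vertices C × Graph.Incident (Inflation.inflated G S) x (Inflation.mate G S e)) where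

  open Graph G
  open Basics G
  open Cubics G
  open Inflation G S
  open Slot
  open Subgraph C renaming (vertices to VC; edges to EC)

  private
    visited? : ∀ v → Dec (∃[ i ] corner v i ∈ VC)
    visited? v = any? (λ i → corner v i ∈? VC)

    used? : ∀ e → Dec (mate e ∈ EC)
    used? e = mate e ∈? EC

    V = ⟦ visited? ⟧
    E = ⟦ used? ⟧

    E-closed : ∀ {e v} → e ∈ E → Incident v e → v ∈ V
    E-closed {e} {v} h i = ∈⟦⟧⁺ visited? (port i , closed (∈⟦⟧⁻ used? h)
      (subst (λ f → I.Incident (corner v (port i)) (mate f)) (slot-port i) (mate-incident⁺ v (port i))))

    mate-bit : Vertex → Fin 3 → Bool
    mate-bit v i = does (mate (slot v i) ∈? EC)
    side-bit : Vertex → Fin 3 → Bool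
    side-bit v i = does (side v i ∈? EC)

    does-false : ∀ {P : Set} (d : Dec P) → ¬ P → does d ≡ false
    does-false (yes p) ¬p = contradiction p ¬p
    does-false (no _) _ = refl

    corner-bits : ∀ v i → (if mate-bit v i then 1 else 0) + ((if side-bit v (rot i) then 1 else 0) + (if side-bit v (rot (rot i)) then 1 else 0)) ≡ 2
                  ⊎ (mate-bit v i ≡ false × side-bit v (rot i) ≡ false × side-bit v (rot (rot i)) ≡ false)
    corner-bits v i with corner v i ∈? VC
    ... | yes h = inj₁ (trans (sym (CI.deg-slots (slotsI v i) EC)) (proj₂ cyc h))
    ... | no ¬h = inj₂ (off zero , off (suc zero) , off (suc (suc zero)))
      where
      off : ∀ k → does (CI.Slots.slot (slotsI v i) k ∈? EC) ≡ false
      off k = does-false (CI.Slots.slot (slotsI v i) k ∈? EC) (λ h → ¬h (closed h (CI.Slots.slot-inc (slotsI v i) k)))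

    mate-xor : ∀ v i → mate-bit v i ≡ side-bit v (rot i) xor side-bit v (rot (rot i))
    mate-xor v i = xor-lemma _ _ _ (corner-bits v i)

    E-bit : ∀ v i → bit (slot v i ∈? E) ≡ (if mate-bit v i then 1 else 0)
    E-bit v i = bit-cong (slot v i ∈? E) (mate (slot v i) ∈? EC) (∈⟦⟧⁻ used?) (∈⟦⟧⁺ used?)

    exits : ∀ v → deg E v ≡ 2 ⊎ (∀ i → mate-bit v i ≡ false)
    exits v with xor-total (side-bit v zero) (side-bit v (suc zero)) (side-bit v (suc (suc zero)))
    ... | inj₁ two = inj₁ (trans (deg-slots (S v) E) (trans
        (cong₂ _+_ (value zero) (cong₂ _+_ (value (suc zero)) (value (suc (suc zero))))) two))
      where
      value : ∀ i → bit (slot v i ∈? E) ≡ (if side-bit v (rot i) xor side-bit v (rot (rot i)) then 1 else 0)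
      value i = trans (E-bit v i) (cong (if_then 1 else 0) (mate-xor v i))
    ... | inj₂ (p , q , r) = inj₂ λ { zero → trans (mate-xor v _) p ; (suc zero) → trans (mate-xor v _) q ; (suc (suc zero)) → trans (mate-xor v _) r }

    -- A cycle without exits at v stays in the triangle of v and dominates at most three original edges.
    trapped : ∀ v → (∀ i → mate-bit v i ≡ false) → ¬ (∃[ i ] corner v i ∈ VC)
    trapped v none (i , h) = 1+n≰n (≤-trans (≤-trans (n≤1+n 4) size≥5) (≤-trans (≤-reflexive (sym (∣⊤∣≡n size)))
      (card-≤-length ⊤ (slot v zero ∷ slot v (suc zero) ∷ slot v (suc (suc zero)) ∷ []) (λ {e} _ → at-v e))))
      where
      stay : ∀ {x y} → x ∈ VC → Star (BI.Adj EC) x y → base x ≡ v → base y ≡ v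
      stay x∈ ε eq = eq
      stay {x} x∈ ((f , f∈ , j) ◅ rs) eq = stay (closed f∈ (BI.joins-incʳ j)) rs (move (cornerView x) (cornerView _) (edgeView f) f∈ j eq)
        where
        move : ∀ {x y f} → CornerView x → CornerView y → EdgeView f → f ∈ EC → I.Joins f x y → base x ≡ v → base y ≡ v
        move (isCorner u k) _ (isMate e) f∈ j eq = contradiction f∈ absent
          where
          absent : mate e ∉ EC
          absent h with trans (sym (base-corner u k)) eq
          ... | refl with mate-incident⁻ (BI.joins-incˡ j)
          ... | refl with trans (sym (none k)) (does-true (mate (slot u k) ∈? EC) h)
            where
            does-true : ∀ {P : Set} (d : Dec P) → P → does d ≡ true
            does-true (yes _) _ = refl
            does-true (no ¬p) p = contradiction p ¬p
          ... | ()
        move (isCorner u k) (isCorner u′ k′) (isSide w l) f∈ j eq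
          with side-incident⁻ {u} {k} (BI.joins-incˡ j) | side-incident⁻ {u′} {k′} (BI.joins-incʳ j)
        ... | p , _ | q , _ = trans (base-corner u′ k′) (trans q (trans (sym p) (trans (sym (base-corner u k)) eq)))
      at-v : ∀ e → e Mem.∈ slot v zero ∷ slot v (suc zero) ∷ slot v (suc (suc zero)) ∷ []
      at-v e with dom e
      ... | x , x∈ , inc with cornerView x
      ... | isCorner u k with trans (sym (base-corner u k)) (stay h (proj₂ (proj₁ cyc) h x∈) (base-corner v i))
      ... | refl with k | mate-incident⁻ {u} {k} inc
      ... | zero | refl = here refl
      ... | suc zero | refl = there (here refl)
      ... | suc (suc zero) | refl = there (there (here refl))

    -- A side collapses to its vertex and so vanishes from the walk; an original edge stays.
    project : ∀ {x y} → Star (BI.Adj EC) x y → Star (Adj E) (base x) (base y)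
    project ε = ε
    project {x} (_◅_ {j = y} (f , f∈ , j) rs) = move (cornerView x) (cornerView y) (edgeView f) f∈ j ◅◅ project rs
      where
      move : ∀ {x y f} → CornerView x → CornerView y → EdgeView f → f ∈ EC → I.Joins f x y → Star (Adj E) (base x) (base y)
      move (isCorner u k) (isCorner u′ k′) (isMate e) f∈ j = subst₂ (Star (Adj E)) (sym (base-corner u k)) (sym (base-corner u′ k′))
        ((e , ∈⟦⟧⁺ used? f∈ , joined (BI.joins-inc⁻ j′ (mate-end₁)) (BI.joins-inc⁻ j′ mate-end₂)) ◅ ε)
        where
        j′ : I.Joins (mate e) (corner u k) (corner u′ k′)
        j′ = j
        mate-end₁ = BI.joins-incˡ (mate-joins e)
        mate-end₂ = BI.joins-incʳ (mate-joins e)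
        joined : ∀ {p q} → corner (proj₁ (ends e)) p ≡ corner u k ⊎ corner (proj₁ (ends e)) p ≡ corner u′ k′ →
                 corner (proj₂ (ends e)) q ≡ corner u k ⊎ corner (proj₂ (ends e)) q ≡ corner u′ k′ → Joins e u u′
        joined (inj₁ p) (inj₂ q) = inj₁ (cong₂ _,_ (proj₁ (corner-injective p)) (proj₁ (corner-injective q)))
        joined (inj₂ p) (inj₁ q) = inj₂ (cong₂ _,_ (proj₁ (corner-injective p)) (proj₁ (corner-injective q)))
        joined (inj₁ p) (inj₁ q) = contradiction (trans (proj₁ (corner-injective p)) (sym (proj₁ (corner-injective q)))) (loopless e)
        joined (inj₂ p) (inj₂ q) = contradiction (trans (proj₁ (corner-injective p)) (sym (proj₁ (corner-injective q)))) (loopless e)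
      move (isCorner u k) (isCorner u′ k′) (isSide w l) f∈ j
        with side-incident⁻ {u} {k} (BI.joins-incˡ j) | side-incident⁻ {u′} {k′} (BI.joins-incʳ j)
      ... | p , _ | q , _ = subst (Star (Adj E) (base (corner u k))) (trans (base-corner u k) (trans p (trans (sym q) (sym (base-corner u′ k′))))) ε

  projected : ∃[ D ] IsDominatingCycle {G} D
  projected = record { vertices = V ; edges = E ; closed = E-closed } , ((nonempty , conn) , two) , dominates
    where
    nonempty : Nonempty V
    nonempty with proj₁ (proj₁ cyc)
    ... | x , x∈ with cornerView x
    ... | isCorner v i = v , ∈⟦⟧⁺ visited? (i , x∈)
    conn : ∀ {u v} → u ∈ V → v ∈ V → Star (Adj E) u v
    conn {u} {v} u∈ v∈ with ∈⟦⟧⁻ visited? u∈ | ∈⟦⟧⁻ visited? v∈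
    ... | i , p | k , q = subst₂ (Star (Adj E)) (base-corner u i) (base-corner v k) (project (proj₂ (proj₁ cyc) p q))
    two : ∀ {v} → v ∈ V → deg E v ≡ 2
    two {v} h = [ id , (λ none → contradiction (∈⟦⟧⁻ visited? h) (trapped v none)) ] (exits v)
    dominates : ∀ {e} → e ∈ ⊤ → ∃[ v ] v ∈ V × Incident v e
    dominates {e} _ with dom e
    ... | x , x∈ , inc with cornerView x
    ... | isCorner v i = v , ∈⟦⟧⁺ visited? (i , x∈) , subst (Incident v) (mate-incident⁻ inc) (slot-inc v i)

StatementA StatementDCC : Set
StatementA = (G : Graph) → Cubic G → (M : PerfectMatching G) → VertexConnected (G /ᴹ M) 4 →
  ∃[ C ] IsCycle {G} C × Dominates C (PerfectMatching.matching M)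
StatementDCC = (G : Graph) → Cubic G → CyclicallyEdgeConnected G 4 → ∃[ C ] IsDominatingCycle {G} C

inflate-and-project : StatementA → (G : Graph) (S : ∀ v → Cubics.Slots G v) (M : PerfectMatching (Inflation.inflated G S)) →
  (∀ e → Inflation.mate G S e ∈ PerfectMatching.matching M) → CyclicallyEdgeConnected G 4 → ∃[ C ] IsDominatingCycle {G} C
inflate-and-project a G S M mate∈M (_ , l , ((C , D , cycC , cycD , disj) , _ , bound) , 4≤l) = projected
  where
  open Graph G
  open Basics G
  open Cubics G
  open Inflation G S using (inflated; inflated-cubic)

  size≥5 : 5 ≤ size
  size≥5 = Domination.twoDisjoint⇒size≥5 G S (C , D , cycC , cycD , disj)

  no-cut : ∀ A → CycleIn A → CycleIn (∁ A) → 4 ≤ ∣ δ A ∣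
  no-cut A p q = ≤-trans 4≤l (bound (δ A) (EdgeCuts.δ-cyclicEdgeCut G A p q))

  connected : VertexConnected (inflated /ᴹ M) 4
  connected = LineConnectivity.lineGraph-4-connected G S Q.graph
      class class-injective class-surjective class-adjacent size≥5 no-cut
    where open Inflation.LineGraph G S M mate∈M

  inflated-cycle : ∃[ C ] IsCycle {inflated} C × Dominates C (PerfectMatching.matching M)
  inflated-cycle = a inflated inflated-cubic M connected

  open Projection G S size≥5 (proj₁ inflated-cycle) (proj₁ (proj₂ inflated-cycle))
    (λ e → proj₂ (proj₂ inflated-cycle) (mate∈M e))

A⇒DCC : StatementA → StatementDCC
A⇒DCC a G cubic = inflate-and-project a G S (Inflation.mates G S) (Inflation.mate-∈ G S)
  where
  S : ∀ v → Cubics.Slots G v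
  S v = Cubics.deg≡3⇒slots G (cubic v)

-- Edge cuts against 4-connectedness of G/M

module Separation (K : Graph) (connected : VertexConnected K 4) where
  open Graph K
  open Basics K

  private
    between? : ∀ P T e → Dec ((proj₁ (ends e) ∈ P × proj₂ (ends e) ∈ T) ⊎ (proj₂ (ends e) ∈ P × proj₁ (ends e) ∈ T))
    between? P T e = ((proj₁ (ends e) ∈? P) ×-dec (proj₂ (ends e) ∈? T))
               ⊎-dec ((proj₂ (ends e) ∈? P) ×-dec (proj₁ (ends e) ∈? T))

    neither? : ∀ (P T : Subset order) v → Dec (v ∉ P × v ∉ T)
    neither? P T v = ¬? (v ∈? P) ×-dec ¬? (v ∈? T)

  between : Subset order → Subset order → Subset size
  between P T = ⟦ between? P T ⟧

  neither : Subset order → Subset order → Subset order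
  neither P T = ⟦ neither? P T ⟧

  between⁺ : ∀ {P T e u v} → Joins e u v → u ∈ P → v ∈ T → e ∈ between P T
  between⁺ {P} {T} (inj₁ refl) u∈P v∈T = ∈⟦⟧⁺ (between? P T) (inj₁ (u∈P , v∈T))
  between⁺ {P} {T} (inj₂ refl) u∈P v∈T = ∈⟦⟧⁺ (between? P T) (inj₂ (u∈P , v∈T))

  between⁻ : ∀ P T {e} → e ∈ between P T → ∃[ u ] ∃[ v ] Joins e u v × u ∈ P × v ∈ T
  between⁻ P T h with ∈⟦⟧⁻ (between? P T) h
  ... | inj₁ (p , q) = _ , _ , inj₁ refl , p , q
  ... | inj₂ (p , q) = _ , _ , inj₂ refl , p , q

  neither⁻ : ∀ P T {v} → v ∈ neither P T → v ∉ P × v ∉ T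
  neither⁻ P T = ∈⟦⟧⁻ (neither? P T)

  private
    between-swap : ∀ P T → ∣ between T P ∣ ≤ ∣ between P T ∣
    between-swap P T = p⊆q⇒∣p∣≤∣q∣ {p = between T P} {q = between P T}
      (λ h → let (_ , _ , j , p , q) = between⁻ T P h in between⁺ (joins-sym j) q p)

    neither-swap : ∀ P T → ∣ neither T P ∣ ≤ ∣ neither P T ∣
    neither-swap P T = p⊆q⇒∣p∣≤∣q∣ {p = neither T P} {q = neither P T}
      (λ h → ∈⟦⟧⁺ (neither? P T) (swap× (neither⁻ T P h)))
      where
      swap× : ∀ {A B : Set} → A × B → B × A
      swap× (a , b) = b , a

    between-shrink : ∀ {P T e x y} → Joins e x y → x ∈ P → y ∈ T → (∀ {v} → v ∈ P → v ∉ T) →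
                     suc ∣ between (P - x) T ∣ ≤ ∣ between P T ∣
    between-shrink {P} {T} {e} {x} {y} j x∈P y∈T disj = ≤-trans
      (s≤s (p⊆q⇒∣p∣≤∣q∣ {p = between (P - x) T} {q = between P T - e} sub))
      (≤-reflexive (sym (∣minus∣ (between P T) (between⁺ j x∈P y∈T))))
      where
      sub : between (P - x) T ⊆ between P T - e
      sub {f} h with between⁻ (P - x) T h
      ... | u , v , k , u∈ , v∈T with ∈-minus⁻ P u∈
      ... | u∈P , u≢x = x∈p∧x≢y⇒x∈p-y (between⁺ k u∈P v∈T) λ { refl →
        [ (λ eq → u≢x eq) , (λ { refl → disj u∈P y∈T }) ] (joins-inc⁻ j (joins-incˡ k)) }

    neither-grow : ∀ P T x → ∣ neither (P - x) T ∣ ≤ suc ∣ neither P T ∣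
    neither-grow P T x with x ∈? neither P T
    ... | no x∉ = ≤-trans (p⊆q⇒∣p∣≤∣q∣ {p = neither (P - x) T} {q = neither P T ∪ ⁅ x ⁆} sub) (≤-reflexive (∣∪⁅⁆∣ (neither P T) x∉))
      where
      sub : neither (P - x) T ⊆ neither P T ∪ ⁅ x ⁆
      sub {v} h with neither⁻ (P - x) T h | v ≟ x
      ... | _ , _ | yes refl = ∈-∪ʳ (neither P T)
      ... | v∉P-x , v∉T | no v≢x = ∈-∪ˡ (∈⟦⟧⁺ (neither? P T) ((λ v∈P → v∉P-x (x∈p∧x≢y⇒x∈p-y v∈P v≢x)) , v∉T))
    ... | yes x∈ = m≤n⇒m≤1+n (p⊆q⇒∣p∣≤∣q∣ {p = neither (P - x) T} {q = neither P T} (λ {v} h →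
        let (v∉P-x , v∉T) = neither⁻ (P - x) T h in
        ∈⟦⟧⁺ (neither? P T) ((λ v∈P → v∉P-x (x∈p∧x≢y⇒x∈p-y v∈P (λ { refl → proj₁ (neither⁻ P T x∈) v∈P }))) , v∉T)))

    -- Removing `x` from `P` adds at most `x` to the vertices of the mixed cut and takes at least
    -- `e` out of its edges.
    budget : ∀ {P T e x y} → Joins e x y → x ∈ P → y ∈ T → (∀ {v} → v ∈ P → v ∉ T) →
             ∣ neither (P - x) T ∣ + ∣ between (P - x) T ∣ ≤ ∣ neither P T ∣ + ∣ between P T ∣
    budget {P} {T} {x = x} j x∈P y∈T disj = ≤-trans (+-monoˡ-≤ _ (neither-grow P T x))
      (≤-trans (≤-reflexive (sym (+-suc ∣ neither P T ∣ _))) (+-monoʳ-≤ ∣ neither P T ∣ (between-shrink j x∈P y∈T disj)))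

  -- Trading an edge between P and T for one of its ends turns the mixed cut into a vertex cut.
  no-separation : ∀ P T → (∀ {v} → v ∈ P → v ∉ T) → Nonempty P → Nonempty T →
                  ¬ (∣ neither P T ∣ + ∣ between P T ∣ ≤ 3)
  no-separation P T = go ∣ between P T ∣ P T ≤-refl
    where
    go : ∀ k P T → ∣ between P T ∣ ≤ k → (∀ {v} → v ∈ P → v ∉ T) → Nonempty P → Nonempty T →
         ¬ (∣ neither P T ∣ + ∣ between P T ∣ ≤ 3)
    go k P T le disj (p , p∈P) (t , t∈T) cut with nonempty? (between P T)
    -- With no edge left between `P` and `T`, the at most three vertices of `X` would separate them.
    ... | no none = disj (Reachability.closed-star (adj? (Subgraph.edges H)) next p∈P
            (proj₂ (proj₂ connected X (s≤s (≤-trans (ℕ.m≤m+n _ _) cut))) (outside-X (inj₁ p∈P)) (outside-X (inj₂ t∈T)))) t∈T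
      where
      X : Subset order
      X = neither P T
      H : Subgraph K
      H = deleteVertices K X
      outside-X : ∀ {v} → v ∈ P ⊎ v ∈ T → v ∈ ∁ X
      outside-X (inj₁ v∈P) = x∉p⇒x∈∁p (λ h → proj₁ (neither⁻ P T h) v∈P)
      outside-X (inj₂ v∈T) = x∉p⇒x∈∁p (λ h → proj₂ (neither⁻ P T h) v∈T)
      next : ∀ {x y} → x ∈ P → Adj (Subgraph.edges H) x y → y ∈ P
      next {x} {y} x∈P (e , e∈H , j) with y ∈? P | y ∈? T
      ... | yes y∈P | _ = y∈P
      ... | no _ | yes y∈T = contradiction (e , between⁺ j x∈P y∈T) none
      ... | no y∉P | no y∉T = contradiction (∈⟦⟧⁺ (neither? P T) (y∉P , y∉T)) (x∈∁p⇒x∉p (Subgraph.closed H e∈H (joins-incʳ j)))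
    go zero P T le disj _ _ cut | yes (e , e∈) = contradiction (≤-trans (≤-reflexive (sym (∣minus∣ _ e∈))) le) λ ()
    go (suc k) P T le disj p t cut | yes (e , e∈) with between⁻ P T e∈
    ... | x , y , j , x∈P , y∈T with nonempty? (P - x) | nonempty? (T - y)
    ... | yes p′ | _ = go k (P - x) T (≤-pred (≤-trans (between-shrink j x∈P y∈T disj) le))
            (disj ∘ proj₁ ∘ ∈-minus⁻ P) p′ t (≤-trans (budget j x∈P y∈T disj) cut)
    -- `P` must not become empty, so the other end of the edge is given up; the roles of `P` and `T`
    -- are exchanged to reuse the same bounds.
    ... | no _ | yes t′ = go k (T - y) P
            (≤-pred (≤-trans (between-shrink (joins-sym j) y∈T x∈P disj′) (≤-trans (between-swap P T) le)))
            (disj′ ∘ proj₁ ∘ ∈-minus⁻ T) t′ p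
            (≤-trans (budget (joins-sym j) y∈T x∈P disj′) (≤-trans (+-mono-≤ (neither-swap P T) (between-swap P T)) cut))
      where
      disj′ : ∀ {v} → v ∈ T → v ∉ P
      disj′ v∈T v∈P = disj v∈P v∈T
    -- Now `P` is just `x` and `T` just `y`. The edge between them leaves room for at most two
    -- vertices in `X`, so the graph would have at most four.
    ... | no p-empty | no t-empty = contradiction
        (≤-trans (proj₁ connected) (≤-trans (≤-reflexive (sym (∣⊤∣≡n order)))
          (≤-trans (p⊆q⇒∣p∣≤∣q∣ {p = ⊤} {q = (X ∪ ⁅ x ⁆) ∪ ⁅ y ⁆} all)
            (≤-trans (≤-reflexive (trans (∣∪⁅⁆∣ (X ∪ ⁅ x ⁆) y∉) (cong suc (∣∪⁅⁆∣ X x∉)))) (s≤s X+1≤3))))) 1+n≰n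
      where
      X : Subset order
      X = neither P T
      x∉ : x ∉ X
      x∉ h = proj₁ (neither⁻ P T h) x∈P
      y∉ : y ∉ X ∪ ⁅ x ⁆
      y∉ h = [ (λ eq → joins-≢ j (sym eq)) , (λ h′ → proj₂ (neither⁻ P T h′) y∈T) ] (∈-∪⁅⁆⁻ X h)
      all : ⊤ ⊆ (X ∪ ⁅ x ⁆) ∪ ⁅ y ⁆
      all {v} _ with v ≟ x | v ≟ y
      ... | yes refl | _ = ∈-∪ˡ (∈-∪ʳ X)
      ... | no _ | yes refl = ∈-∪ʳ (X ∪ ⁅ x ⁆)
      ... | no v≢x | no v≢y = ∈-∪ˡ (∈-∪ˡ (∈⟦⟧⁺ (neither? P T)
              ((λ h → p-empty (v , x∈p∧x≢y⇒x∈p-y h v≢x)) , (λ h → t-empty (v , x∈p∧x≢y⇒x∈p-y h v≢y)))))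
      X+1≤3 : suc ∣ X ∣ ≤ 3
      X+1≤3 = ≤-trans (≤-reflexive (+-comm 1 _)) (≤-trans (+-monoʳ-≤ ∣ X ∣
        (≤-trans (s≤s z≤n) (≤-reflexive (sym (∣minus∣ (between P T) e∈))))) cut)

module MatchedVertex (G : Graph) (S : ∀ v → Cubics.Slots G v) (M : PerfectMatching G) where
  open Graph G
  open Basics G
  open Cubics G
  open PerfectMatching M
  open MatchingContraction G M

  record NonMatching (v : Vertex) : Set where
    field
      {n₁ n₂} : Edge
      n₁≢n₂   : n₁ ≢ n₂
      n₁∉M    : n₁ ∉ matching
      n₂∉M    : n₂ ∉ matching
      inc₁    : Incident v n₁
      inc₂    : Incident v n₂
      cover   : ∀ {e} → Incident v e → e ≡ partnerEdge v ⊎ e ≡ n₁ ⊎ e ≡ n₂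

  rot-cover : ∀ i j → j ≡ i ⊎ j ≡ rot i ⊎ j ≡ rot (rot i)
  rot-cover zero zero = inj₁ refl
  rot-cover zero (suc zero) = inj₂ (inj₁ refl)
  rot-cover zero (suc (suc zero)) = inj₂ (inj₂ refl)
  rot-cover (suc zero) zero = inj₂ (inj₂ refl)
  rot-cover (suc zero) (suc zero) = inj₁ refl
  rot-cover (suc zero) (suc (suc zero)) = inj₂ (inj₁ refl)
  rot-cover (suc (suc zero)) zero = inj₂ (inj₁ refl)
  rot-cover (suc (suc zero)) (suc zero) = inj₂ (inj₂ refl)
  rot-cover (suc (suc zero)) (suc (suc zero)) = inj₁ refl

  rot-≢ : ∀ i → i ≢ rot i × i ≢ rot (rot i)
  rot-≢ zero = (λ ()) , (λ ())
  rot-≢ (suc zero) = (λ ()) , (λ ())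
  rot-≢ (suc (suc zero)) = (λ ()) , (λ ())

  nonMatching : ∀ v → NonMatching v
  nonMatching v = build (slot-cover (partnerEdge-incident v))
    where
    open Slots (S v)
    build : ∃[ i ] slot i ≡ partnerEdge v → NonMatching v
    build (i , eq) = record
      { n₁≢n₂ = λ eq′ → rot≢ i (slot-inj eq′)
      ; n₁∉M = off (proj₁ (rot-≢ i)) ; n₂∉M = off (proj₂ (rot-≢ i))
      ; inc₁ = slot-inc (rot i) ; inc₂ = slot-inc (rot (rot i)) ; cover = cover }
      where
      off : ∀ {j} → i ≢ j → slot j ∉ matching
      off {j} i≢j h = i≢j (slot-inj (trans eq (partnerEdge-unique h (slot-inc j))))
      cover : ∀ {e} → Incident v e → e ≡ partnerEdge v ⊎ e ≡ slot (rot i) ⊎ e ≡ slot (rot (rot i))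
      cover inc with slot-cover inc
      ... | j , refl with rot-cover i j
      ... | inj₁ refl = inj₁ eq
      ... | inj₂ (inj₁ refl) = inj₂ (inj₁ refl)
      ... | inj₂ (inj₂ refl) = inj₂ (inj₂ refl)

  nonMatching-pair : ∀ {v e f g} → e ≢ f → e ∉ matching → f ∉ matching → g ∉ matching →
                     Incident v e → Incident v f → Incident v g → g ≡ e ⊎ g ≡ f
  nonMatching-pair {v} {e} {f} {g} e≢f e∉M f∉M g∉M i j k = pick (only i e∉M) (only j f∉M) (only k g∉M)
    where
    open NonMatching (nonMatching v)
    only : ∀ {e} → Incident v e → e ∉ matching → e ≡ n₁ ⊎ e ≡ n₂
    only i e∉M with cover i
    ... | inj₁ refl = contradiction (partnerEdge-∈ v) e∉M
    ... | inj₂ h = h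
    pick : e ≡ n₁ ⊎ e ≡ n₂ → f ≡ n₁ ⊎ f ≡ n₂ → g ≡ n₁ ⊎ g ≡ n₂ → g ≡ e ⊎ g ≡ f
    pick (inj₁ p) (inj₁ q) _ = contradiction (trans p (sym q)) e≢f
    pick (inj₂ p) (inj₂ q) _ = contradiction (trans p (sym q)) e≢f
    pick (inj₁ p) (inj₂ q) (inj₁ r) = inj₁ (trans r (sym p))
    pick (inj₁ p) (inj₂ q) (inj₂ r) = inj₂ (trans r (sym q))
    pick (inj₂ p) (inj₁ q) (inj₁ r) = inj₂ (trans r (sym q))
    pick (inj₂ p) (inj₁ q) (inj₂ r) = inj₁ (trans r (sym p))

module FourConnectedContraction (G : Graph) (S : ∀ v → Cubics.Slots G v) (M : PerfectMatching G)
  {k : ℕ} (π : Graph.Vertex G → Fin k) (label : Fin k → Graph.Edge G)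
  (label-∈ : ∀ x → label x ∈ PerfectMatching.matching M)
  (label-injective : ∀ {x y} → label x ≡ label y → x ≡ y)
  (label-π : ∀ v → label (π v) ≡ MatchingContraction.partnerEdge G M v)
  (connected : VertexConnected (Quotient.graph G π) 4) where
  open Graph G
  open Basics G
  open Cubics G
  open PerfectMatching M
  open MatchingContraction G M using (partnerEdge; partnerEdge-∈; partnerEdge-incident; partnerEdge-unique)
  open MatchedVertex G S M
  module Q = Quotient G π
  open Separation Q.graph connected

  private
    π-cong : ∀ {u v} → partnerEdge u ≡ partnerEdge v → π u ≡ π v
    π-cong {u} {v} eq = label-injective (trans (label-π u) (trans eq (sym (label-π v))))

    π-injective : ∀ {u v} → π u ≡ π v → partnerEdge u ≡ partnerEdge v
    π-injective {u} {v} eq = trans (sym (label-π u)) (trans (cong label eq) (label-π v))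

    in? : ∀ A x → Dec (proj₁ (ends (label x)) ∈ A × proj₂ (ends (label x)) ∈ A)
    in? A x = (proj₁ (ends (label x)) ∈? A) ×-dec (proj₂ (ends (label x)) ∈? A)

    out? : ∀ A x → Dec (proj₁ (ends (label x)) ∉ A × proj₂ (ends (label x)) ∉ A)
    out? A x = ¬? (proj₁ (ends (label x)) ∈? A) ×-dec ¬? (proj₂ (ends (label x)) ∈? A)

    label-at : ∀ {u x} → π u ≡ x → Incident u (label x)
    label-at {u} refl = subst (Incident u) (sym (label-π u)) (partnerEdge-incident u)

    both : ∀ {B : Vertex → Set} {e u} → B (proj₁ (ends e)) × B (proj₂ (ends e)) → Incident u e → B u
    both (p , q) (inj₁ refl) = p
    both (p , q) (inj₂ refl) = q

  -- Let `P` and `T` be the matching edges inside and outside `A`, seen as vertices of the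
  -- contraction. The remaining vertices are matching edges of `δ A`, and edges between `P` and `T`
  -- are other edges of `δ A`; together they form a mixed cut of size at most 3.
  small-cut : ∀ A → ∣ δ A ∣ ≤ 3 → ∀ {e f} → e ∈ matching → f ∈ matching →
              (∀ {v} → Incident v e → v ∈ A) → ¬ (∀ {v} → Incident v f → v ∉ A)
  small-cut A δ≤3 {e} {f} e∈M f∈M e⊆A f∩A = no-separation P T disj (π u , inP) (π w , inT)
      (≤-trans (+-mono-≤ mixed nonmatching) (≤-trans (≤-reflexive (card-split (δ A) matching)) δ≤3))
    where
    P T : Subset (Graph.order Q.graph)
    P = ⟦ in? A ⟧
    T = ⟦ out? A ⟧
    u = proj₁ (ends e)
    w = proj₁ (ends f)
    inP : π u ∈ P
    inP = ∈⟦⟧⁺ (in? A) (e⊆A (at (inj₁ refl)) , e⊆A (at (inj₂ refl)))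
      where
      at : ∀ {v} → Incident v (label (π u)) → Incident v e
      at {v} = subst (Incident v) (trans (label-π u) (partnerEdge-unique e∈M (inj₁ refl)))
    inT : π w ∈ T
    inT = ∈⟦⟧⁺ (out? A) (f∩A (at (inj₁ refl)) , f∩A (at (inj₂ refl)))
      where
      at : ∀ {v} → Incident v (label (π w)) → Incident v f
      at {v} = subst (Incident v) (trans (label-π w) (partnerEdge-unique f∈M (inj₁ refl)))
    disj : ∀ {x} → x ∈ P → x ∉ T
    disj p q = proj₁ (∈⟦⟧⁻ (out? A) q) (proj₁ (∈⟦⟧⁻ (in? A) p))
    mixed : ∣ neither P T ∣ ≤ ∣ δ A ∩ matching ∣
    mixed = card-≤-inj (neither P T) (δ A ∩ matching) (λ x e → label x ≡ e)
      (λ {x} h → label x , x∈p∩q⁺ (cross (neither⁻ P T h) , label-∈ x) , refl)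
      (λ p q → label-injective (trans p (sym q)))
      where
      cross : ∀ {x} → x ∉ P × x ∉ T → label x ∈ δ A
      cross {x} (x∉P , x∉T) with proj₁ (ends (label x)) ∈? A | proj₂ (ends (label x)) ∈? A
      ... | yes p | yes q = contradiction (∈⟦⟧⁺ (in? A) (p , q)) x∉P
      ... | no p | no q = contradiction (∈⟦⟧⁺ (out? A) (p , q)) x∉T
      ... | yes p | no q = δ⁺ (joins-ends (label x)) p q
      ... | no p | yes q = δ⁺ (joins-sym (joins-ends (label x))) q p
    nonmatching : ∣ between P T ∣ ≤ ∣ δ A ∩ ∁ matching ∣
    nonmatching = card-≤-inj (between P T) (δ A ∩ ∁ matching) (λ j e → Q.original j ≡ e)
      (λ {j} h → Q.original j , x∈p∩q⁺ (cross h) , refl)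
      (λ p q → Q.original-injective (trans p (sym q)))
      where
      cross : ∀ {j} → j ∈ between P T → Q.original j ∈ δ A × Q.original j ∈ ∁ matching
      cross {j} h with between⁻ P T h
      ... | x , y , k , x∈P , y∈T with Q.joins⁻ k
      ... | a , b , l , a↦x , b↦y = δ⁺ l (both {_∈ A} (∈⟦⟧⁻ (in? A) x∈P) (label-at a↦x)) (both {_∉ A} (∈⟦⟧⁻ (out? A) y∈T) (label-at b↦y)) ,
        x∉p⇒x∈∁p (λ m → disj x∈P (subst (_∈ T) (trans (sym b↦y) (trans (π-cong
          (trans (partnerEdge-unique m (joins-incʳ l)) (sym (partnerEdge-unique m (joins-incˡ l))))) a↦x)) y∈T))

  -- The two parallel edges are all that `a` has outside the matching. So the vertex `π a` of the
  -- contraction has at most two edges to vertices other than `π b`, those at the partner of `a`.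
  -- These two edges and the vertex `π b` form a mixed cut of size at most 3.
  no-digon : ∀ {e f a b} → e ≢ f → e ∉ matching → f ∉ matching → Joins e a b → ¬ Joins f a b
  no-digon {e} {f} {a} {b} e≢f e∉M f∉M j k = no-separation P T disj (π a , x∈⁅x⁆ (π a)) T-nonempty
      (≤-trans (+-mono-≤ rest≤1 between≤2) ≤-refl)
    where
    pair? : ∀ x → Dec (x ≢ π a × x ≢ π b)
    pair? x = ¬? (x ≟ π a) ×-dec ¬? (x ≟ π b)
    P T : Subset (Graph.order Q.graph)
    P = ⁅ π a ⁆
    T = ⟦ pair? ⟧
    disj : ∀ {x} → x ∈ P → x ∉ T
    disj p q = proj₁ (∈⟦⟧⁻ pair? q) (x∈⁅y⁆⇒x≡y _ p)
    T-nonempty : Nonempty T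
    T-nonempty with nonempty? T
    ... | yes ne = ne
    ... | no empty = contradiction (≤-trans (proj₁ connected) (≤-trans (≤-reflexive (sym (∣⊤∣≡n _)))
      (≤-trans (card-≤-length ⊤ (π a ∷ π b ∷ []) (λ {x} _ → cover x)) (s≤s (s≤s z≤n))))) (1+n≰n {4})
      where
      cover : ∀ x → x Mem.∈ π a ∷ π b ∷ []
      cover x with x ≟ π a | x ≟ π b
      ... | yes eq | _ = here eq
      ... | no _ | yes eq = there (here eq)
      ... | no p | no q = contradiction (x , ∈⟦⟧⁺ pair? (p , q)) empty
    rest≤1 : ∣ neither P T ∣ ≤ 1
    rest≤1 = card-≤-length (neither P T) (π b ∷ []) (λ {x} h → cover x (neither⁻ P T h))
      where
      cover : ∀ x → x ∉ P × x ∉ T → x Mem.∈ π b ∷ []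
      cover x (x∉P , x∉T) with x ≟ π b
      ... | yes eq = here eq
      ... | no q = contradiction (∈⟦⟧⁺ pair? ((λ { refl → x∉P (x∈⁅x⁆ _) }) , q)) x∉T
    a′ = proj₁ (inc-joins (partnerEdge-incident a))
    partner : Joins (partnerEdge a) a a′
    partner = proj₂ (inc-joins (partnerEdge-incident a))
    open NonMatching (nonMatching a′)
    n? : ∀ e → Dec (e ≡ n₁ ⊎ e ≡ n₂)
    n? e = (e ≟ n₁) ⊎-dec (e ≟ n₂)
    between≤2 : ∣ between P T ∣ ≤ 2
    between≤2 = ≤-trans (card-≤-inj (between P T) ⟦ n? ⟧ (λ t e → Q.original t ≡ e)
        (λ {t} h → Q.original t , ∈⟦⟧⁺ n? (located (between⁻ P T h)) , refl) (λ p q → Q.original-injective (trans p (sym q))))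
      (card-≤-length ⟦ n? ⟧ (n₁ ∷ n₂ ∷ []) (λ h → [ here , (λ eq → there (here eq)) ] (∈⟦⟧⁻ n? h)))
      where
      located : ∀ {t} → ∃[ x ] ∃[ y ] Graph.Joins Q.graph t x y × x ∈ P × y ∈ T → Q.original t ≡ n₁ ⊎ Q.original t ≡ n₂
      located {t} (x , y , l , x∈P , y∈T) with Q.joins⁻ l
      ... | u , v , m , u↦x , v↦y = at (joins-inc⁻ partner (subst (Incident u) (π-injective u~a) (partnerEdge-incident u)))
        where
        u~a : π u ≡ π a
        u~a = trans u↦x (x∈⁅y⁆⇒x≡y _ x∈P)
        y≢ : y ≢ π a × y ≢ π b
        y≢ = ∈⟦⟧⁻ pair? y∈T
        t∉M : Q.original t ∉ matching
        t∉M h = proj₁ y≢ (trans (sym v↦y) (trans (π-cong (trans (partnerEdge-unique h (joins-incʳ m)) (sym (partnerEdge-unique h (joins-incˡ m))))) u~a))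
        at : u ≡ a ⊎ u ≡ a′ → Q.original t ≡ n₁ ⊎ Q.original t ≡ n₂
        at (inj₁ refl) with nonMatching-pair e≢f e∉M f∉M t∉M (joins-incˡ j) (joins-incˡ k) (joins-incˡ m)
        ... | inj₁ eq = contradiction (trans (sym v↦y) (cong π (joins-unique m (subst (λ g → Joins g a b) (sym eq) j)))) (proj₂ y≢)
        ... | inj₂ eq = contradiction (trans (sym v↦y) (cong π (joins-unique m (subst (λ g → Joins g a b) (sym eq) k)))) (proj₂ y≢)
        at (inj₂ refl) with cover (joins-incˡ m)
        ... | inj₁ eq = contradiction (subst (_∈ matching) (sym eq) (partnerEdge-∈ a′)) t∉M
        ... | inj₂ h = h

-- Contracting the triangles of G − M

least : ∀ {n} {P : Fin n → Set} → (∀ x → Dec (P x)) → ∃ P → Fin n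
least {suc n} P? (x , px) with P? zero
... | yes _ = zero
least {suc n} P? (zero , px) | no ¬p = contradiction px ¬p
least {suc n} P? (suc x , px) | no _ = suc (least (P? ∘ suc) (x , px))

least-sound : ∀ {n} {P : Fin n → Set} (P? : ∀ x → Dec (P x)) (p : ∃ P) → P (least P? p)
least-sound {suc n} P? (x , px) with P? zero
... | yes p = p
least-sound {suc n} P? (zero , px) | no ¬p = contradiction px ¬p
least-sound {suc n} P? (suc x , px) | no _ = least-sound (P? ∘ suc) (x , px)

least-ext : ∀ {n} {P Q : Fin n → Set} (P? : ∀ x → Dec (P x)) (Q? : ∀ x → Dec (Q x)) (p : ∃ P) (q : ∃ Q) →
            (∀ {x} → P x → Q x) → (∀ {x} → Q x → P x) → least P? p ≡ least Q? q
least-ext {suc n} P? Q? (x , px) (y , qy) f g with P? zero | Q? zero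
... | yes _ | yes _ = refl
... | yes p | no ¬q = contradiction (f p) ¬q
... | no ¬p | yes q = contradiction (g q) ¬p
least-ext {suc n} P? Q? (zero , px) _ f g | no ¬p | no _ = contradiction px ¬p
least-ext {suc n} P? Q? (suc _ , _) (zero , qy) f g | no _ | no ¬q = contradiction qy ¬q
least-ext {suc n} P? Q? (suc x , px) (suc y , qy) f g | no _ | no _ =
  cong suc (least-ext (P? ∘ suc) (Q? ∘ suc) (x , px) (y , qy) f g)

record Classes {n : ℕ} (_≈_ : Fin n → Fin n → Set) : Set where
  field
    {count}    : ℕ
    π          : Fin n → Fin count
    sound      : ∀ {u v} → π u ≡ π v → u ≈ v
    complete   : ∀ {u v} → u ≈ v → π u ≡ π v
    surjective : ∀ c → ∃[ v ] π v ≡ c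

-- A class is represented by its least element, which by `least-ext` depends on the class alone; the
-- fixed points of `rep` are therefore one per class.
classes : ∀ {n} {_≈_ : Fin n → Fin n → Set} → (∀ u v → Dec (u ≈ v)) → (∀ {u} → u ≈ u) →
          (∀ {u v} → u ≈ v → v ≈ u) → (∀ {u v w} → u ≈ v → v ≈ w → u ≈ w) → Classes _≈_
classes {n} {_≈_} ≈? ≈-refl ≈-sym ≈-trans = record
  { π = π
  ; sound = λ {u} {v} eq → ≈-trans (rep-≈ u) (subst (_≈ v) (sym (reps-eq eq)) (≈-sym (rep-≈ v)))
  ; complete = λ {u} {v} u≈v → position-lookup (rep-idem u) (trans (lookup-position (rep-idem v)) (sym (rep-cong u≈v)))
  ; surjective = λ c → lookup elements c , position-lookup (rep-idem _) (sym (lookup-sound c)) }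
  where
  rep : Fin n → Fin n
  rep u = least (≈? u) (u , ≈-refl)
  rep-≈ : ∀ u → u ≈ rep u
  rep-≈ u = least-sound (≈? u) (u , ≈-refl)
  rep-cong : ∀ {u v} → u ≈ v → rep u ≡ rep v
  rep-cong {u} {v} u≈v = least-ext (≈? u) (≈? v) _ _ (≈-trans (≈-sym u≈v)) (≈-trans u≈v)
  open Enumeration (λ u → rep u ≟ u)
  rep-idem : ∀ u → rep (rep u) ≡ rep u
  rep-idem u = sym (rep-cong (rep-≈ u))
  π : Fin n → Fin (length elements)
  π u = position (rep-idem u)
  reps-eq : ∀ {u v} → π u ≡ π v → rep u ≡ rep v
  reps-eq {u} {v} eq = trans (sym (lookup-position (rep-idem u))) (trans (cong (lookup elements) eq) (lookup-position (rep-idem v)))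

module Triangles (G : Graph) (S : ∀ v → Cubics.Slots G v) (M : PerfectMatching G)
  (no-digon : ∀ {e f a b} → e ≢ f → e ∉ PerfectMatching.matching M → f ∉ PerfectMatching.matching M →
              Graph.Joins G e a b → ¬ Graph.Joins G f a b) where
  open Graph G
  open Basics G
  open Cubics G
  open PerfectMatching M
  open MatchingContraction G M using (partnerEdge; partnerEdge-∈; partnerEdge-incident; partnerEdge-unique)
  open MatchedVertex G S M

  N : Vertex → Vertex → Set
  N u w = ∃[ e ] e ∉ matching × Joins e u w

  N-sym : ∀ {u w} → N u w → N w u
  N-sym (e , e∉M , j) = e , e∉M , joins-sym j

  N-cover : ∀ {u w x y} → w ≢ x → N u w → N u x → N u y → y ≡ w ⊎ y ≡ x
  N-cover {u} {w} {x} w≢x (e , e∉M , j) (f , f∉M , k) (g , g∉M , l)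
    with nonMatching-pair (λ { refl → w≢x (joins-unique j k) }) e∉M f∉M g∉M (joins-incˡ j) (joins-incˡ k) (joins-incˡ l)
  ... | inj₁ refl = inj₁ (joins-unique l j)
  ... | inj₂ refl = inj₂ (joins-unique l k)

  -- Distinct partner edges make u, v, w distinct and all three partner edges leave the triangle.
  Triangle : Vertex → Vertex → Vertex → Set
  Triangle u v w = (N u v × N v w × N u w) × (partnerEdge u ≢ partnerEdge v × partnerEdge v ≢ partnerEdge w × partnerEdge u ≢ partnerEdge w)

  triangle? : ∀ u v w → Dec (Triangle u v w)
  triangle? u v w = (N? u v ×-dec N? v w ×-dec N? u w)
    ×-dec (¬? (partnerEdge u ≟ partnerEdge v) ×-dec ¬? (partnerEdge v ≟ partnerEdge w) ×-dec ¬? (partnerEdge u ≟ partnerEdge w))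
    where
    N? : ∀ u w → Dec (N u w)
    N? u w = any? (λ e → ¬? (e ∈? matching) ×-dec joins? e u w)

  triangle-rotate : ∀ {u v w} → Triangle u v w → Triangle v w u
  triangle-rotate ((a , b , c) , (p , q , r)) = (b , N-sym c , N-sym a) , (q , ≢-sym r , ≢-sym p)

  triangle-flip : ∀ {u v w} → Triangle u v w → Triangle v u w
  triangle-flip ((a , b , c) , (p , q , r)) = (N-sym a , c , b) , (≢-sym p , r , q)

  triangle-N : ∀ {u v w x} → Triangle u v w → N u x → x ≡ v ⊎ x ≡ w
  triangle-N ((a , b , c) , (p , q , r)) n = N-cover (λ { refl → q refl }) a c n

  infix 4 _≈_

  _≈_ : Vertex → Vertex → Set
  u ≈ v = u ≡ v ⊎ ∃[ w ] Triangle u v w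

  ≈? : ∀ u v → Dec (u ≈ v)
  ≈? u v = (u ≟ v) ⊎-dec any? (triangle? u v)

  ≈-refl : ∀ {u} → u ≈ u
  ≈-refl = inj₁ refl

  ≈-sym : ∀ {u v} → u ≈ v → v ≈ u
  ≈-sym (inj₁ refl) = inj₁ refl
  ≈-sym (inj₂ (w , t)) = inj₂ (w , triangle-flip t)

  triangle-≈ : ∀ {u v w x} → Triangle u v w → u ≈ x → x ≡ u ⊎ x ≡ v ⊎ x ≡ w
  triangle-≈ t (inj₁ refl) = inj₁ refl
  triangle-≈ t (inj₂ (y , (n , _) , _)) = inj₂ (triangle-N t n)

  -- A vertex has just two edges outside the matching, so it lies in only one triangle, and a class
  -- has either one or three vertices.
  ≈-trans : ∀ {u v w} → u ≈ v → v ≈ w → u ≈ w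
  ≈-trans (inj₁ refl) q = q
  ≈-trans (inj₂ (x , t)) q with triangle-≈ (triangle-flip t) q
  ... | inj₁ refl = inj₂ (x , t)
  ... | inj₂ (inj₁ refl) = inj₁ refl
  ... | inj₂ (inj₂ refl) = inj₂ (_ , triangle-flip (triangle-rotate (triangle-rotate t)))

  ≈-partner : ∀ {u v} → u ≈ v → partnerEdge u ≡ partnerEdge v → u ≡ v
  ≈-partner (inj₁ eq) _ = eq
  ≈-partner (inj₂ (_ , _ , (p , _))) eq = contradiction eq p

  module Contracted {k : ℕ} (π : Vertex → Fin k) (sound : ∀ {u v} → π u ≡ π v → u ≈ v)
    (complete : ∀ {u v} → u ≈ v → π u ≡ π v) (surjective : ∀ c → ∃[ v ] π v ≡ c) where

    open Quotient G π public
    module BH = Basics graph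
    module CH = Cubics graph

    partner-survives : ∀ v → ∃[ j ] original j ≡ partnerEdge v
    partner-survives v with inc-joins (partnerEdge-incident v)
    ... | w , l = let (j , eq , _) = lift-edge l leaves in j , eq
      where
      leaves : π v ≢ π w
      leaves eq = joins-≢ l (≈-partner (sound eq) (sym (partnerEdge-unique (partnerEdge-∈ v) (joins-incʳ l))))

    original-leaves : ∀ {j u w} → Joins (original j) u w → ¬ (u ≈ w)
    original-leaves {j} l u≈w = survive-joins l (lookup-sound j) (complete u≈w)

    -- The other two edges at `u` are sides of its triangle, and sides become loops and are dropped.
    triangle-exit : ∀ {j u v w} → Triangle u v w → Incident u (original j) → original j ≡ partnerEdge u
    triangle-exit {j} {u} t i with original j ∈? matching
    ... | yes m = sym (partnerEdge-unique m i)
    ... | no m∉ with inc-joins i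
    ... | x , l with triangle-N t (original j , m∉ , l)
    ... | inj₁ refl = contradiction (inj₂ (_ , t)) (original-leaves l)
    ... | inj₂ refl = contradiction (inj₂ (_ , triangle-flip (triangle-rotate (triangle-rotate t)))) (original-leaves l)

    -- The second component remembers which edge of `G` each slot comes from; the lift needs this to
    -- compare degrees before and after contraction.
    build-slots : ∀ c (f : Fin 3 → Edge) → (∀ {i j} → f i ≡ f j → i ≡ j) → (∀ i → ∃[ j ] original j ≡ f i) →
      (∀ i → ∃[ u ] Incident u (f i) × π u ≡ c) → (∀ {j u} → Incident u (original j) → π u ≡ c → ∃[ i ] f i ≡ original j) →
      ∃ λ (T : CH.Slots c) → ∀ i → original (CH.Slots.slot T i) ≡ f i
    build-slots c f inj lifted inc cover = record
      { slot = λ i → proj₁ (lifted i)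
      ; slot-inc = λ i → let (u , h , eq) = inc i in subst (λ c → Graph.Incident graph c (proj₁ (lifted i))) eq
          (incident⁺ (subst (Incident u) (sym (proj₂ (lifted i))) h))
      ; slot-inj = λ {i} {j} eq → inj (trans (sym (proj₂ (lifted i))) (trans (cong original eq) (proj₂ (lifted j))))
      ; slot-cover = λ {j} h → let (u , h′ , eq) = incident⁻ h in let (i , eq′) = cover h′ eq in
          i , original-injective (trans (proj₂ (lifted i)) eq′)
      } , λ i → proj₂ (lifted i)

    singleton-slots : ∀ v → (∀ {u} → v ≈ u → v ≡ u) →
      ∃ λ (T : CH.Slots (π v)) → ∀ i → original (CH.Slots.slot T i) ≡ Slots.slot (S v) i
    singleton-slots v single = build-slots (π v) slot slot-inj lifted
      (λ i → v , slot-inc i , refl) cover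
      where
      open Slots (S v)
      lifted : ∀ i → ∃[ j ] original j ≡ slot i
      lifted i with inc-joins (slot-inc i)
      ... | w , l = let (j , eq , _) = lift-edge l (λ eq → joins-≢ l (single (sound eq))) in j , eq
      cover : ∀ {j u} → Incident u (original j) → π u ≡ π v → ∃[ i ] slot i ≡ original j
      cover {j} h eq = slot-cover (subst (λ u → Incident u (original j)) (sym (single (≈-sym (sound eq)))) h)

    triple : ∀ {A : Set} → A → A → A → Fin 3 → A
    triple a b c zero = a
    triple a b c (suc zero) = b
    triple a b c (suc (suc zero)) = c

    triangle-slots : ∀ {u v w} → Triangle u v w →
      ∃ λ (T : CH.Slots (π u)) → ∀ i → original (CH.Slots.slot T i) ≡ triple (partnerEdge u) (partnerEdge v) (partnerEdge w) i
    triangle-slots {u} {v} {w} t = build-slots (π u) exit inj lifted inc cover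
      where
      exit : Fin 3 → Edge
      exit = triple (partnerEdge u) (partnerEdge v) (partnerEdge w)
      inj : ∀ {i j} → exit i ≡ exit j → i ≡ j
      inj {zero} {zero} _ = refl
      inj {zero} {suc zero} eq = contradiction eq (proj₁ (proj₂ t))
      inj {zero} {suc (suc zero)} eq = contradiction eq (proj₂ (proj₂ (proj₂ t)))
      inj {suc zero} {zero} eq = contradiction (sym eq) (proj₁ (proj₂ t))
      inj {suc zero} {suc zero} _ = refl
      inj {suc zero} {suc (suc zero)} eq = contradiction eq (proj₁ (proj₂ (proj₂ t)))
      inj {suc (suc zero)} {zero} eq = contradiction (sym eq) (proj₂ (proj₂ (proj₂ t)))
      inj {suc (suc zero)} {suc zero} eq = contradiction (sym eq) (proj₁ (proj₂ (proj₂ t)))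
      inj {suc (suc zero)} {suc (suc zero)} _ = refl
      lifted : ∀ i → ∃[ j ] original j ≡ exit i
      lifted zero = partner-survives u
      lifted (suc zero) = partner-survives v
      lifted (suc (suc zero)) = partner-survives w
      inc : ∀ i → ∃[ x ] Incident x (exit i) × π x ≡ π u
      inc zero = u , partnerEdge-incident u , refl
      inc (suc zero) = v , partnerEdge-incident v , complete (inj₂ (_ , triangle-flip t))
      inc (suc (suc zero)) = w , partnerEdge-incident w , complete (inj₂ (_ , triangle-rotate (triangle-rotate t)))
      cover : ∀ {j x} → Incident x (original j) → π x ≡ π u → ∃[ i ] exit i ≡ original j
      cover h eq with triangle-≈ t (≈-sym (sound eq))
      ... | inj₁ refl = zero , sym (triangle-exit t h)
      ... | inj₂ (inj₁ refl) = suc zero , sym (triangle-exit (triangle-rotate t) h)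
      ... | inj₂ (inj₂ refl) = suc (suc zero) , sym (triangle-exit (triangle-rotate (triangle-rotate t)) h)

    triangle⊎singleton : ∀ v → (∃[ w ] ∃[ z ] Triangle v w z) ⊎ (∀ {u} → v ≈ u → v ≡ u)
    triangle⊎singleton v with any? (λ w → any? (triangle? v w))
    ... | yes t = inj₁ t
    ... | no none = inj₂ λ { (inj₁ eq) → eq ; (inj₂ (w , t)) → contradiction (_ , w , t) none }

    slotsH : ∀ c → CH.Slots c
    slotsH c with surjective c
    ... | v , refl with triangle⊎singleton v
    ... | inj₁ (w , z , t) = proj₁ (triangle-slots t)
    ... | inj₂ single = proj₁ (singleton-slots v single)

    preimage? : ∀ (A : Subset k) v → Dec (π v ∈ A)
    preimage? A v = π v ∈? A

    preimage : Subset k → Subset order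
    preimage A = ⟦ preimage? A ⟧

    preimage⁺ : ∀ {A v} → π v ∈ A → v ∈ preimage A
    preimage⁺ {A} = ∈⟦⟧⁺ (preimage? A)

    preimage⁻ : ∀ {A v} → v ∈ preimage A → π v ∈ A
    preimage⁻ {A} = ∈⟦⟧⁻ (preimage? A)

    preimage-δ : ∀ A → ∣ δ (preimage A) ∣ ≤ ∣ CH.δ A ∣
    preimage-δ A = card-≤-inj (δ (preimage A)) (CH.δ A) (λ e j → original j ≡ e)
      (λ h → lift (δ⁻ h)) (λ p q → trans (sym p) q)
      where
      lift : ∀ {e} → ∃[ u ] ∃[ v ] Joins e u v × u ∈ preimage A × v ∉ preimage A → ∃[ j ] j ∈ CH.δ A × original j ≡ e
      lift (u , v , l , u∈ , v∉) with lift-edge l (λ eq → v∉ (preimage⁺ {A} (subst (_∈ A) eq (preimage⁻ {A} u∈))))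
      ... | j , eq , m = j , CH.δ⁺ m (preimage⁻ {A} u∈) (λ h → v∉ (preimage⁺ {A} h)) , eq

    -- A vertex of a contracted triangle keeps its matching edge only, so a surviving edge outside
    -- the matching ends at vertices that are alone in their classes.
    nonMatching-single : ∀ {j u v} → original j ∉ matching → Incident u (original j) → u ≈ v → u ≡ v
    nonMatching-single m∉ i (inj₁ eq) = eq
    nonMatching-single {u = u} m∉ i (inj₂ (w , t)) = contradiction
      (subst (_∈ matching) (sym (triangle-exit t i)) (partnerEdge-∈ u)) m∉

    -- Otherwise the cycle would be a cycle of G - M with at most three vertices, hence a contracted triangle.
    cycle⇒matching-inside : ∀ A → BH.CycleIn A → ∣ δ (preimage A) ∣ ≤ 3 →
      ∃[ e ] e ∈ matching × (∀ {v} → Incident v e → v ∈ preimage A)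
    cycle⇒matching-inside A (C , cyc , C⊆A) δ≤3 with any? (λ e → (e ∈? matching) ×-dec (proj₁ (ends e) ∈? preimage A) ×-dec (proj₂ (ends e) ∈? preimage A))
    ... | yes (e , e∈M , p , q) = e , e∈M , λ { (inj₁ refl) → p ; (inj₂ refl) → q }
    ... | no none = contradiction (proj₁ (proj₁ cyc)) λ (c , c∈C) → at-vertex c∈C (surjective c)
      where
      B : Subset order
      B = preimage A
      VC = Subgraph.vertices C
      EC = Subgraph.edges C
      none-inside : ∀ {e u v} → e ∈ matching → Joins e u v → u ∈ B → v ∉ B
      none-inside {e} e∈M (inj₁ refl) u∈ v∈ = none (e , e∈M , u∈ , v∈)
      none-inside {e} e∈M (inj₂ refl) u∈ v∈ = none (e , e∈M , v∈ , u∈)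
      partner-δ : ∀ {v} → v ∈ B → partnerEdge v ∈ δ B
      partner-δ {v} v∈ with inc-joins (partnerEdge-incident v)
      ... | w , l = δ⁺ l v∈ (none-inside (partnerEdge-∈ v) l v∈)
      partner-injective : ∀ {u v} → u ∈ B → v ∈ B → partnerEdge u ≡ partnerEdge v → u ≡ v
      partner-injective {u} {v} u∈ v∈ eq with inc-joins (partnerEdge-incident u)
      ... | w , l with joins-inc⁻ l (subst (Incident v) (sym eq) (partnerEdge-incident v))
      ... | inj₁ v≡u = sym v≡u
      ... | inj₂ refl = contradiction v∈ (none-inside (partnerEdge-∈ u) l u∈)
      -- No matching edge lies inside `B`, so the partner edges of its vertices are different edges
      -- of `δ B`.
      B≤3 : ∣ B ∣ ≤ 3
      B≤3 = ≤-trans (card-≤-inj B (δ B) (λ v e → v ∈ B × partnerEdge v ≡ e)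
        (λ {v} v∈ → partnerEdge v , partner-δ v∈ , v∈ , refl)
        (λ (p , p′) (q , q′) → partner-injective p q (trans p′ (sym q′)))) δ≤3
      C⇒B : ∀ {j u} → j ∈ EC → Incident u (original j) → u ∈ B
      C⇒B j∈ i = preimage⁺ {A} (C⊆A (Subgraph.closed C j∈ (incident⁺ i)))
      C⇒∉M : ∀ {j} → j ∈ EC → original j ∉ matching
      C⇒∉M {j} j∈ m = none-inside m (joins-ends _) (C⇒B j∈ (inj₁ refl)) (C⇒B j∈ (inj₂ refl))
      -- The cycle uses only edges outside the matching, whose ends form classes of their own. It
      -- can thus be traced in `G` itself, vertex by vertex.
      at : ∀ {j c v} → j ∈ EC → Graph.Incident graph c j → π v ≡ c → ∃[ w ] Joins (original j) v w
      at {j} {v = v} j∈ i eq with incident⁻ i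
      ... | u , h , eq′ with nonMatching-single {j} (C⇒∉M j∈) h (sound (trans eq′ (sym eq)))
      ... | refl = inc-joins h
      at-vertex : ∀ {c} → c ∈ VC → ∃[ v ] π v ≡ c → Empty.⊥
      at-vertex c∈C (v , refl) = first (CH.deg≡2⇒twoEdges (proj₂ cyc c∈C))
        where
        first : ¬ CH.TwoEdges EC (π v)
        first T with at T.e∈E T.inc-e refl | at T.f∈E T.inc-f refl
          where module T = CH.TwoEdges T
        ... | w , l | x , m = second (CH.deg≡2⇒twoEdges (proj₂ cyc (Subgraph.closed C T.e∈E (incident⁺ (joins-incʳ l)))))
          where
          module T = CH.TwoEdges T
          e≢f : original T.e ≢ original T.f
          e≢f eq = T.e≢f (original-injective eq)
          w≢x : w ≢ x
          w≢x refl = no-digon e≢f (C⇒∉M T.e∈E) (C⇒∉M T.f∈E) l m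
          v∈ = C⇒B T.e∈E (joins-incˡ l)
          w∈ = C⇒B T.e∈E (joins-incʳ l)
          x∈ = C⇒B T.f∈E (joins-incʳ m)
          -- The cycle passes through `x`, `v`, `w` and continues to `y`. The case `y = v` gives
          -- parallel edges; `y = x` gives a triangle, which would have been contracted; any other
          -- `y` is a fourth vertex of `B`.
          third : ∀ {g} → g ∈ EC → g ≢ T.e → ∃[ y ] Joins (original g) w y → Empty.⊥
          third {g} g∈ g≢e (y , n) with y ≟ v | y ≟ x
          ... | yes refl | _ = no-digon (λ eq → g≢e (original-injective eq)) (C⇒∉M g∈) (C⇒∉M T.e∈E) (joins-sym n) l
          ... | no _ | yes refl = original-leaves l (inj₂ (x , ((original T.e , C⇒∉M T.e∈E , l) , (original g , C⇒∉M g∈ , n) , (original T.f , C⇒∉M T.f∈E , m)) ,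
              ((λ eq → joins-≢ l (partner-injective v∈ w∈ eq)) , (λ eq → w≢x (partner-injective w∈ x∈ eq)) , (λ eq → joins-≢ m (partner-injective v∈ x∈ eq)))))
          ... | no y≢v | no y≢x = 1+n≰n (≤-trans (length-≤-card B (y ∷ v ∷ w ∷ x ∷ [])
              ((y≢v ∷ ≢-sym (joins-≢ n) ∷ y≢x ∷ []) ∷ (joins-≢ l ∷ joins-≢ m ∷ []) ∷ (w≢x ∷ []) ∷ [] ∷ [])
              (C⇒B g∈ (joins-incʳ n) ∷ v∈ ∷ w∈ ∷ x∈ ∷ [])) B≤3)
          second : ¬ CH.TwoEdges EC (π w)
          second T′ with CH.TwoEdges.e T′ ≟ T.e
          ... | no g≢e = third (CH.TwoEdges.e∈E T′) g≢e (at (CH.TwoEdges.e∈E T′) (CH.TwoEdges.inc-e T′) refl)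
          ... | yes eq = third (CH.TwoEdges.f∈E T′) (λ eq′ → CH.TwoEdges.e≢f T′ (trans eq (sym eq′)))
                           (at (CH.TwoEdges.f∈E T′) (CH.TwoEdges.inc-f T′) refl)

-- Cuts of the contracted graph and lifting of its cycles

-- Here `a`, `b`, `c` say which corners of a contracted triangle are exits of the cycle, and exactly
-- two are. The sum is the degree of the first corner in the lift: its exit edge, and each of its
-- two sides unless that side joins two exits.
not-both : ∀ a b c → (if a then 1 else 0) + ((if b then 1 else 0) + (if c then 1 else 0)) ≡ 2 →
  (if a then 1 else 0) + ((if not (a ∧ b) then 1 else 0) + (if not (a ∧ c) then 1 else 0)) ≡ 2
not-both true true false _ = refl
not-both true false true _ = refl
not-both false true true _ = refl
not-both true true true ()
not-both true false false ()
not-both false true false ()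
not-both false false true ()
not-both false false false ()

not-all : ∀ {A B C : Set} (a : Dec A) (b : Dec B) (c : Dec C) → bit a + (bit b + bit c) ≡ 2 → A → B → ¬ C
not-all (yes _) (yes _) (yes _) () _ _ _
not-all (no ¬a) _ _ _ a _ _ = ¬a a
not-all _ (no ¬b) _ _ _ b _ = ¬b b
not-all _ _ (no ¬c) _ _ _ c = ¬c c

module TriangleContraction (G : Graph) (S : ∀ v → Cubics.Slots G v) (M : PerfectMatching G)
  (no-digon : ∀ {e f a b} → e ≢ f → e ∉ PerfectMatching.matching M → f ∉ PerfectMatching.matching M →
              Graph.Joins G e a b → ¬ Graph.Joins G f a b)
  (small-cut : ∀ A → ∣ Cubics.δ G A ∣ ≤ 3 → ∀ {e f} → e ∈ PerfectMatching.matching M → f ∈ PerfectMatching.matching M →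
               (∀ {v} → Graph.Incident G v e → v ∈ A) → ¬ (∀ {v} → Graph.Incident G v f → v ∉ A))
  {k : ℕ} (π : Graph.Vertex G → Fin k)
  (sound : ∀ {u v} → π u ≡ π v → Triangles._≈_ G S M no-digon u v)
  (complete : ∀ {u v} → Triangles._≈_ G S M no-digon u v → π u ≡ π v)
  (surjective : ∀ c → ∃[ v ] π v ≡ c) where

  open Graph G
  open Basics G
  open Cubics G
  open PerfectMatching M
  open MatchingContraction G M using (partnerEdge; partnerEdge-∈; partnerEdge-incident; partnerEdge-unique)
  open MatchedVertex G S M
  open Triangles G S M no-digon
  open Contracted π sound complete surjective

  -- A component that is not everything would have a preimage with empty boundary, and partner edges
  -- lie entirely inside it and entirely outside it, against `small-cut`.
  contracted-connected : Vertex → Connected (whole graph)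
  contracted-connected v₀ = (π v₀ , ∈⊤) , λ {x} {y} _ _ → star x y
    where
    star : ∀ x y → Star (BH.Adj ⊤) x y
    star x y with Reachability.reachable (BH.adj? ⊤) x
    ... | T , x∈T , T-closed , reach with y ∈? T
    ... | yes y∈T = reach y∈T
    ... | no y∉T = absurd (surjective x) (surjective y)
      where
      δ-empty : ∀ {e} → e ∉ CH.δ T
      δ-empty h with CH.δ⁻ h
      ... | u , v , j , u∈ , v∉ = v∉ (T-closed u∈ (_ , ∈⊤ , j))
      δ≤0 : ∣ δ (preimage T) ∣ ≤ 0
      δ≤0 = ≤-trans (preimage-δ T) (card-≤-length (CH.δ T) [] (λ h → contradiction h δ-empty))
      unsplit : ∀ {e u v} → Joins e u v → u ∈ preimage T → v ∈ preimage T
      unsplit {v = v} j u∈ with v ∈? preimage T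
      ... | yes v∈ = v∈
      ... | no v∉ = contradiction (≤-trans (≤-reflexive (sym (∣minus∣ (δ (preimage T)) (δ⁺ j u∈ v∉)))) δ≤0) λ ()
      absurd : ∃[ u ] π u ≡ x → ∃[ v ] π v ≡ y → Star (BH.Adj ⊤) x y
      absurd (u , refl) (v , refl) = contradiction {A = ∀ {w} → Incident w (partnerEdge v) → w ∉ preimage T} out
        (small-cut (preimage T) (≤-trans δ≤0 z≤n) (partnerEdge-∈ u) (partnerEdge-∈ v) ins)
        where
        ins : ∀ {w} → Incident w (partnerEdge u) → w ∈ preimage T
        ins i with inc-joins (partnerEdge-incident u)
        ... | u′ , l with joins-inc⁻ l i
        ... | inj₁ refl = preimage⁺ {T} x∈T
        ... | inj₂ refl = unsplit l (preimage⁺ {T} x∈T)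
        out : ∀ {w} → Incident w (partnerEdge v) → w ∉ preimage T
        out i w∈ with inc-joins (partnerEdge-incident v)
        ... | v′ , l with joins-inc⁻ l i
        ... | inj₁ refl = y∉T (preimage⁻ {T} w∈)
        ... | inj₂ refl = y∉T (preimage⁻ {T} (unsplit (joins-sym l) w∈))

  -- All edges leaving the vertex set of `K` belong to `F`. If `F` had at most three edges, the
  -- cycles in `K` and `L` would each force a matching edge onto their side, against `small-cut`.
  -- Failure to be a tree gives a cycle only under double negation, which suffices for deriving a
  -- contradiction.
  no-small-cyclic-cut : ∀ F → IsCyclicEdgeCut graph F → 4 ≤ ∣ F ∣
  no-small-cyclic-cut F (_ , K , L , compK , compL , differ , ¬treeK , ¬treeL) = ℕ.≰⇒> λ F≤3 →
    ¬treeK (proj₁ (proj₂ compK) , λ (C , cycC , C⊑K) →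
      ¬treeL (proj₁ (proj₂ compL) , λ (D , cycD , D⊑L) → absurd F≤3 (C , cycC , proj₁ C⊑K) (D , cycD , proj₁ D⊑L)))
    where
    open EdgeCuts graph
    A : Subset k
    A = Subgraph.vertices K
    δA⊆F : CH.δ A ⊆ F
    δA⊆F {e} h with CH.δ⁻ h | e ∈? F
    ... | _ | yes e∈F = e∈F
    ... | u , v , j , u∈ , v∉ | no e∉F = contradiction (proj₁ (proj₁ (isComponent⇒⊒ K compK u∈))
      (component-step F u (x∉p⇒x∈∁p e∉F) j (component-root F u))) v∉
    -- Components with a common vertex `v` both coincide with the component of `v`.
    apart : ∀ {v} → v ∈ A → v ∉ Subgraph.vertices L
    apart {v} v∈K v∈L = differ
      (((λ h → proj₁ ⊑L (proj₁ K⊑ h)) , (λ h → proj₂ ⊑L (proj₂ K⊑ h))) ,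
       ((λ h → proj₁ ⊑K (proj₁ L⊑ h)) , (λ h → proj₂ ⊑K (proj₂ L⊑ h))))
      where
      ⊑K = proj₁ (isComponent⇒⊒ K compK v∈K)
      K⊑ = proj₂ (isComponent⇒⊒ K compK v∈K)
      ⊑L = proj₁ (isComponent⇒⊒ L compL v∈L)
      L⊑ = proj₂ (isComponent⇒⊒ L compL v∈L)
    absurd : ∣ F ∣ ≤ 3 → (∃[ C ] IsCycle {graph} C × Subgraph.vertices C ⊆ A) →
             (∃[ D ] IsCycle {graph} D × Subgraph.vertices D ⊆ Subgraph.vertices L) → Empty.⊥
    absurd F≤3 cycleK (D , cycD , D⊆L) =
      let (e , e∈M , e⊆) = cycle⇒matching-inside A cycleK δ≤3
          (f , f∈M , f⊆) = cycle⇒matching-inside (∁ A) (D , cycD , λ h → x∉p⇒x∈∁p (λ h′ → apart h′ (D⊆L h))) ∁δ≤3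
      in small-cut (preimage A) δ≤3 e∈M f∈M e⊆ (λ i h → x∈∁p⇒x∉p (preimage⁻ {∁ A} (f⊆ i)) (preimage⁻ {A} h))
      where
      δA≤3 : ∣ CH.δ A ∣ ≤ 3
      δA≤3 = ≤-trans (p⊆q⇒∣p∣≤∣q∣ {p = CH.δ A} {q = F} δA⊆F) F≤3
      δ≤3 : ∣ δ (preimage A) ∣ ≤ 3
      δ≤3 = ≤-trans (preimage-δ A) δA≤3
      ∁δ≤3 : ∣ δ (preimage (∁ A)) ∣ ≤ 3
      ∁δ≤3 = ≤-trans (preimage-δ (∁ A)) (≤-trans (p⊆q⇒∣p∣≤∣q∣ {p = CH.δ (∁ A)} {q = CH.δ A} CH.δ-∁) δA≤3)

  contracted-cubic : Cubic graph
  contracted-cubic c = CH.slots⇒deg≡3 (slotsH c)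

  module Lift (D : Subgraph graph) (cyc : IsCycle {graph} D) (dom : Dominates D ⊤) where
    open Subgraph D renaming (vertices to VD; edges to ED; closed to closedD)

    Used : Edge → Set
    Used e = ∃[ j ] original j ≡ e × j ∈ ED

    used? : ∀ e → Dec (Used e)
    used? e = any? (λ j → (original j ≟ e) ×-dec (j ∈? ED))

    -- In a contracted triangle on D, an edge is kept unless both its ends are exits of D.
    Inner : Edge → Set
    Inner e = π (proj₁ (ends e)) ≡ π (proj₂ (ends e)) × π (proj₁ (ends e)) ∈ VD ×
              ¬ (Used (partnerEdge (proj₁ (ends e))) × Used (partnerEdge (proj₂ (ends e))))

    kept? : ∀ e → Dec (Used e ⊎ Inner e)
    kept? e = used? e ⊎-dec ((π (proj₁ (ends e)) ≟ π (proj₂ (ends e))) ×-dec (π (proj₁ (ends e)) ∈? VD)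
      ×-dec ¬? (used? (partnerEdge (proj₁ (ends e))) ×-dec used? (partnerEdge (proj₂ (ends e)))))

    V : Subset order
    V = preimage VD

    E : Subset size
    E = ⟦ kept? ⟧

    used-leaves : ∀ {e u w} → Used e → Joins e u w → π u ≢ π w
    used-leaves (j , refl , _) l eq = original-leaves {j} l (sound eq)

    inner⁺ : ∀ {e u w} → Joins e u w → π u ≡ π w → π u ∈ VD → ¬ (Used (partnerEdge u) × Used (partnerEdge w)) → e ∈ E
    inner⁺ (inj₁ refl) eq u∈ ¬both = ∈⟦⟧⁺ kept? (inj₂ (eq , u∈ , ¬both))
    inner⁺ (inj₂ refl) eq u∈ ¬both = ∈⟦⟧⁺ kept? (inj₂ (sym eq , subst (_∈ VD) eq u∈ , λ (p , q) → ¬both (q , p)))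

    inner⁻ : ∀ {e u w} → Joins e u w → π u ≡ π w → e ∈ E → ¬ (Used (partnerEdge u) × Used (partnerEdge w))
    inner⁻ l eq h with ∈⟦⟧⁻ kept? h
    ... | inj₁ used = contradiction eq (used-leaves used l)
    inner⁻ (inj₁ refl) eq h | inj₂ (_ , _ , ¬both) = ¬both
    inner⁻ (inj₂ refl) eq h | inj₂ (_ , _ , ¬both) = λ (p , q) → ¬both (q , p)

    E-closed : ∀ {e v} → e ∈ E → Incident v e → v ∈ V
    E-closed h i with ∈⟦⟧⁻ kept? h
    ... | inj₁ (j , refl , j∈) = preimage⁺ {VD} (closedD j∈ (incident⁺ i))
    E-closed h (inj₁ refl) | inj₂ (eq , v∈ , _) = preimage⁺ {VD} v∈
    E-closed h (inj₂ refl) | inj₂ (eq , v∈ , _) = preimage⁺ {VD} (subst (_∈ VD) eq v∈)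

    used-bit : ∀ {j e} → original j ≡ e → bit (j ∈? ED) ≡ bit (used? e)
    used-bit {j} {e} eq = bit-cong (j ∈? ED) (used? e) (λ h → j , eq , h)
      (λ (j′ , eq′ , h) → subst (_∈ ED) (original-injective (trans eq′ (sym eq))) h)

    module _ {u v w} (t : Triangle u v w) (u∈ : π u ∈ VD) where

      -- The three edges at a contracted triangle are the partner edges of its corners, and `D` has
      -- degree 2 there.
      exits : bit (used? (partnerEdge u)) + (bit (used? (partnerEdge v)) + bit (used? (partnerEdge w))) ≡ 2
      exits = trans (sym (trans (CH.deg-slots T ED) (cong₂ _+_ (used-bit (eqs zero)) (cong₂ _+_ (used-bit (eqs (suc zero))) (used-bit (eqs (suc (suc zero))))))))
        (proj₂ cyc u∈)
        where
        T = proj₁ (triangle-slots t)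
        eqs = proj₂ (triangle-slots t)

      u~v : π u ≡ π v
      u~v = complete (inj₂ (_ , t))

      u~w : π u ≡ π w
      u~w = complete (inj₂ (_ , triangle-flip (triangle-rotate (triangle-rotate t))))

      private
        uv = proj₁ (proj₁ t)
        uw = proj₂ (proj₂ (proj₁ t))
        side-edges : Fin 3 → Edge
        side-edges = triple (partnerEdge u) (proj₁ uv) (proj₁ uw)

      triangle-side-slots : ∃ λ (T : Slots u) → ∀ i → Slots.slot T i ≡ side-edges i
      triangle-side-slots = record { slot = side-edges ; slot-inc = inc ; slot-inj = inj ; slot-cover = cover } , λ i → refl
        where
        m≢ : ∀ {e} → e ∉ matching → partnerEdge u ≢ e
        m≢ e∉M refl = e∉M (partnerEdge-∈ u)
        v≢w : v ≢ w
        v≢w refl = proj₁ (proj₂ (proj₂ t)) refl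
        edges-≢ : proj₁ uv ≢ proj₁ uw
        edges-≢ eq = v≢w (joins-unique (proj₂ (proj₂ uv)) (subst (λ e → Joins e u w) (sym eq) (proj₂ (proj₂ uw))))
        inc : ∀ i → Incident u (side-edges i)
        inc zero = partnerEdge-incident u
        inc (suc zero) = joins-incˡ (proj₂ (proj₂ uv))
        inc (suc (suc zero)) = joins-incˡ (proj₂ (proj₂ uw))
        inj : ∀ {i j} → side-edges i ≡ side-edges j → i ≡ j
        inj {zero} {zero} _ = refl
        inj {zero} {suc zero} eq = contradiction eq (m≢ (proj₁ (proj₂ uv)))
        inj {zero} {suc (suc zero)} eq = contradiction eq (m≢ (proj₁ (proj₂ uw)))
        inj {suc zero} {zero} eq = contradiction (sym eq) (m≢ (proj₁ (proj₂ uv)))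
        inj {suc zero} {suc zero} _ = refl
        inj {suc zero} {suc (suc zero)} eq = contradiction eq edges-≢
        inj {suc (suc zero)} {zero} eq = contradiction (sym eq) (m≢ (proj₁ (proj₂ uw)))
        inj {suc (suc zero)} {suc zero} eq = contradiction (sym eq) edges-≢
        inj {suc (suc zero)} {suc (suc zero)} _ = refl
        cover : ∀ {e} → Incident u e → ∃[ i ] side-edges i ≡ e
        cover {e} i with e ∈? matching
        ... | yes e∈M = zero , partnerEdge-unique e∈M i
        ... | no e∉M with nonMatching-pair edges-≢ (proj₁ (proj₂ uv)) (proj₁ (proj₂ uw)) e∉M (inc (suc zero)) (inc (suc (suc zero))) i
        ... | inj₁ eq = suc zero , sym eq
        ... | inj₂ eq = suc (suc zero) , sym eq

      triangle-degree : deg E u ≡ 2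
      triangle-degree = trans (deg-slots T E) (trans (cong₂ _+_ exit-bit (cong₂ _+_ (side-bit (proj₂ (proj₂ uv)) u~v) (side-bit (proj₂ (proj₂ uw)) u~w)))
        (not-both (does (used? (partnerEdge u))) (does (used? (partnerEdge v))) (does (used? (partnerEdge w))) exits))
        where
        T = proj₁ triangle-side-slots
        exit-bit : bit (partnerEdge u ∈? E) ≡ bit (used? (partnerEdge u))
        exit-bit = bit-cong (partnerEdge u ∈? E) (used? (partnerEdge u)) to (λ h → ∈⟦⟧⁺ kept? (inj₁ h))
          where
          to : partnerEdge u ∈ E → Used (partnerEdge u)
          to h with ∈⟦⟧⁻ kept? h
          ... | inj₁ used = used
          ... | inj₂ (eq , _) with partner-survives u
          ... | j , eq′ = contradiction eq (subst (λ e → π (proj₁ (ends e)) ≢ π (proj₂ (ends e))) eq′ (lookup-sound j))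
        side-bit : ∀ {e x} → Joins e u x → π u ≡ π x → bit (e ∈? E) ≡ bit (¬? (used? (partnerEdge u) ×-dec used? (partnerEdge x)))
        side-bit {e} {x} l eq = bit-cong (e ∈? E) (¬? (used? (partnerEdge u) ×-dec used? (partnerEdge x)))
          (inner⁻ l eq) (inner⁺ l eq u∈)

      -- The direct edge uv is dropped only when w is not an exit, and then the detour through w is kept.
      triangle-connected : Star (Adj E) u v
      triangle-connected with used? (partnerEdge u) ×-dec used? (partnerEdge v)
      ... | no ¬both = (_ , inner⁺ (proj₂ (proj₂ uv)) u~v u∈ ¬both , proj₂ (proj₂ uv)) ◅ ε
      ... | yes (p , q) = (_ , inner⁺ (proj₂ (proj₂ uw)) u~w u∈ (λ (_ , r) → ¬r r) , proj₂ (proj₂ uw)) ◅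
                          (_ , inner⁺ (joins-sym (proj₂ (proj₂ vw))) (trans (sym u~w) u~v) (subst (_∈ VD) u~w u∈) (λ (r , _) → ¬r r) , joins-sym (proj₂ (proj₂ vw))) ◅ ε
        where
        vw = proj₁ (proj₂ (proj₁ t))
        ¬r : ¬ Used (partnerEdge w)
        ¬r = not-all (used? (partnerEdge u)) (used? (partnerEdge v)) (used? (partnerEdge w)) exits p q

    singleton-degree : ∀ {v} → (∀ {u} → v ≈ u → v ≡ u) → π v ∈ VD → deg E v ≡ 2
    singleton-degree {v} single v∈ = trans (deg-slots (S v) E) (trans
        (cong₂ _+_ (same zero) (cong₂ _+_ (same (suc zero)) (same (suc (suc zero)))))
        (trans (sym (CH.deg-slots T ED)) (proj₂ cyc v∈)))
      where
      open Slots (S v)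
      T = proj₁ (singleton-slots v single)
      same : ∀ i → bit (slot i ∈? E) ≡ bit (CH.Slots.slot T i ∈? ED)
      same i = trans (bit-cong (slot i ∈? E) (used? (slot i)) to (λ h → ∈⟦⟧⁺ kept? (inj₁ h)))
        (sym (used-bit (proj₂ (singleton-slots v single) i)))
        where
        to : slot i ∈ E → Used (slot i)
        to h with ∈⟦⟧⁻ kept? h
        ... | inj₁ used = used
        ... | inj₂ (eq , _) = contradiction eq
          (subst (λ e → π (proj₁ (ends e)) ≢ π (proj₂ (ends e))) (proj₂ (singleton-slots v single) i) (lookup-sound _))

    class-connected : ∀ {u v} → π u ≡ π v → π u ∈ VD → Star (Adj E) u v
    class-connected eq u∈ with sound eq
    ... | inj₁ refl = ε
    ... | inj₂ (w , t) = triangle-connected t u∈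

    lift-star : ∀ {x y} → Star (BH.Adj ED) x y → y ∈ VD → ∀ {u v} → π u ≡ x → π v ≡ y → Star (Adj E) u v
    lift-star ε y∈ refl eq = class-connected (sym eq) y∈
    lift-star ((j , j∈ , l) ◅ rs) y∈ refl eq with joins⁻ l
    ... | a , b , m , a↦ , b↦ = class-connected (sym a↦) (closedD j∈ (BH.joins-incˡ l))
      ◅◅ ((original j , ∈⟦⟧⁺ kept? (inj₁ (j , refl , j∈)) , m) ◅ lift-star rs y∈ b↦ eq)

    lifted : ∃[ C ] IsCycle {G} C × Dominates C matching
    lifted = record { vertices = V ; edges = E ; closed = E-closed } ,
      ((nonempty (proj₁ (proj₁ cyc)) , λ u∈ v∈ → lift-star (proj₂ (proj₁ cyc) (preimage⁻ {VD} u∈) (preimage⁻ {VD} v∈)) (preimage⁻ {VD} v∈) refl refl) ,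
       λ {v} v∈ → two v (preimage⁻ {VD} v∈)) ,
      λ {e} e∈M → dominates e e∈M
      where
      nonempty : Nonempty VD → Nonempty V
      nonempty (c , c∈) = let (v , eq) = surjective c in v , preimage⁺ {VD} (subst (_∈ VD) (sym eq) c∈)
      two : ∀ v → π v ∈ VD → deg E v ≡ 2
      two v v∈ with triangle⊎singleton v
      ... | inj₁ (w , z , t) = triangle-degree t v∈
      ... | inj₂ single = singleton-degree single v∈
      -- Every matching edge survives in the contraction, so `D` meets it in some class; `V`
      -- contains whole classes, hence also the end of the edge in that class.
      dominates : ∀ e → e ∈ matching → ∃[ v ] v ∈ V × Incident v e
      dominates e e∈M with partner-survives (proj₁ (ends e))
      ... | j , eq with dom {j} ∈⊤
      ... | c , c∈ , i with incident⁻ i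
      ... | u , h , eq′ = u , preimage⁺ {VD} (subst (_∈ VD) (sym eq′) c∈) ,
        subst (Incident u) (trans eq (partnerEdge-unique e∈M (inj₁ refl))) h

  -- The search for a dominating cycle comes first. If it failed, (DCC) would refute cyclic 4-edge
  -- connectivity, which holds under double negation as soon as there are two disjoint cycles.
  contract-and-lift : StatementDCC → Vertex → ∃[ C ] IsCycle {G} C × Dominates C matching
  contract-and-lift dcc v = let (D , cyc , dom) = dominatingCycle in Lift.lifted D cyc dom
    where
    dominatingCycle : ∃[ D ] IsDominatingCycle {graph} D
    dominatingCycle with Domination.twoDisjoint⊎dominating graph slotsH (π v) | EdgeCuts.dominatingCycle? graph ⊤
    ... | inj₂ found | _ = found
    ... | inj₁ _ | yes found = found
    ... | inj₁ two | no none = contradiction (λ c → none (dcc graph contracted-cubic c))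
      (EdgeCuts.cyclicallyEdgeConnected graph (contracted-connected v) two no-small-cyclic-cut)

DCC⇒A : StatementDCC → StatementA
DCC⇒A dcc G cubic M connected = from-slots (λ v → Cubics.deg≡3⇒slots G (cubic v))
  where
  from-slots : (∀ v → Cubics.Slots G v) → ∃[ C ] IsCycle {G} C × Dominates C (PerfectMatching.matching M)
  from-slots S = from-classes (classes ≈? ≈-refl ≈-sym ≈-trans)
    where
    open MatchingContraction G M using (π; label; label-∈; label-injective; label-π)
    open FourConnectedContraction G S M π label label-∈ label-injective label-π connected using (no-digon; small-cut)
    open Triangles G S M no-digon
    from-classes : Classes _≈_ → ∃[ C ] IsCycle {G} C × Dominates C (PerfectMatching.matching M)
    from-classes record { π = π ; sound = sound ; complete = complete ; surjective = surjective } =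
      TriangleContraction.contract-and-lift G S M no-digon small-cut π sound complete surjective dcc vertex
      where
      vertex : Graph.Vertex G
      -- The order of the contraction exceeds 4, so it has a vertex, and `π` is surjective.
      vertex = proj₁ (MatchingContraction.π-surjective G M (fromℕ< (≤-trans (s≤s z≤n) (proj₁ connected))))

corollary2p9 : ((G : Graph) → Cubic G → (M : PerfectMatching G) → VertexConnected (G /ᴹ M) 4 →
    ∃[ C ] IsCycle {G} C × Dominates C (PerfectMatching.matching M))
    ⇔
    ((G : Graph) → Cubic G → CyclicallyEdgeConnected G 4 →
    ∃[ C ] IsDominatingCycle {G} C)
corollary2p9 = mk⇔ A⇒DCC DCC⇒A
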